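{- The following is provable in $\mathrm{BZFC}$: for all sets $A$ and $B$, $$|A|=|B|\;\Leftrightarrow\; A\cong B,$$ i.e. $|A|=|B|$ is true iff $A\cong B$ is true, and $|A|=|B|$ is false iff $A\cong B$ is false.
   Context: Logic. The background logic is the four-valued first-order logic BS4 with primitives $\sim,\land,\lor,\rightarrow,\leftrightarrow,\bot,\forall,\exists$. A model has a non-empty domain $M$, the usual interpretations of constants and function symbols, and, for each $n$-ary relation symbol $R$, two independent interpretations $R^+,R^-\subseteq M^n$; $=^+$ is true identity and $=^-$ is a symmetric relation. Truth and falsity are defined simultaneously (a formula may be true, false, both, or neither): an atomic formula is true/false according to $R^+$/$R^-$; $\sim\varphi$ is true iff $\varphi$ is false, and false iff $\varphi$ is true; $\varphi\land\psi$ is true iff both are true, false iff at least one is false; $\lor$ dually; $\varphi\rightarrow\psi$ is true iff ($\varphi$ true implies $\psi$ true), false iff $\varphi$ is true and $\psi$ is false; $\varphi\leftrightarrow\psi$ is true iff ($\varphi$ true iff $\psi$ true), false iff ($\varphi$ true and $\psi$ false) or ($\varphi$ false and $\psi$ true); $\forall$ is true iff all instances are true, false iff some instance is false; $\exists$ is true iff some instance is true, false iff all instances are false; $\bot$ is false and not true. $\Gamma\vDash\varphi$ iff $\varphi$ is true in every model in which all of $\Gamma$ is true. Asserting a formula means asserting that it is true; English "iff", "if/then", "and", "or" between formulas concern truth. Abbreviations: $\neg\varphi:=\varphi\rightarrow\bot$ (true iff $\varphi$ is not true); $!\varphi:=\sim\neg\varphi$ (two-valued, true iff $\varphi$ is true);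 $?\varphi:=\neg\sim\varphi$ (two-valued, true iff $\varphi$ is not false); $\circ\varphi:=\,!\varphi\leftrightarrow ?\varphi$; $\varphi\Rightarrow\psi:=(\varphi\rightarrow\psi)\land(\sim\psi\rightarrow\sim\varphi)$; $\varphi\Leftrightarrow\psi:=(\varphi\leftrightarrow\psi)\land(\sim\varphi\leftrightarrow\sim\psi)$; $\varphi\,\&\,\psi:=\,\sim(\varphi\rightarrow\sim\psi)$; $\exists x\in A\,\varphi:=\exists x(x\in A\,\&\,\varphi)$; $\forall x\in A\,\varphi:=\forall x(x\in A\rightarrow\varphi)$. A slashed relation symbol ($\neq,\notin,\not\subseteq,\not\cong,\not\preceq$) is the $\sim$-negation of the relation. Set theory. $\mathrm{BZFC}$ is a BS4-theory in the language $\{\in,=\}$ whose objects are called sets. It includes: Extensionality $\forall A\forall B(A=B\Leftrightarrow\forall x(x\in A\Leftrightarrow x\in B))$; Comprehension $\forall A\exists B\forall x(x\in B\Leftrightarrow x\in A\land\varphi(x))$; ACLA: $\exists A(A^!\not\subseteq A^?)\land\exists A(A^?\not\subseteq A^!)$; Choice: every classical set of non-empty sets has a choice function. Here $A=\{x:\varphi(x)\}$ means $\forall x(x\in A\Leftrightarrow\varphi(x))$; $A\subseteq B:=\forall x(x\in A\Rightarrow x\in B)$; $A$ is classical if $\forall x\,{\circ}(x\in A)$; $A^!:=\{x:{!}(x\in A)\}$ and $A^?:=\{x:{?}(x\in A)\}$. The remaining axioms are suitable analogues of those of $\mathrm{ZFC}$; available consequences are: $A^!,A^?$ are (classical) sets;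 $A\subseteq B\leftrightarrow(A^!\subseteq B^!\land A^?\subseteq B^?)$, $A\not\subseteq B\leftrightarrow A^!\not\subseteq B^?$, $A=B\leftrightarrow(A^!=B^!\land A^?=B^?)$, $A\neq B\leftrightarrow(A^!\not\subseteq B^?\lor B^!\not\subseteq A^?)$; for all classical sets $X,Y$ there is a unique set $\langle X|Y\rangle$ with $\langle X|Y\rangle^!=X$, $\langle X|Y\rangle^?=Y$; ordered pairs (and triples) are encoded so that $(a,b)=(c,d)\Leftrightarrow(a=c\land b=d)$; usual $\mathrm{ZFC}$ set theory (including choice and von Neumann ordinals, which live in the inner $\mathrm{ZFC}$-model of hereditarily classical sets) applies to classical sets, whose elements may be arbitrary sets. For a classical set $X$, $|X|_{Cl}$ is the least von Neumann ordinal in bijection with $X$. Put $A_{\mathbf b}:=A^!\setminus A^?$, $A_{\mathbf t}:=A^!\cap A^?$, $A_{\mathbf n}:=A^?\setminus A^!$, $\mathrm{rlm}(A):=A^!\cup A^?$ (all classical sets). Functions and equinumerosity. A classical function is a classical set $f$ of ordered pairs with $((a,b)\in f\land(a,c)\in f)\rightarrow{!}(b=c)$; it is an injection if $((a,c)\in f\land(b,c)\in f)\rightarrow{!}(a=b)$. For $A\subseteq\mathrm{dom}(f)$, $f[A]:=\{y:\exists x(y=f(x)\,\&\,x\in A)\}$, so $f[A]^!=f[A^!]$ and $f[A]^?=f[A^?]$. A counting of $A$ is an injection with domain $\mathrm{rlm}(A)$; $\mathrm{Count}(A)$ is the class of countings of $A$. Define $$A\cong B:=\exists f\in\mathrm{Count}(A)\,\exists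 g\in\mathrm{Count}(B)\,(f[A]=g[B]).$$ Thus $A\not\cong B$ is true iff $f[A]\neq g[B]$ for all $f\in\mathrm{Count}(A)$, $g\in\mathrm{Count}(B)$. Cardinal numbers. The cardinal number of $A$ is the triple $|A|:=(X,Y,Z)$ with $$X:=\big\langle |A^!|_{Cl}\,\big|\,|A^?|_{Cl}\big\rangle,\quad Y:=\big\langle |A_{\mathbf t}|_{Cl}\,\big|\,|A^?|_{Cl}\big\rangle,\quad Z:=\big\langle |A_{\mathbf b}|_{Cl}\,\big|\,|A_{\mathbf n}|_{Cl}\big\rangle.$$ -}

module Defs where

open import Level using (Level) renaming (suc to lsuc)
open import Data.Nat.Base using (ℕ; zero; suc)
open import Data.Fin.Base using (Fin; zero; suc; lift)
open import Data.Vec.Base using (Vec; []; _∷_; lookup)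
import Data.Vec.Functional as F
open import Data.Product.Base using (Σ; _×_)
open import Data.Sum.Base using (_⊎_)
open import Data.Unit.Polymorphic.Base using (⊤)
open import Data.Empty.Polymorphic using (⊥)
open import Function.Base using (_∘_)
open import Relation.Binary.PropositionalEquality.Core using (_≡_)

private
  variable
    ℓ : Level
    m n : ℕ

------------------------------------------------------------------------
-- BS4 over the language {∈, =}

infix  9 _∈̇_ _≐_
infix  8 ∼_
infixr 7 _∧̇_
infixr 6 _∨̇_
infixr 5 _→̇_
infix  4 _↔̇_

-- Well-scoped de Bruijn syntax: the free variables of a `Form n` are the
-- elements of `Fin n`, and `zero` is the innermost bound variable.
data Form (n : ℕ) : Set where
  _∈̇_ _≐_            : Fin n → Fin n → Form n
  ⊥̇                   : Form n
  ∼_                   : Form n → Form n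
  _∧̇_ _∨̇_ _→̇_ _↔̇_ : Form n → Form n → Form n
  all ex               : Form (suc n) → Form n

record Model (ℓ : Level) : Set (lsuc ℓ) where
  field
    Dom   : Set ℓ
    point : Dom
    _∈⁺_  : Dom → Dom → Set ℓ
    _∈⁻_  : Dom → Dom → Set ℓ
    _=⁻_  : Dom → Dom → Set ℓ
    =⁻-sym : ∀ {a b} → a =⁻ b → b =⁻ a

module _ (𝔐 : Model ℓ) where
  open Model 𝔐

  True False : Form n → Vec Dom n → Set ℓ

  True (x ∈̇ y)  ρ = lookup ρ x ∈⁺ lookup ρ y
  True (x ≐ y)   ρ = lookup ρ x ≡ lookup ρ y
  True ⊥̇        ρ = ⊥
  True (∼ φ)     ρ = False φ ρ
  True (φ ∧̇ ψ)  ρ = True φ ρ × True ψ ρ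
  True (φ ∨̇ ψ)  ρ = True φ ρ ⊎ True ψ ρ
  True (φ →̇ ψ)  ρ = True φ ρ → True ψ ρ
  True (φ ↔̇ ψ)  ρ = (True φ ρ → True ψ ρ) × (True ψ ρ → True φ ρ)
  True (all φ)   ρ = (a : Dom) → True φ (a ∷ ρ)
  True (ex φ)    ρ = Σ Dom λ a → True φ (a ∷ ρ)

  False (x ∈̇ y) ρ = lookup ρ x ∈⁻ lookup ρ y
  False (x ≐ y)  ρ = lookup ρ x =⁻ lookup ρ y
  False ⊥̇       ρ = ⊤
  False (∼ φ)    ρ = True φ ρ
  False (φ ∧̇ ψ) ρ = False φ ρ ⊎ False ψ ρ
  False (φ ∨̇ ψ) ρ = False φ ρ × False ψ ρ
  False (φ →̇ ψ) ρ = True φ ρ × False ψ ρ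
  False (φ ↔̇ ψ) ρ = (True φ ρ × False ψ ρ) ⊎ (False φ ρ × True ψ ρ)
  False (all φ)  ρ = Σ Dom λ a → False φ (a ∷ ρ)
  False (ex φ)   ρ = (a : Dom) → False φ (a ∷ ρ)

Sentence : Set
Sentence = Form 0

Theory : Set₁
Theory = Sentence → Set

_⊩_ : Model ℓ → Sentence → Set ℓ
𝔐 ⊩ φ = True 𝔐 φ []

-- Γ ⊨[ ℓ ] φ: consequence over the models whose domain lives in Set ℓ.
infix 1 _⊨[_]_
_⊨[_]_ : Theory → (ℓ : Level) → Sentence → Set (lsuc ℓ)
Γ ⊨[ ℓ ] φ = (𝔐 : Model ℓ) → (∀ {γ} → Γ γ → 𝔐 ⊩ γ) → 𝔐 ⊩ φ

------------------------------------------------------------------------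
-- Renaming, closure and binding

rename : (Fin m → Fin n) → Form m → Form n
rename r (x ∈̇ y)  = r x ∈̇ r y
rename r (x ≐ y)   = r x ≐ r y
rename r ⊥̇        = ⊥̇
rename r (∼ φ)     = ∼ rename r φ
rename r (φ ∧̇ ψ)  = rename r φ ∧̇ rename r ψ
rename r (φ ∨̇ ψ)  = rename r φ ∨̇ rename r ψ
rename r (φ →̇ ψ)  = rename r φ →̇ rename r ψ
rename r (φ ↔̇ ψ)  = rename r φ ↔̇ rename r ψ
rename r (all φ)   = all (rename (lift 1 r) φ)
rename r (ex φ)    = ex (rename (lift 1 r) φ)

closure : ∀ n → Form n → Sentence
closure zero    φ = φ
closure (suc n) φ = closure n (all φ)

-- `∀̇ λ x → φ` and `∃̇ λ x → φ` let the bound variable be named.  A variable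
-- from outside must be weakened once (↑) for every binder it passes.
∀̇ ∃̇ : (Fin (suc n) → Form (suc n)) → Form n
∀̇ φ = all (φ zero)
∃̇ φ = ex (φ zero)

↑ : Fin n → Fin (suc n)
↑ = suc

↑² : Fin n → Fin (suc (suc n))
↑² = ↑ ∘ ↑

↑³ : Fin n → Fin (suc (suc (suc n)))
↑³ = ↑ ∘ ↑²

------------------------------------------------------------------------
-- Defined connectives

infix  8 ¬̇_ !_ ⁇_ ◯_
infixr 7 _&_
infixr 5 _⇒_
infix  4 _⇔_

¬̇_ !_ ⁇_ ◯_ : Form n → Form n
¬̇ φ = φ →̇ ⊥̇
! φ  = ∼ ¬̇ φ
⁇ φ  = ¬̇ ∼ φ
◯ φ  = ! φ ↔̇ ⁇ φ

_⇒_ _⇔_ _&_ : Form n → Form n → Form n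
φ ⇒ ψ = (φ →̇ ψ) ∧̇ (∼ ψ →̇ ∼ φ)
φ ⇔ ψ = (φ ↔̇ ψ) ∧̇ (∼ φ ↔̇ ∼ ψ)
φ & ψ = ∼ (φ →̇ ∼ ψ)

------------------------------------------------------------------------
-- Sets

-- A defined term t, given by a formula δ with "c = t" iff δ(c) is true, is
-- eliminated by reading ψ(t) as ∃c (δ(c) & ψ(c)).  As _&_ depends only on the
-- truth of its left argument, this gives ψ(t) both its truth and its falsity
-- conditions once c exists and is unique.

-- S ≔ λ x → φ  says  S = {x : φ(x)}.
infix 4 _≔_
_≔_ : Fin n → (Fin (suc n) → Form (suc n)) → Form n
S ≔ φ = ∀̇ λ x → x ∈̇ ↑ S ⇔ φ x

infix 8 _⊆̇_
_⊆̇_ : Fin n → Fin n → Form n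
A ⊆̇ B = ∀̇ λ x → x ∈̇ ↑ A ⇒ x ∈̇ ↑ B

Classical : Fin n → Form n
Classical A = ∀̇ λ x → ◯ (x ∈̇ ↑ A)

-- S = A^!, A^?, A_b, A_t, A_n, rlm(A)
_isTruePart_ _isNonFalsePart_ _isBPart_ _isTPart_ _isNPart_ _isRealm_
  : Fin n → Fin n → Form n
S isTruePart A     = S ≔ λ x → ! (x ∈̇ ↑ A)
S isNonFalsePart A = S ≔ λ x → ⁇ (x ∈̇ ↑ A)
S isBPart A        = S ≔ λ x → ! (x ∈̇ ↑ A) ∧̇ ∼ ⁇ (x ∈̇ ↑ A)
S isTPart A        = S ≔ λ x → ! (x ∈̇ ↑ A) ∧̇ ⁇ (x ∈̇ ↑ A)
S isNPart A        = S ≔ λ x → ⁇ (x ∈̇ ↑ A) ∧̇ ∼ ! (x ∈̇ ↑ A)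
S isRealm A        = S ≔ λ x → ! (x ∈̇ ↑ A) ∨̇ ⁇ (x ∈̇ ↑ A)

-- W = ⟨X|Y⟩
_is⟨_∣_⟩ : Fin n → Fin n → Fin n → Form n
W is⟨ X ∣ Y ⟩ = X isTruePart W ∧̇ Y isNonFalsePart W

Empty : Fin n → Form n
Empty e = e ≔ λ x → ⊥̇

-- Singletons and unordered pairs are classical.  (The extension of
-- "x = a" without ! is in general not a set: its ?-part is a proper class.)
_isSingleton_ : Fin n → Fin n → Form n
s isSingleton a = s ≔ λ x → ! (x ≐ ↑ a)

_is｛_,_｝ : Fin n → Fin n → Fin n → Form n
s is｛ a , b ｝ = s ≔ λ x → ! (x ≐ ↑ a) ∨̇ ! (x ≐ ↑ b)

-- k = {{a},{a,b}}, used only to tag elements in the ordered pairs below.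
_isTagged_,_ : Fin n → Fin n → Fin n → Form n
k isTagged a , b =
  ∃̇ λ s → s isSingleton ↑ a & ∃̇ λ t → t is｛ ↑² a , ↑² b ｝ & ↑² k is｛ ↑ s , t ｝

-- Ordered pairs: (a,b) is the disjoint sum
--   {x : ∃y (x = ⟨y,0⟩ & y ∈ a) ∨ ∃y (x = ⟨y,1⟩ & y ∈ b)},
-- where ⟨_,_⟩ is the tagging above, 0 = ∅ and 1 = {∅}.  Membership in a and b,
-- both true and false, is recorded faithfully, so that
--   (a,b) = (c,d) ⇔ (a = c ∧ b = d);
-- the falsity half fails for Kuratowski pairs, whose components enter only up
-- to identity.
_is⟪_,_⟫ : Fin n → Fin n → Fin n → Form n
p is⟪ a , b ⟫ =
  ∃̇ λ o → Empty o & ∃̇ λ i → i isSingleton ↑ o &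
    (↑² p ≔ λ x → (∃̇ λ y → ↑ x isTagged y , ↑³ o & y ∈̇ ↑ (↑³ a))
               ∨̇ (∃̇ λ y → ↑ x isTagged y , ↑² i & y ∈̇ ↑ (↑³ b)))

-- (a,b,c) = ((a,b),c)
_is⟪_,_,_⟫ : Fin n → Fin n → Fin n → Fin n → Form n
t is⟪ a , b , c ⟫ = ∃̇ λ p → p is⟪ ↑ a , ↑ b ⟫ & ↑ t is⟪ p , ↑ c ⟫

------------------------------------------------------------------------
-- Classical functions

-- (a,b) ∈ f;  for a function f this also renders b = f(a).
⟪_,_⟫∈_ : Fin n → Fin n → Fin n → Form n
⟪ a , b ⟫∈ f = ∃̇ λ p → p is⟪ ↑ a , ↑ b ⟫ & p ∈̇ ↑ f

Function : Fin n → Form n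
Function f =
    Classical f
  ∧̇ (∀̇ λ p → p ∈̇ ↑ f →̇ ∃̇ λ a → ∃̇ λ b → ↑² p is⟪ ↑ a , b ⟫)
  ∧̇ (∀̇ λ a → ∀̇ λ b → ∀̇ λ c →
        ⟪ ↑² a , ↑ b ⟫∈ ↑³ f ∧̇ ⟪ ↑² a , c ⟫∈ ↑³ f →̇ ! (↑ b ≐ c))

Injection : Fin n → Form n
Injection f =
    Function f
  ∧̇ (∀̇ λ a → ∀̇ λ b → ∀̇ λ c →
        ⟪ ↑² a , c ⟫∈ ↑³ f ∧̇ ⟪ ↑ b , c ⟫∈ ↑³ f →̇ ! (↑² a ≐ ↑ b))

_isDomain_ _isRange_ : Fin n → Fin n → Form n
D isDomain f = D ≔ λ x → ∃̇ λ y → ⟪ ↑ x , y ⟫∈ ↑² f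
R isRange f  = R ≔ λ y → ∃̇ λ x → ⟪ x , ↑ y ⟫∈ ↑² f

-- u = f[A]
_isImage_[_] : Fin n → Fin n → Fin n → Form n
u isImage f [ A ] = u ≔ λ y → ∃̇ λ x → ⟪ x , ↑ y ⟫∈ ↑² f & x ∈̇ ↑² A

-- f ∈ Count(A)
_∈Count_ : Fin n → Fin n → Form n
f ∈Count A = Injection f ∧̇ (∃̇ λ D → D isRealm ↑ A ∧̇ D isDomain ↑ f)

infix 8 _≅̇_
_≅̇_ : Fin n → Fin n → Form n
A ≅̇ B =
  ∃̇ λ f → f ∈Count ↑ A & ∃̇ λ g → g ∈Count ↑² B &
    ∃̇ λ u → u isImage ↑² f [ ↑³ A ] &
      ∃̇ λ v → v isImage ↑² g [ ↑ (↑³ B) ] & ↑ u ≐ v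

------------------------------------------------------------------------
-- Von Neumann ordinals and cardinal numbers

-- A transitive, hereditarily classical set that is strictly well-ordered by ∈.
Ordinal : Fin n → Form n
Ordinal α =
    Classical α
  ∧̇ (∀̇ λ x → x ∈̇ ↑ α →̇ Classical x)
  ∧̇ (∀̇ λ x → x ∈̇ ↑ α →̇ ∀̇ λ y → y ∈̇ ↑ x →̇ y ∈̇ ↑² α)
  ∧̇ (∀̇ λ x → x ∈̇ ↑ α →̇ ¬̇ (x ∈̇ x))
  ∧̇ (∀̇ λ x → x ∈̇ ↑ α →̇ ∀̇ λ y → y ∈̇ ↑² α →̇ ∀̇ λ z → z ∈̇ ↑³ α →̇
        ↑² x ∈̇ ↑ y ∧̇ ↑ y ∈̇ z →̇ ↑² x ∈̇ z)
  ∧̇ (∀̇ λ x → x ∈̇ ↑ α →̇ ∀̇ λ y → y ∈̇ ↑² α →̇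
        ↑ x ∈̇ y ∨̇ ↑ x ≐ y ∨̇ y ∈̇ ↑ x)
  ∧̇ (∀̇ λ S → Classical S ∧̇ S ⊆̇ ↑ α ∧̇ (∃̇ λ x → x ∈̇ ↑ S) →̇
        ∃̇ λ x → x ∈̇ ↑ S ∧̇ (∀̇ λ y → y ∈̇ ↑² S →̇ ↑ x ∈̇ y ∨̇ ↑ x ≐ y))

InBijection : Fin n → Fin n → Form n
InBijection X Y = ∃̇ λ h → Injection h ∧̇ ↑ X isDomain h ∧̇ ↑ Y isRange h

-- κ = |X|_Cl
_isCard_ : Fin n → Fin n → Form n
κ isCard X =
    Ordinal κ
  ∧̇ InBijection κ X
  ∧̇ (∀̇ λ β → Ordinal β ∧̇ InBijection β (↑ X) →̇ ↑ κ ∈̇ β ∨̇ ↑ κ ≐ β)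

-- W = ⟨ |S|_Cl | |T|_Cl ⟩
_isCardPair_,_ : Fin n → Fin n → Fin n → Form n
W isCardPair S , T =
  ∃̇ λ κ → κ isCard ↑ S & ∃̇ λ μ → μ isCard ↑² T & ↑² W is⟨ ↑ κ ∣ μ ⟩

-- The three components of |A|
_isX_ _isY_ _isZ_ : Fin n → Fin n → Form n
W isX A = ∃̇ λ S → S isTruePart ↑ A & ∃̇ λ T → T isNonFalsePart ↑² A &
            ↑² W isCardPair ↑ S , T
W isY A = ∃̇ λ S → S isTPart ↑ A & ∃̇ λ T → T isNonFalsePart ↑² A &
            ↑² W isCardPair ↑ S , T
W isZ A = ∃̇ λ S → S isBPart ↑ A & ∃̇ λ T → T isNPart ↑² A &
            ↑² W isCardPair ↑ S , T

-- c = |A|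
_isCardinalNumber_ : Fin n → Fin n → Form n
c isCardinalNumber A =
  ∃̇ λ X → X isX ↑ A & ∃̇ λ Y → Y isY ↑² A & ∃̇ λ Z → Z isZ ↑³ A &
    ↑³ c is⟪ ↑² X , ↑ Y , Z ⟫

-- |A| = |B|
∣_∣≐∣_∣ : Fin n → Fin n → Form n
∣ A ∣≐∣ B ∣ =
  ∃̇ λ c → c isCardinalNumber ↑ A & ∃̇ λ d → d isCardinalNumber ↑² B & ↑ c ≐ d

------------------------------------------------------------------------
-- The theory BZFC

extensionality : Sentence
extensionality = ∀̇ λ A → ∀̇ λ B →
  ↑ A ≐ B ⇔ ∀̇ λ x → x ∈̇ ↑² A ⇔ x ∈̇ ↑ B

-- φ = φ(x, p⃗) with x as variable zero; the parameters p⃗ are weakened past A, B.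
comprehension : Form (suc n) → Sentence
comprehension {n} φ = closure n (∀̇ λ A → ∃̇ λ B →
  B ≔ λ x → x ∈̇ ↑² A ∧̇ rename (x F.∷ ↑³) φ)

classicalSuperset : Sentence
classicalSuperset = ∀̇ λ A → ∃̇ λ C → Classical C ∧̇ ↑ A ⊆̇ C

-- φ = φ(x, y, p⃗) with x as variable zero and y as variable one.
replacement : Form (suc (suc n)) → Sentence
replacement {n} φ = closure n (
  (∀̇ λ x → ∀̇ λ y → ∀̇ λ z →
      rename (↑² x F.∷ ↑ y F.∷ ↑³) φ ∧̇ rename (↑² x F.∷ z F.∷ ↑³) φ →̇ ! (↑ y ≐ z))
  →̇ ∀̇ λ A → ∃̇ λ B → B ≔ λ y → ∃̇ λ x →
      rename (x F.∷ ↑ y F.∷ (↑ ∘ ↑³)) φ & x ∈̇ ↑³ A)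

pairing : Sentence
pairing = ∀̇ λ a → ∀̇ λ b → ∃̇ λ C → C is｛ ↑² a , ↑ b ｝

union : Sentence
union = ∀̇ λ A → ∃̇ λ B → B ≔ λ x → ∃̇ λ C → C ∈̇ ↑³ A ∧̇ ↑ x ∈̇ C

-- Without ! the ?-part of {x : x ⊆ A} would be a proper class.
powerSet : Sentence
powerSet = ∀̇ λ A → ∃̇ λ B → B ≔ λ x → ! (x ⊆̇ ↑² A)

infinity : Sentence
infinity = ∃̇ λ I →
    (∃̇ λ e → Empty e ∧̇ e ∈̇ ↑ I)
  ∧̇ (∀̇ λ x → x ∈̇ ↑ I →̇
        ∃̇ λ y → (y ≔ λ z → z ∈̇ ↑² x ∨̇ ! (z ≐ ↑² x)) ∧̇ y ∈̇ ↑² I)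

-- Every inhabited classical set has an element whose realm is disjoint from it.
foundation : Sentence
foundation = ∀̇ λ A → Classical A ∧̇ (∃̇ λ x → x ∈̇ ↑ A) →̇
  ∃̇ λ x → x ∈̇ ↑ A ∧̇ (∀̇ λ y → y ∈̇ ↑² A →̇ ¬̇ (y ∈̇ ↑ x) ∧̇ ¬̇ ⁇ (y ∈̇ ↑ x))

choice : Sentence
choice = ∀̇ λ A → Classical A ∧̇ (∀̇ λ x → x ∈̇ ↑ A →̇ ∃̇ λ y → y ∈̇ ↑ x) →̇
  ∃̇ λ f → Function f ∧̇ ↑ A isDomain f
         ∧̇ (∀̇ λ x → x ∈̇ ↑² A →̇ ∃̇ λ y → ⟪ ↑ x , y ⟫∈ ↑² f ∧̇ y ∈̇ ↑ x)

-- ∃A (A^! ⊈ A^?) ∧ ∃A (A^? ⊈ A^!), where ⊈ is the ∼-negation of ⊆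
acla : Sentence
acla =
    (∃̇ λ A → ∃̇ λ S → S isTruePart ↑ A & ∃̇ λ T → T isNonFalsePart ↑² A &
       ∼ (↑ S ⊆̇ T))
  ∧̇ (∃̇ λ A → ∃̇ λ S → S isTruePart ↑ A & ∃̇ λ T → T isNonFalsePart ↑² A &
       ∼ (T ⊆̇ ↑ S))

data BZFC : Theory where
  ext     : BZFC extensionality
  compr   : (φ : Form (suc n)) → BZFC (comprehension φ)
  clSup   : BZFC classicalSuperset
  repl    : (φ : Form (suc (suc n))) → BZFC (replacement φ)
  pair    : BZFC pairing
  un      : BZFC union
  pow     : BZFC powerSet
  inf     : BZFC infinity
  found   : BZFC foundation
  ac      : BZFC choice
  aclas   : BZFC acla

{-# OPTIONS --safe #-}
module Submission where

-- Work inside a model, with excluded middle in the metatheory.  Every classical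
-- set has a cardinal, by the well-ordering theorem.  Write X ↪ Y for "X embeds
-- into Y" and A^!, A^?, A_b, A_t, A_n for the parts of A.
--
-- Truth.  A ≅ B holds iff A_b, A_t, A_n are equinumerous with B_b, B_t, B_n, and
-- the cardinals of these parts can be read off |A|.
--
-- Falsity.  By Cantor–Bernstein, |A| ≠ |B| fails iff A^! ↪ B^?, B^! ↪ A^?,
-- A_b ↪ B_n and B_b ↪ A_n: the condition from the second component, A_t ↪ B^?,
-- is implied.  A ≇ B fails iff there are countings f, g with f[A^!] ⊆ g[B^?] and
-- g[B^!] ⊆ f[A^?].  Such f and g clearly yield the four embeddings.  Conversely,
-- rerouting A^! ↪ B^? along alternating paths makes it map A_b into B_n, and
-- likewise for B^! ↪ A^?; by the Mendelsohn–Dulmage theorem the two then combine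
-- into one partial matching of A with B that covers both A^! and B^!.  Countings
-- that identify exactly the matched elements are as required.

open import Defs
open import Level using (Level)
open import Axiom.ExcludedMiddle using (ExcludedMiddle)
open import Data.Nat.Base using (ℕ; suc; zero)
open import Data.Fin.Base using (Fin; zero; suc; lift)
open import Data.Fin.Patterns
open import Data.Vec.Base using (Vec; []; _∷_; lookup)
import Data.Vec.Functional as F
open import Data.Product.Base using (Σ; _×_; _,_; proj₁; proj₂; swap)
open import Data.Sum.Base using (_⊎_; inj₁; inj₂; [_,_]′)
open import Data.Unit.Polymorphic.Base using (tt)
open import Data.Empty.Polymorphic using (⊥)
open import Function.Base using (id; _∘_)
open import Relation.Nullary using (yes; no; contradiction)
open import Relation.Binary.PropositionalEquality.Core
  using (_≡_; refl; sym; trans; subst)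

-- The axiom schemas speak of formulas only. So every relation from which a set is formed (orbits,
-- enumerations, matchings) occurs twice, as a formula and as a relation of the metatheory, with a
-- proof that the formula is true exactly where the relation holds. For classical sets falsity is
-- the complement of truth, and excluded middle lets the usual arguments of ZFC run.
--
-- The obstacle in the falsity half is that the four embeddings are unrelated to one another.
-- Countings f and g leave f[A] and g[B] unseparated only if every a in A^! shares its value with
-- some b in B^?, and an a that is both true and false in A can share its value only with a b that
-- is neither true nor false in B. The embedding of A^! ignores the second demand and that of A_b
-- reaches only the gluts, so one embedding has to be made to do both.
--
-- Paths are orbits, taken as intersections of closed sets, so that induction along a path is an
-- instance of separation. The matching theorem that joins the two directions is also the source of
-- Cantor-Bernstein.

private
  variable
    ℓ : Level
    m n : ℕ

-- Logical equivalence and its congruences.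

infix 2 _⟷_
_⟷_ : Set ℓ → Set ℓ → Set ℓ
P ⟷ Q = (P → Q) × (Q → P)

_via_ : {P P′ Q : Set ℓ} → P ⟷ Q → P′ ⟷ Q → P ⟷ P′
(f , f′) via (g , g′) = g′ ∘ f , f′ ∘ g

module _ {P P′ Q Q′ : Set ℓ} (p : P ⟷ P′) (q : Q ⟷ Q′) where
  ×-cong : (P × Q) ⟷ (P′ × Q′)
  ×-cong = (λ (a , b) → proj₁ p a , proj₁ q b) , (λ (a , b) → proj₂ p a , proj₂ q b)

  ⊎-cong : (P ⊎ Q) ⟷ (P′ ⊎ Q′)
  ⊎-cong = [ inj₁ ∘ proj₁ p , inj₂ ∘ proj₁ q ]′ , [ inj₁ ∘ proj₂ p , inj₂ ∘ proj₂ q ]′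

  →-cong : (P → Q) ⟷ (P′ → Q′)
  →-cong = (λ f → proj₁ q ∘ f ∘ proj₂ p) , (λ f → proj₂ q ∘ f ∘ proj₁ p)

module _ {D : Set ℓ} {P Q : D → Set ℓ} (e : ∀ a → P a ⟷ Q a) where
  Π-cong : (∀ a → P a) ⟷ (∀ a → Q a)
  Π-cong = (λ f a → proj₁ (e a) (f a)) , (λ f a → proj₂ (e a) (f a))

  Σ-cong : Σ D P ⟷ Σ D Q
  Σ-cong = (λ (a , p) → a , proj₁ (e a) p) , (λ (a , p) → a , proj₂ (e a) p)

-- Renaming of variables under truth and falsity.

module _ (𝔐 : Model ℓ) where
  open Model 𝔐

  True-closure : ∀ n {φ : Form n} → True 𝔐 (closure n φ) [] → ∀ ρ → True 𝔐 φ ρ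
  True-closure zero    t []      = t
  True-closure (suc n) t (a ∷ ρ) = True-closure n t ρ a

  Agree : (Fin m → Fin n) → Vec Dom m → Vec Dom n → Set ℓ
  Agree r ρ ρ′ = ∀ i → lookup ρ′ (r i) ≡ lookup ρ i

  Agree-lift : {r : Fin m → Fin n} {ρ : Vec Dom m} {ρ′ : Vec Dom n} →
               Agree r ρ ρ′ → ∀ a → Agree (lift 1 r) (a ∷ ρ) (a ∷ ρ′)
  Agree-lift e a zero    = refl
  Agree-lift e a (suc i) = e i

  -- The two proofs are mutually recursive: `∼` exchanges truth and falsity, and the falsity
  -- conditions of `→̇` and `↔̇` mention the truth of subformulas.
  True-rename : (φ : Form m) {r : Fin m → Fin n} {ρ : Vec Dom m} {ρ′ : Vec Dom n} →
                Agree r ρ ρ′ → True 𝔐 (rename r φ) ρ′ ⟷ True 𝔐 φ ρ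
  False-rename : (φ : Form m) {r : Fin m → Fin n} {ρ : Vec Dom m} {ρ′ : Vec Dom n} →
                 Agree r ρ ρ′ → False 𝔐 (rename r φ) ρ′ ⟷ False 𝔐 φ ρ

  True-rename (x ∈̇ y)  e rewrite e x | e y = id , id
  True-rename (x ≐ y)   e rewrite e x | e y = id , id
  True-rename ⊥̇        e = id , id
  True-rename (∼ φ)     e = False-rename φ e
  True-rename (φ ∧̇ ψ)  e = ×-cong (True-rename φ e) (True-rename ψ e)
  True-rename (φ ∨̇ ψ)  e = ⊎-cong (True-rename φ e) (True-rename ψ e)
  True-rename (φ →̇ ψ)  e = →-cong (True-rename φ e) (True-rename ψ e)
  True-rename (φ ↔̇ ψ)  e = ×-cong (→-cong (True-rename φ e) (True-rename ψ e))
                                   (→-cong (True-rename ψ e) (True-rename φ e))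
  True-rename (all φ)   e = Π-cong λ a → True-rename φ (Agree-lift e a)
  True-rename (ex φ)    e = Σ-cong λ a → True-rename φ (Agree-lift e a)

  False-rename (x ∈̇ y) e rewrite e x | e y = id , id
  False-rename (x ≐ y)  e rewrite e x | e y = id , id
  False-rename ⊥̇       e = id , id
  False-rename (∼ φ)    e = True-rename φ e
  False-rename (φ ∧̇ ψ) e = ⊎-cong (False-rename φ e) (False-rename ψ e)
  False-rename (φ ∨̇ ψ) e = ×-cong (False-rename φ e) (False-rename ψ e)
  False-rename (φ →̇ ψ) e = ×-cong (True-rename φ e) (False-rename ψ e)
  False-rename (φ ↔̇ ψ) e = ⊎-cong (×-cong (True-rename φ e) (False-rename ψ e))
                                   (×-cong (False-rename φ e) (True-rename ψ e))
  False-rename (all φ)  e = Σ-cong λ a → False-rename φ (Agree-lift e a)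
  False-rename (ex φ)   e = Π-cong λ a → False-rename φ (Agree-lift e a)

data Part : Set where
  truth nonFalse glut tpart gap realm : Part

-- These parts partition the realm, and the remaining three are unions of some of them. Lying in a
-- basic part fixes both the truth and the falsity of membership.
data Basic : Part → Set where
  glut  : Basic glut
  tpart : Basic tpart
  gap   : Basic gap

module SetTheory (em : ExcludedMiddle ℓ) (𝔐 : Model ℓ)
                 (axiom : ∀ {γ} → BZFC γ → 𝔐 ⊩ γ) where
  open Model 𝔐

  private
    T : Form n → Vec Dom n → Set ℓ
    T = True 𝔐

    F⁻ : Form n → Vec Dom n → Set ℓ
    F⁻ = False 𝔐

  infix 3 ¬_
  ¬_ : Set ℓ → Set ℓ
  ¬ P = P → ⊥ {ℓ}

  absurd : ∀ {a} {P : Set a} → ⊥ {ℓ} → P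
  absurd ()

  by-contradiction : {P : Set ℓ} → ¬ ¬ P → P
  by-contradiction {P} f with em {P}
  ... | yes p = p
  ... | no ¬p = absurd (f λ p → contradiction p ¬p)

  decide : (P : Set ℓ) → P ⊎ (¬ P)
  decide P with em {P}
  ... | yes p = inj₁ p
  ... | no ¬p = inj₂ λ p → contradiction p ¬p

  -- Extensionality, classical sets, comprehension and replacement.

  ext-true : ∀ {A B} → (∀ x → (x ∈⁺ A ⟷ x ∈⁺ B) × (x ∈⁻ A ⟷ x ∈⁻ B)) → A ≡ B
  ext-true {A} {B} = proj₂ (proj₁ (axiom ext A B))

  Separated : Dom → Dom → Set ℓ
  Separated A B = Σ Dom λ x → (x ∈⁺ A × x ∈⁻ B) ⊎ (x ∈⁻ A × x ∈⁺ B)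

  -- The falsity half of extensionality. The biconditional between the `∼`-negations is false under
  -- the same two alternatives as the first one, in the opposite order, hence the swap.
  =⁻⟷Separated : ∀ {A B} → A =⁻ B ⟷ Separated A B
  =⁻⟷Separated {A} {B} =
      (λ e → let x , d = proj₁ (proj₂ (axiom ext A B)) e in
             x , [ id , [ inj₂ , inj₁ ]′ ]′ d)
    , (λ (x , d) → proj₂ (proj₂ (axiom ext A B)) (x , inj₁ d))

  Cl : Dom → Set ℓ
  Cl A = T (Classical 0F) (A ∷ [])

  Cl-∉⁻ : ∀ {A x} → Cl A → x ∈⁺ A → ¬ x ∈⁻ A
  Cl-∉⁻ c p = proj₁ (c _) (p , tt)

  Cl-∈⁻ : ∀ {A x} → Cl A → ¬ x ∈⁺ A → x ∈⁻ A
  Cl-∈⁻ c np = by-contradiction λ n → np (proj₁ (proj₂ (c _) n))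

  -- A classical set is determined by its true members, so a single predicate describes it; `both`
  -- recovers falsity as the complement.
  record _Comprises_ (B : Dom) (P : Dom → Set ℓ) : Set ℓ where
    field
      classical : Cl B
      out       : ∀ {x} → x ∈⁺ B → P x
      into      : ∀ {x} → P x → x ∈⁺ B

    both : ∀ x → (x ∈⁺ B ⟷ P x) × (x ∈⁻ B ⟷ (¬ P x))
    both x = (out , into)
           , (λ x∉ p → Cl-∉⁻ classical (into p) x∉)
           , (λ ¬p → Cl-∈⁻ classical (¬p ∘ out))

  open _Comprises_ public

  comprises : ∀ {B P} → (∀ x → (x ∈⁺ B ⟷ P x) × (x ∈⁻ B ⟷ (¬ P x))) → B Comprises P
  comprises e .classical x =
      (λ (p , _) q → proj₁ (proj₂ (e x)) q (proj₁ (proj₁ (e x)) p))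
    , (λ nq → proj₂ (proj₁ (e x))
               (by-contradiction λ np → nq (proj₂ (proj₂ (e x)) np)) , tt)
  comprises e .out  = proj₁ (proj₁ (e _))
  comprises e .into = proj₂ (proj₁ (e _))

  comprises-≡ : ∀ {A B} → Cl A → Cl B → (∀ x → x ∈⁺ A ⟷ x ∈⁺ B) → A ≡ B
  comprises-≡ a b e = ext-true λ x → e x
    , (λ p → Cl-∈⁻ b λ q → Cl-∉⁻ a (proj₂ (e x) q) p)
    , (λ p → Cl-∈⁻ a λ q → Cl-∉⁻ b (proj₁ (e x) q) p)

  comprises-unique : ∀ {S S′ P} → S Comprises P → S′ Comprises P → S ≡ S′
  comprises-unique c c′ =
    comprises-≡ (classical c) (classical c′) λ x → into c′ ∘ out c , into c ∘ out c′

  comprehend : (φ : Form (suc n)) (ρ : Vec Dom n) (A : Dom) → Σ Dom λ B → ∀ x →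
    (x ∈⁺ B ⟷ (x ∈⁺ A × T φ (x ∷ ρ))) × (x ∈⁻ B ⟷ (x ∈⁻ A ⊎ F⁻ φ (x ∷ ρ)))
  comprehend {n} φ ρ A with True-closure 𝔐 n (axiom (compr φ)) ρ A
  ... | B , e = B , λ x →
      let ag = λ { zero → refl ; (suc i) → refl }
          t = True-rename 𝔐 φ {ρ = x ∷ ρ} ag
          f = False-rename 𝔐 φ {ρ = x ∷ ρ} ag
          (p , p′) , (q , q′) = e x
          u = ×-cong {P = x ∈⁺ A} (id , id) t
          v = ⊎-cong {P = x ∈⁻ A} (id , id) f
      in (proj₁ u ∘ p , p′ ∘ proj₂ u) , (proj₁ v ∘ q , q′ ∘ proj₂ v)

  -- Comprehension is applied to `! φ`, because φ itself would pass its own falsity condition on to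
  -- the subset. With `!` falsity becomes non-truth and the subset stays classical.
  sep : (φ : Form (suc n)) (ρ : Vec Dom n) {A : Dom} → Cl A →
        Σ Dom λ B → B Comprises λ x → x ∈⁺ A × T φ (x ∷ ρ)
  sep φ ρ {A} cl with comprehend (! φ) ρ A
  ... | B , e = B , comprises λ x →
      let (p , p′) , (q , q′) = e x in
        ((λ y → let a , t , _ = p y in a , t) , (λ (a , t) → p′ (a , t , tt)))
      , (λ y (a , t) → [ Cl-∉⁻ cl a , (λ nt → nt t) ]′ (q y))
      , (λ nat → q′ ([ (λ a → inj₂ λ t → nat (a , t)) , (λ na → inj₁ (Cl-∈⁻ cl na)) ]′
                     (decide (x ∈⁺ A))))

  Functional : (Dom → Dom → Set ℓ) → Set ℓ
  Functional R = ∀ {x y z} → R x y → R x z → y ≡ z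

  -- As `&` reads only the truth of its left argument, y is false in B when every x related to y is
  -- false in A. Four-valued membership is thus carried along φ, which is what ordered pairs and
  -- images of non-classical sets rely on.
  replace : (φ : Form (suc (suc n))) (ρ : Vec Dom n) →
    Functional (λ x y → T φ (x ∷ y ∷ ρ)) → (A : Dom) → Σ Dom λ B → ∀ y →
      (y ∈⁺ B ⟷ Σ Dom λ x → T φ (x ∷ y ∷ ρ) × x ∈⁺ A)
    × (y ∈⁻ B ⟷ (∀ x → T φ (x ∷ y ∷ ρ) → x ∈⁻ A))
  replace {n} φ ρ fun A
    with True-closure 𝔐 n (axiom (repl φ)) ρ
           (λ x y z (p , q) →
             fun (proj₁ (True-rename 𝔐 φ (λ { 0F → refl ; 1F → refl ; (suc (suc i)) → refl })) p)
                 (proj₁ (True-rename 𝔐 φ (λ { 0F → refl ; 1F → refl ; (suc (suc i)) → refl })) q)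
             , tt)
           A
  ... | B , e = B , λ y →
      let t = λ x → True-rename 𝔐 φ {ρ = x ∷ y ∷ ρ}
                      {ρ′ = x ∷ y ∷ B ∷ A ∷ ρ}
                      (λ { 0F → refl ; 1F → refl ; (suc (suc i)) → refl })
          (p , p′) , (q , q′) = e y
          u = Σ-cong (λ x → ×-cong {Q = x ∈⁺ A} (t x) (id , id))
          v = Π-cong (λ x → →-cong {Q = x ∈⁻ A} (t x) (id , id))
      in (proj₁ u ∘ p , p′ ∘ proj₂ u) , (proj₁ v ∘ q , q′ ∘ proj₂ v)

  replaceCl : (φ : Form (suc (suc n))) (ρ : Vec Dom n) →
    Functional (λ x y → T φ (x ∷ y ∷ ρ)) → {A : Dom} → Cl A →
    Σ Dom λ B → B Comprises λ y → Σ Dom λ x → T φ (x ∷ y ∷ ρ) × x ∈⁺ A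
  replaceCl φ ρ fun {A} cl with replace φ ρ fun A
  ... | B , e = B , comprises λ y → proj₁ (e y)
      , (λ p (x , t , a) → Cl-∉⁻ cl a (proj₁ (proj₂ (e y)) p x t))
      , (λ ne → proj₂ (proj₂ (e y)) λ x t → Cl-∈⁻ cl λ a → ne (x , t , a))

  -- Ordered pairs

  Sing : Dom → Dom → Set ℓ
  Sing s a = T (0F isSingleton 1F) (s ∷ a ∷ [])

  Doubleton : Dom → Dom → Dom → Set ℓ
  Doubleton t a b = T (0F is｛ 1F , 2F ｝) (t ∷ a ∷ b ∷ [])

  doubleton-comprises : ∀ {t a b} → Doubleton t a b → t Comprises λ x → x ≡ a ⊎ x ≡ b
  doubleton-comprises d = comprises λ x → let (p , p′) , (q , q′) = d x in
      ( (λ y → [ inj₁ ∘ proj₁ , inj₂ ∘ proj₁ ]′ (p y))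
      , (λ y → p′ ([ (λ e → inj₁ (e , tt)) , (λ e → inj₂ (e , tt)) ]′ y)))
    , (λ y → [ proj₁ (q y) , proj₂ (q y) ]′)
    , (λ f → q′ (f ∘ inj₁ , f ∘ inj₂))

  sing-comprises : ∀ {s a} → Sing s a → s Comprises (_≡ a)
  sing-comprises d = comprises λ x → let (p , p′) , q = d x in
      (proj₁ ∘ p , (λ e → p′ (e , tt))) , q

  comprises-sing : ∀ {s a} → s Comprises (_≡ a) → Sing s a
  comprises-sing c x = let (p , p′) , q = both c x in ((λ y → p y , tt) , p′ ∘ proj₁) , q

  doubleton : ∀ a b → Σ Dom λ t → Doubleton t a b
  doubleton a b = axiom pair a b

  singleton : ∀ a → Σ Dom λ s → Sing s a
  singleton a with doubleton a a
  ... | t , d = t , comprises-sing record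
      { classical = classical c
      ; out = λ x → [ id , id ]′ (out c x)
      ; into = into c ∘ inj₁ }
    where c = doubleton-comprises d

  binaryUnion : ∀ A B → Σ Dom λ C → ∀ x →
    (x ∈⁺ C ⟷ (x ∈⁺ A ⊎ x ∈⁺ B)) × (x ∈⁻ C ⟷ (x ∈⁻ A × x ∈⁻ B))
  binaryUnion A B with doubleton A B
  ... | t , d with axiom un t | doubleton-comprises d
  ... | C , e | c = C , λ x →
      let (p , p′) , (q , q′) = e x in
        ((λ y → let D , D∈ , x∈ = p y in
            [ (λ { refl → inj₁ x∈ }) , (λ { refl → inj₂ x∈ }) ]′ (out c D∈))
        , [ (λ a → p′ (A , into c (inj₁ refl) , a)) , (λ b → p′ (B , into c (inj₂ refl) , b)) ]′)
      , (λ y → [ absurd ∘ Cl-∉⁻ (classical c) (into c (inj₁ refl)) , id ]′ (q y A)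
             , [ absurd ∘ Cl-∉⁻ (classical c) (into c (inj₂ refl)) , id ]′ (q y B))
      , (λ (a , b) → q′ λ D → [ (λ D∈ → inj₂ ([ (λ { refl → a }) , (λ { refl → b }) ]′ (out c D∈)))
                              , (λ D∉ → inj₁ (Cl-∈⁻ (classical c) D∉)) ]′ (decide (D ∈⁺ t)))

  binaryUnionCl : ∀ {A B} → Cl A → Cl B → Σ Dom λ C → C Comprises λ x → x ∈⁺ A ⊎ x ∈⁺ B
  binaryUnionCl {A} {B} a b with binaryUnion A B
  ... | C , e = C , comprises λ x → proj₁ (e x)
      , (λ p → let p₁ , p₂ = proj₁ (proj₂ (e x)) p in
           [ (λ q → Cl-∉⁻ a q p₁) , (λ q → Cl-∉⁻ b q p₂) ]′)
      , (λ f → proj₂ (proj₂ (e x)) (Cl-∈⁻ a (f ∘ inj₁) , Cl-∈⁻ b (f ∘ inj₂)))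

  emptySet : Σ Dom λ o → o Comprises λ _ → ⊥
  -- Separation needs some classical set to start from: `point` exists because domains are
  -- non-empty, and it has a classical superset.
  emptySet = let C , cl , _ = axiom clSup point
                 o , c = sep ⊥̇ [] cl
             in o , record { classical = classical c ; out = proj₂ ∘ out c ; into = λ () }

  𝟎 𝟏 : Dom
  𝟎 = proj₁ emptySet
  𝟏 = proj₁ (singleton 𝟎)

  𝟎-comprises : 𝟎 Comprises λ _ → ⊥
  𝟎-comprises = proj₂ emptySet

  𝟏-sing : Sing 𝟏 𝟎
  𝟏-sing = proj₂ (singleton 𝟎)

  𝟎≢𝟏 : ¬ 𝟎 ≡ 𝟏
  𝟎≢𝟏 e = out 𝟎-comprises (subst (𝟎 ∈⁺_) (sym e) (into (sing-comprises 𝟏-sing) refl))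

  Tag : Dom → Dom → Dom → Set ℓ
  Tag k a b = T (0F isTagged 1F , 2F) (k ∷ a ∷ b ∷ [])

  tag : ∀ a b → Σ Dom λ k → Tag k a b
  tag a b = let s , σ = singleton a
                t , τ = doubleton a b
                k , κ = doubleton s t
            in k , s , σ , t , τ , κ

  sing-unique : ∀ {s s′ a} → Sing s a → Sing s′ a → s ≡ s′
  sing-unique σ σ′ = comprises-unique (sing-comprises σ) (sing-comprises σ′)

  doubleton-unique : ∀ {s s′ a b} → Doubleton s a b → Doubleton s′ a b → s ≡ s′
  doubleton-unique σ σ′ = comprises-unique (doubleton-comprises σ) (doubleton-comprises σ′)

  tag-unique : ∀ {k k′ a b} → Tag k a b → Tag k′ a b → k ≡ k′
  tag-unique (s , σ , t , τ , κ) (s′ , σ′ , t′ , τ′ , κ′)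
    with sing-unique σ σ′ | doubleton-unique τ τ′
  ... | refl | refl = doubleton-unique κ κ′

  tag-first : ∀ {k a b a′ b′} → Tag k a b → Tag k a′ b′ → a ≡ a′
  tag-first (s , σ , t , τ , κ) (s′ , σ′ , t′ , τ′ , κ′) =
    sym (out (sing-comprises σ)
      ([ (λ { refl → into (sing-comprises σ′) refl })
       , (λ { refl → into (doubleton-comprises τ′) (inj₁ refl) }) ]′
       (out (doubleton-comprises κ′) (into (doubleton-comprises κ) (inj₁ refl)))))

  tag-second-or : ∀ {k a b a′ b′} → Tag k a b → Tag k a′ b′ → b ≡ a′ ⊎ b ≡ b′
  tag-second-or (s , σ , t , τ , κ) (s′ , σ′ , t′ , τ′ , κ′) =
    [ (λ { refl → inj₁ (out (sing-comprises σ′) b∈t) })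
    , (λ { refl → out (doubleton-comprises τ′) b∈t }) ]′
    (out (doubleton-comprises κ′) (into (doubleton-comprises κ) (inj₂ refl)))
    where b∈t = into (doubleton-comprises τ) (inj₂ refl)

  -- The second entry of either tag equals the first or the second entry of the other. If both times
  -- it is the first, equality of the first entries settles the matter.
  tag-second : ∀ {k a b a′ b′} → Tag k a b → Tag k a′ b′ → b ≡ b′
  tag-second p q with tag-first p q | tag-second-or p q | tag-second-or q p
  ... | _    | inj₂ e    | _         = e
  ... | _    | inj₁ _    | inj₂ e    = sym e
  ... | refl | inj₁ refl | inj₁ refl = refl

  PairExt : Dom → Dom → Dom → Set ℓ
  PairExt p a b = ∀ x →
      (x ∈⁺ p ⟷ ((Σ Dom λ y → Tag x y 𝟎 × y ∈⁺ a) ⊎ (Σ Dom λ y → Tag x y 𝟏 × y ∈⁺ b)))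
    × (x ∈⁻ p ⟷ ((∀ y → Tag x y 𝟎 → y ∈⁻ a) × (∀ y → Tag x y 𝟏 → y ∈⁻ b)))

  Empty-𝟎 : T (Empty 0F) (𝟎 ∷ [])
  Empty-𝟎 x = let p , q , q′ = both 𝟎-comprises x in p , (λ _ → tt) , (λ _ → q′ id)

  Empty-unique : ∀ {o} → T (Empty 0F) (o ∷ []) → o ≡ 𝟎
  Empty-unique e = ext-true λ x → let p , _ , q′ = e x
                                      r , _ , s′ = Empty-𝟎 x in
    (absurd ∘ proj₁ p , absurd ∘ proj₁ r) , (λ _ → s′ tt) , (λ _ → q′ tt)

  opaque
    Pair : Dom → Dom → Dom → Set ℓ
    Pair = PairExt

    pair-ext : ∀ {p a b} → Pair p a b → PairExt p a b
    pair-ext π = π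

    ext-pair : ∀ {p a b} → PairExt p a b → Pair p a b
    ext-pair e = e

    pair-true : (i j k : Fin n) (ρ : Vec Dom n) →
      T (i is⟪ j , k ⟫) ρ ⟷ Pair (lookup ρ i) (lookup ρ j) (lookup ρ k)
    pair-true i j k ρ = to , λ e → 𝟎 , Empty-𝟎 , 𝟏 , 𝟏-sing , e
      where
      to : T (i is⟪ j , k ⟫) ρ → PairExt (lookup ρ i) (lookup ρ j) (lookup ρ k)
      to (o , ω , i , ι , e) with Empty-unique ω
      ... | refl with sing-unique ι 𝟏-sing
      ... | refl = e

  -- The disjoint sum is the union of two replacement images, of a under tagging with `𝟎` and of b
  -- under tagging with `𝟏`; both keep truth and falsity of membership.
  opair : ∀ a b → Σ Dom λ p → Pair p a b
  opair a b =
    let tagged = λ c → replace (1F isTagged 0F , 2F) (c ∷ []) tag-unique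
        l , λe = tagged 𝟎 a
        r , ρe = tagged 𝟏 b
        p , e = binaryUnion l r
    in p , ext-pair λ x →
       let u = ⊎-cong (proj₁ (λe x)) (proj₁ (ρe x))
           v = ×-cong (proj₂ (λe x)) (proj₂ (ρe x))
           (f , f′) , (g , g′) = e x
       in (proj₁ u ∘ f , f′ ∘ proj₂ u) , (proj₁ v ∘ g , g′ ∘ proj₂ v)

  pair-unique : ∀ {p q a b} → Pair p a b → Pair q a b → p ≡ q
  pair-unique π π′ = ext-true λ x →
      proj₁ (pair-ext π x) via proj₁ (pair-ext π′ x)
    , proj₂ (pair-ext π x) via proj₂ (pair-ext π′ x)

  tag-𝟎𝟏 : ∀ {k a b} → Tag k a 𝟎 → Tag k b 𝟏 → ⊥ {ℓ}
  tag-𝟎𝟏 p q = 𝟎≢𝟏 (tag-second p q)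

  module _ {p a b} (π : Pair p a b) where
    pair-first⁺ : ∀ {x k} → Tag k x 𝟎 → k ∈⁺ p ⟷ x ∈⁺ a
    pair-first⁺ {x} {k} τ = let f , f′ = proj₁ (pair-ext π k) in
        (λ k∈ → [ (λ (y , τ′ , y∈) → subst (_∈⁺ a) (tag-first τ′ τ) y∈)
                , (λ (y , τ′ , _) → absurd (tag-𝟎𝟏 τ τ′)) ]′ (f k∈))
      , (λ x∈ → f′ (inj₁ (x , τ , x∈)))

    pair-first⁻ : ∀ {x k} → Tag k x 𝟎 → k ∈⁻ p ⟷ x ∈⁻ a
    pair-first⁻ {x} {k} τ = let g , g′ = proj₂ (pair-ext π k) in
        (λ k∉ → proj₁ (g k∉) x τ)
      , (λ x∉ → g′ ((λ y τ′ → subst (_∈⁻ a) (tag-first τ τ′) x∉)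
                   , (λ y τ′ → absurd (tag-𝟎𝟏 τ τ′))))

    pair-second⁺ : ∀ {x k} → Tag k x 𝟏 → k ∈⁺ p ⟷ x ∈⁺ b
    pair-second⁺ {x} {k} τ = let f , f′ = proj₁ (pair-ext π k) in
        (λ k∈ → [ (λ (y , τ′ , _) → absurd (tag-𝟎𝟏 τ′ τ))
                , (λ (y , τ′ , y∈) → subst (_∈⁺ b) (tag-first τ′ τ) y∈) ]′ (f k∈))
      , (λ x∈ → f′ (inj₂ (x , τ , x∈)))

    pair-second⁻ : ∀ {x k} → Tag k x 𝟏 → k ∈⁻ p ⟷ x ∈⁻ b
    pair-second⁻ {x} {k} τ = let g , g′ = proj₂ (pair-ext π k) in
        (λ k∉ → proj₂ (g k∉) x τ)
      , (λ x∉ → g′ ((λ y τ′ → absurd (tag-𝟎𝟏 τ′ τ))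
                   , (λ y τ′ → subst (_∈⁻ b) (tag-first τ τ′) x∉)))

  -- Membership of x in the component, true or false, can be read off the pair at the tag of x, so
  -- extensionality applies.
  pair-first : ∀ {p a b a′ b′} → Pair p a b → Pair p a′ b′ → a ≡ a′
  pair-first π π′ = ext-true λ x → let k , τ = tag x 𝟎 in
      swap (pair-first⁺ π τ) via swap (pair-first⁺ π′ τ)
    , swap (pair-first⁻ π τ) via swap (pair-first⁻ π′ τ)

  pair-second : ∀ {p a b a′ b′} → Pair p a b → Pair p a′ b′ → b ≡ b′
  pair-second π π′ = ext-true λ x → let k , τ = tag x 𝟏 in
      swap (pair-second⁺ π τ) via swap (pair-second⁺ π′ τ)
    , swap (pair-second⁻ π τ) via swap (pair-second⁻ π′ τ)

  -- A point that separates the pairs belongs truly to one of them, hence is a tagged x, and the tag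
  -- tells in which component x is separating. Conversely, tagging a point that separates two
  -- components separates the pairs.
  pair-=⁻ : ∀ {p q a b c d} → Pair p a b → Pair q c d → p =⁻ q ⟷ (a =⁻ c ⊎ b =⁻ d)
  pair-=⁻ {p} {q} {a} {b} {c} {d} π π′ = to ∘ proj₁ =⁻⟷Separated , proj₂ =⁻⟷Separated ∘ from
    where
    to : Separated p q → a =⁻ c ⊎ b =⁻ d
    to (k , inj₁ (k∈ , k∉)) = [ (λ (y , τ , y∈) → inj₁ (proj₂ =⁻⟷Separated
                                    (y , inj₁ (y∈ , proj₁ (pair-first⁻ π′ τ) k∉))))
                              , (λ (y , τ , y∈) → inj₂ (proj₂ =⁻⟷Separated
                                    (y , inj₁ (y∈ , proj₁ (pair-second⁻ π′ τ) k∉)))) ]′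
                              (proj₁ (proj₁ (pair-ext π k)) k∈)
    to (k , inj₂ (k∉ , k∈)) = [ (λ (y , τ , y∈) → inj₁ (proj₂ =⁻⟷Separated
                                    (y , inj₂ (proj₁ (pair-first⁻ π τ) k∉ , y∈))))
                              , (λ (y , τ , y∈) → inj₂ (proj₂ =⁻⟷Separated
                                    (y , inj₂ (proj₁ (pair-second⁻ π τ) k∉ , y∈)))) ]′
                              (proj₁ (proj₁ (pair-ext π′ k)) k∈)

    from : a =⁻ c ⊎ b =⁻ d → Separated p q
    from (inj₁ e) =
      let x , s = proj₁ =⁻⟷Separated e
          k , τ = tag x 𝟎
      in k , [ (λ (u , v) → inj₁ (proj₂ (pair-first⁺ π τ) u , proj₂ (pair-first⁻ π′ τ) v))
             , (λ (u , v) → inj₂ (proj₂ (pair-first⁻ π τ) u , proj₂ (pair-first⁺ π′ τ) v)) ]′ s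
    from (inj₂ e) =
      let x , s = proj₁ =⁻⟷Separated e
          k , τ = tag x 𝟏
      in k , [ (λ (u , v) → inj₁ (proj₂ (pair-second⁺ π τ) u , proj₂ (pair-second⁻ π′ τ) v))
             , (λ (u , v) → inj₂ (proj₂ (pair-second⁻ π τ) u , proj₂ (pair-second⁺ π′ τ) v)) ]′ s

  -- Functions as sets of pairs

  opaque
    App : Dom → Dom → Dom → Set ℓ
    App f x y = Σ Dom λ p → Pair p x y × p ∈⁺ f

    app-intro : ∀ {f p x y} → Pair p x y → p ∈⁺ f → App f x y
    app-intro π p∈ = _ , π , p∈

    app-elim : ∀ {f x y} → App f x y → Σ Dom λ p → Pair p x y × p ∈⁺ f
    app-elim a = a

    app-true : (i j k : Fin n) (ρ : Vec Dom n) →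
      T (⟪ i , j ⟫∈ k) ρ ⟷ App (lookup ρ k) (lookup ρ i) (lookup ρ j)
    app-true i j k ρ = Σ-cong λ p → ×-cong (pair-true 0F (suc i) (suc j) (p ∷ ρ)) (id , id)

    -- The falsity of a membership in f is its non-truth only because f is classical.
    app-false : (i j k : Fin n) (ρ : Vec Dom n) → Cl (lookup ρ k) →
      F⁻ (⟪ i , j ⟫∈ k) ρ ⟷ (¬ App (lookup ρ k) (lookup ρ i) (lookup ρ j))
    app-false i j k ρ cl =
        (λ h (p , π , p∈) → Cl-∉⁻ cl p∈ (h p (proj₂ (pair-true 0F (suc i) (suc j) (p ∷ ρ)) π)))
      , (λ na p π → Cl-∈⁻ cl λ p∈ → na (p , proj₁ (pair-true 0F (suc i) (suc j) (p ∷ ρ)) π , p∈))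

  record Graph (f : Dom) (R : Dom → Dom → Set ℓ) : Set ℓ where
    field
      classical : Cl f
      pairs     : ∀ p → p ∈⁺ f → Σ Dom λ a → Σ Dom λ b → Pair p a b
      appOut    : ∀ {x y} → App f x y → R x y
      appInto   : ∀ {x y} → R x y → App f x y

  open Graph public using (appOut; appInto)

  Defines : Form (suc (suc n)) → Vec Dom n → (Dom → Dom → Set ℓ) → Set ℓ
  Defines φ ρ R = ∀ x y → T φ (x ∷ y ∷ ρ) ⟷ R x y

  module _ (φ : Form (suc (suc n))) (ρ : Vec Dom n) (R : Dom → Dom → Set ℓ)
           (def : Defines φ ρ R) (fun : Functional R) {X : Dom} (clX : Cl X) where
    image : Σ Dom λ B → B Comprises λ y → Σ Dom λ x → R x y × x ∈⁺ X
    image =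
      let B , c = replaceCl φ ρ (λ t u → fun (proj₁ (def _ _) t) (proj₁ (def _ _) u)) clX
      in B , record
        { classical = classical c
        ; out  = λ y∈ → let x , t , x∈ = out c y∈ in x , proj₁ (def _ _) t , x∈
        ; into = λ (x , r , x∈) → into c (x , proj₂ (def _ _) r , x∈) }

  module _ (φ : Form (suc (suc n))) (ρ : Vec Dom n) (R : Dom → Dom → Set ℓ)
           (def : Defines φ ρ R) (fun : Functional R) {X : Dom} (clX : Cl X) where
    private
      -- In the formula for `PairIn` the bound y comes before x and p follows, whereas φ expects x
      -- first and y second.
      exchange : Fin (suc (suc n)) → Fin (suc (suc (suc n)))
      exchange = 1F F.∷ 0F F.∷ ↑³

      agree : ∀ {x y p} → Agree 𝔐 exchange (x ∷ y ∷ ρ) (y ∷ x ∷ p ∷ ρ)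
      agree 0F            = refl
      agree 1F            = refl
      agree (suc (suc i)) = refl

      PairIn : Dom → Dom → Set ℓ
      PairIn x p = Σ Dom λ y → Pair p x y × R x y

      PairIn-true : ∀ x p → T (ex (2F is⟪ 1F , 0F ⟫ & rename exchange φ)) (x ∷ p ∷ ρ) ⟷ PairIn x p
      PairIn-true x p = Σ-cong λ y → ×-cong (pair-true 2F 1F 0F (y ∷ x ∷ p ∷ ρ))
        ( (λ t → proj₁ (def x y) (proj₁ (True-rename 𝔐 φ agree) t))
        , (λ r → proj₂ (True-rename 𝔐 φ agree) (proj₂ (def x y) r)))

      unique : Functional PairIn
      unique {x} {p} {q} (y , π , r) (z , π′ , r′) = pair-unique π (subst (Pair q x) (fun r′ r) π′)

      G : Σ Dom λ f → f Comprises λ p → Σ Dom λ x → PairIn x p × x ∈⁺ X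
      G = image (ex (2F is⟪ 1F , 0F ⟫ & rename exchange φ)) ρ PairIn PairIn-true unique clX

    -- The graph is the image of X under x ↦ (x, y) with y the value of R at x. This is functional
    -- because R is, so replacement produces it.
    graph : Σ Dom λ f → Graph f λ x y → x ∈⁺ X × R x y
    graph = proj₁ G , record
        { classical = classical c
        ; pairs     = λ p p∈ → let x , (y , π , _) , _ = out c p∈ in x , y , π
        ; appOut    = λ {x} {y} a → let p , π , p∈ = app-elim a
                                        x′ , (y′ , π′ , r) , x∈ = out c p∈ in
            subst (_∈⁺ X) (pair-first π′ π) x∈
          , subst (R x) (pair-second π′ π) (subst (λ x → R x y′) (pair-first π′ π) r)
        ; appInto   = λ {x} {y} (x∈ , r) → let p , π = opair x y in
            app-intro π (into c (x , (y , π , r) , x∈))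
        }
      where c = proj₂ G

  -- Functions and injections inside the model.

  record IsFunction (f : Dom) : Set ℓ where
    field
      isClassical : Cl f
      isPairs     : ∀ p → p ∈⁺ f → Σ Dom λ a → Σ Dom λ b → Pair p a b
      functional  : Functional (App f)

  record Inj (f : Dom) : Set ℓ where
    field
      isFunction : IsFunction f
      injective  : Functional λ y x → App f x y

    open IsFunction isFunction public

  open Inj public using ()
    renaming (isClassical to Inj-Cl; functional to Inj-functional; injective to Inj-injective)

  graph-inj : ∀ {f R} → Graph f R → Functional R → Functional (λ y x → R x y) → Inj f
  graph-inj γ fun inj = record
    { isFunction = record
      { isClassical = Graph.classical γ
      ; isPairs     = Graph.pairs γ
      ; functional  = λ p q → fun (appOut γ p) (appOut γ q) }
    ; injective = λ p q → inj (appOut γ p) (appOut γ q) }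

  restricted-inj : ∀ {f X R} → Graph f (λ x y → x ∈⁺ X × R x y) →
                   Functional R → Functional (λ y x → R x y) → Inj f
  restricted-inj γ fun inj =
    graph-inj γ (λ (_ , p) (_ , q) → fun p q) (λ (_ , p) (_ , q) → inj p q)

  Function⟷true : (i : Fin n) (ρ : Vec Dom n) → IsFunction (lookup ρ i) ⟷ T (Function i) ρ
  Function⟷true i ρ =
      (λ f → let open IsFunction f in
          isClassical
        , (λ p p∈ → let a , b , π = isPairs p p∈ in
             a , b , proj₂ (pair-true 2F 1F 0F (b ∷ a ∷ p ∷ ρ)) π)
        , λ a b c (s , t) → functional (proj₁ (app-true 2F 1F (↑³ i) (c ∷ b ∷ a ∷ ρ)) s)
                                       (proj₁ (app-true 2F 0F (↑³ i) (c ∷ b ∷ a ∷ ρ)) t) , tt)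
    , (λ (cl , ps , fun) → record
        { isClassical = cl
        ; isPairs     = λ p p∈ → let a , b , π = ps p p∈ in
            a , b , proj₁ (pair-true 2F 1F 0F (b ∷ a ∷ p ∷ ρ)) π
        ; functional  = λ {a} {b} {c} s t → proj₁ (fun a b c
            ( proj₂ (app-true 2F 1F (↑³ i) (c ∷ b ∷ a ∷ ρ)) s
            , proj₂ (app-true 2F 0F (↑³ i) (c ∷ b ∷ a ∷ ρ)) t)) })

  Injection⟷true : (i : Fin n) (ρ : Vec Dom n) → Inj (lookup ρ i) ⟷ T (Injection i) ρ
  Injection⟷true i ρ =
      (λ f → let open Inj f in
          proj₁ (Function⟷true i ρ) isFunction
        , λ a b c (s , t) → injective (proj₁ (app-true 2F 0F (↑³ i) (c ∷ b ∷ a ∷ ρ)) s)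
                                      (proj₁ (app-true 1F 0F (↑³ i) (c ∷ b ∷ a ∷ ρ)) t) , tt)
    , (λ (f , inj) → record
        { isFunction = proj₂ (Function⟷true i ρ) f
        ; injective  = λ {c} {a} {b} s t → proj₁ (inj a b c
            ( proj₂ (app-true 2F 0F (↑³ i) (c ∷ b ∷ a ∷ ρ)) s
            , proj₂ (app-true 1F 0F (↑³ i) (c ∷ b ∷ a ∷ ρ)) t)) })

  TrueIff : Dom → (Dom → Set ℓ) → (Dom → Set ℓ) → Set ℓ
  TrueIff S P Q = ∀ x → (x ∈⁺ S ⟷ P x) × (x ∈⁻ S ⟷ Q x)

  -- A set is classical as soon as its falsity condition is the negation of its truth condition.
  trueIff⟷comprises : ∀ {S P P′ Q} → (∀ x → P x ⟷ P′ x) → (∀ x → Q x ⟷ (¬ P′ x)) →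
                      TrueIff S P Q ⟷ S Comprises P′
  trueIff⟷comprises e e′ =
      (λ t → comprises λ x →
          (proj₁ (e x) ∘ proj₁ (proj₁ (t x)) , proj₂ (proj₁ (t x)) ∘ proj₂ (e x))
        , (proj₁ (e′ x) ∘ proj₁ (proj₂ (t x)) , proj₂ (proj₂ (t x)) ∘ proj₂ (e′ x)))
    , (λ c x →
          (proj₂ (e x) ∘ proj₁ (proj₁ (both c x)) , proj₂ (proj₁ (both c x)) ∘ proj₁ (e x))
        , (proj₂ (e′ x) ∘ proj₁ (proj₂ (both c x)) , proj₂ (proj₂ (both c x)) ∘ proj₁ (e′ x)))

  ¬∃ : {D : Set ℓ} {P Q : D → Set ℓ} → (∀ a → Q a ⟷ (¬ P a)) → (∀ a → Q a) ⟷ (¬ Σ D P)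
  ¬∃ e = (λ h (a , p) → proj₁ (e a) (h a) p) , (λ n a → proj₂ (e a) λ p → n (a , p))

  domain-true : (i j : Fin n) (ρ : Vec Dom n) → Cl (lookup ρ j) →
    T (i isDomain j) ρ ⟷ lookup ρ i Comprises (λ x → Σ Dom (App (lookup ρ j) x))
  domain-true i j ρ cl = trueIff⟷comprises
    (λ x → Σ-cong λ y → app-true 1F 0F (suc (suc j)) (y ∷ x ∷ ρ))
    (λ x → ¬∃ λ y → app-false 1F 0F (suc (suc j)) (y ∷ x ∷ ρ) cl)

  range-true : (i j : Fin n) (ρ : Vec Dom n) → Cl (lookup ρ j) →
    T (i isRange j) ρ ⟷ lookup ρ i Comprises (λ y → Σ Dom λ x → App (lookup ρ j) x y)
  range-true i j ρ cl = trueIff⟷comprises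
    (λ y → Σ-cong λ x → app-true 0F 1F (suc (suc j)) (x ∷ y ∷ ρ))
    (λ y → ¬∃ λ x → app-false 0F 1F (suc (suc j)) (x ∷ y ∷ ρ) cl)

  -- Embeddings and bijections.

  record Embeds (h X Y : Dom) : Set ℓ where
    field
      inj    : Inj h
      source : ∀ {x y} → App h x y → x ∈⁺ X
      target : ∀ {x y} → App h x y → y ∈⁺ Y
      total  : ∀ {x} → x ∈⁺ X → Σ Dom (App h x)

    functional : Functional (App h)
    functional = Inj-functional inj

    injective : Functional (λ y x → App h x y)
    injective = Inj-injective inj

  record Bijects (h X Y : Dom) : Set ℓ where
    field
      embeds : Embeds h X Y
      onto   : ∀ {y} → y ∈⁺ Y → Σ Dom λ x → App h x y

    open Embeds embeds public

  _↪_ _≈_ : Dom → Dom → Set ℓ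
  X ↪ Y = Σ Dom λ h → Embeds h X Y
  X ≈ Y = Σ Dom λ h → Bijects h X Y

  ≈⇒↪ : ∀ {X Y} → X ≈ Y → X ↪ Y
  ≈⇒↪ (h , b) = h , Bijects.embeds b

  InBijection⟷≈ : (i j : Fin n) (ρ : Vec Dom n) → Cl (lookup ρ i) → Cl (lookup ρ j) →
    T (InBijection i j) ρ ⟷ lookup ρ i ≈ lookup ρ j
  InBijection⟷≈ i j ρ clX clY =
      (λ (h , inj , d , r) → bijects (proj₂ (Injection⟷true 0F (h ∷ ρ)) inj)
        (λ cl → proj₁ (domain-true (suc i) 0F (h ∷ ρ) cl) d)
        (λ cl → proj₁ (range-true (suc j) 0F (h ∷ ρ) cl) r))
    , (λ (h , b) → h , proj₁ (Injection⟷true 0F (h ∷ ρ)) (Bijects.inj b)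
        , proj₂ (domain-true (suc i) 0F (h ∷ ρ) (Inj-Cl (Bijects.inj b))) (record
            { classical = clX ; out = Bijects.total b ; into = λ (_ , a) → Bijects.source b a })
        , proj₂ (range-true (suc j) 0F (h ∷ ρ) (Inj-Cl (Bijects.inj b))) (record
            { classical = clY ; out = Bijects.onto b ; into = λ (_ , a) → Bijects.target b a }))
    where
    bijects : ∀ {h X Y} → Inj h →
      (Cl h → X Comprises λ x → Σ Dom (App h x)) →
      (Cl h → Y Comprises λ y → Σ Dom λ x → App h x y) → X ≈ Y
    bijects {h} inj d r = h , record
      { embeds = record
        { inj    = inj
        ; source = λ a → into (d (Inj-Cl inj)) (_ , a)
        ; target = λ a → into (r (Inj-Cl inj)) (_ , a)
        ; total  = out (d (Inj-Cl inj)) }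
      ; onto = out (r (Inj-Cl inj)) }

  converse : ∀ {h} → Functional (λ y x → App h x y) → ∀ {Y} → Cl Y →
             Σ Dom λ k → Graph k λ y x → y ∈⁺ Y × App h x y
  converse {h} inj clY = graph (⟪ 1F , 0F ⟫∈ 2F) (h ∷ []) (λ y x → App h x y)
    (λ y x → app-true 1F 0F 2F (y ∷ x ∷ h ∷ [])) inj clY

  composite : ∀ {h k} → Functional (App h) → Functional (App k) → ∀ {X} → Cl X →
              Σ Dom λ l → Graph l λ x z → x ∈⁺ X × Σ Dom λ y → App h x y × App k y z
  composite {h} {k} fun fun′ clX =
    graph (ex (⟪ 1F , 0F ⟫∈ 3F ∧̇ ⟪ 0F , 2F ⟫∈ 4F)) (h ∷ k ∷ [])
      (λ x z → Σ Dom λ y → App h x y × App k y z)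
      (λ x z → Σ-cong λ y → let ρ = y ∷ x ∷ z ∷ h ∷ k ∷ [] in
         ×-cong (app-true 1F 0F 3F ρ) (app-true 0F 2F 4F ρ))
      (λ (_ , p , q) (_ , p′ , q′) → fun′ q (subst (λ y → App k y _) (fun p′ p) q′)) clX

  ≈-sym : ∀ {X Y} → Cl Y → X ≈ Y → Y ≈ X
  ≈-sym clY (h , b) = let k , γ = converse injective clY in
    k , record
      { embeds = record
        { inj    = restricted-inj γ injective functional
        ; source = proj₁ ∘ appOut γ
        ; target = source ∘ proj₂ ∘ appOut γ
        ; total  = λ y∈ → let x , a = onto y∈ in x , appInto γ (y∈ , a) }
      ; onto = λ x∈ → let y , a = total x∈ in y , appInto γ (target a , a) }
    where open Bijects b

  module _ {X Y Z} (clX : Cl X) {h k} (b : Embeds h X Y) (c : Embeds k Y Z) where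
    private
      module E = Embeds b
      module E′ = Embeds c
      γ = proj₂ (composite E.functional E′.functional clX)

    ∘-embeds : Σ Dom λ l → Embeds l X Z × (∀ {x y z} → App h x y → App k y z → App l x z)
    ∘-embeds = _ , record
        { inj    = graph-inj γ
            (λ { (_ , _ , p , q) (_ , _ , p′ , q′) →
                 E′.functional q (subst (λ y → App k y _) (E.functional p′ p) q′) })
            (λ { (_ , _ , p , q) (_ , _ , p′ , q′) →
                 E.injective p (subst (App h _) (E′.injective q′ q) p′) })
        ; source = proj₁ ∘ appOut γ
        ; target = λ a → let _ , _ , _ , q = appOut γ a in E′.target q
        ; total  = λ x∈ → let y , p = E.total x∈
                              z , q = E′.total (E.target p)
                          in z , appInto γ (x∈ , y , p , q) }
      , λ p q → appInto γ (E.source p , _ , p , q)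

  ↪-trans : ∀ {X Y Z} → Cl X → X ↪ Y → Y ↪ Z → X ↪ Z
  ↪-trans clX (_ , b) (_ , c) = let l , e , _ = ∘-embeds clX b c in l , e

  ≈-trans : ∀ {X Y Z} → Cl X → X ≈ Y → Y ≈ Z → X ≈ Z
  ≈-trans clX (_ , b) (_ , c) =
    let l , e , app = ∘-embeds clX (Bijects.embeds b) (Bijects.embeds c) in
    l , record
      { embeds = e
      ; onto   = λ z∈ → let y , q = Bijects.onto c z∈
                            x , p = Bijects.onto b (Bijects.source c q)
                        in x , app p q }

  ⊆⇒↪ : ∀ {X Y} → Cl X → (∀ {x} → x ∈⁺ X → x ∈⁺ Y) → X ↪ Y
  ⊆⇒↪ {X} clX ⊆ =
    let h , γ = graph (0F ≐ 1F) [] _≡_ (λ x y → id , id) (λ p q → trans (sym p) q) clX in h , record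
    { inj    = restricted-inj γ (λ p q → trans (sym p) q) (λ p q → trans p (sym q))
    ; source = proj₁ ∘ appOut γ
    ; target = λ a → let x∈ , e = appOut γ a in ⊆ (subst (_∈⁺ X) e x∈)
    ; total  = λ {x} x∈ → x , appInto γ (x∈ , refl) }

  -- Ordinals

  record Ord (α : Dom) : Set ℓ where
    field
      isClassical : Cl α
      elements    : ∀ {x} → x ∈⁺ α → Cl x
      transitive  : ∀ {x y} → x ∈⁺ α → y ∈⁺ x → y ∈⁺ α
      irreflexive : ∀ {x} → x ∈⁺ α → ¬ x ∈⁺ x
      ∈-trans     : ∀ {x y z} → x ∈⁺ α → y ∈⁺ α → z ∈⁺ α → x ∈⁺ y → y ∈⁺ z → x ∈⁺ z
      compare     : ∀ {x y} → x ∈⁺ α → y ∈⁺ α → x ∈⁺ y ⊎ x ≡ y ⊎ y ∈⁺ x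
      minimum     : ∀ {S} → Cl S → (∀ {x} → x ∈⁺ S → x ∈⁺ α) → Σ Dom (_∈⁺ S) →
                    Σ Dom λ x → x ∈⁺ S × (∀ y → y ∈⁺ S → x ∈⁺ y ⊎ x ≡ y)

  -- The formula's `⊆̇` also demands that falsity passes back from the superset; between classical
  -- sets this follows from the inclusion of the true members.
  Ord⟷true : (i : Fin n) (ρ : Vec Dom n) → Ord (lookup ρ i) ⟷ T (Ordinal i) ρ
  Ord⟷true i ρ =
      (λ o → let open Ord o in
          isClassical , (λ _ → elements) , (λ _ p _ → transitive p) , (λ _ → irreflexive)
        , (λ _ p _ q _ r (s , t) → ∈-trans p q r s t) , (λ _ p _ q → compare p q)
        , λ S (c , s , i) → minimum c (λ {x} → proj₁ (s x)) i)
    , (λ (c , h , t , irr , ∈t , tri , wf) → record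
        { isClassical = c ; elements = h _ ; transitive = λ p → t _ p _ ; irreflexive = irr _
        ; ∈-trans = λ p q r s t → ∈t _ p _ q _ r (s , t) ; compare = λ p q → tri _ p _ q
        ; minimum = λ cS s i → wf _ (cS , (λ x → s , λ n → Cl-∈⁻ cS λ p → Cl-∉⁻ c (s p) n) , i) })

  open Ord using (transitive; elements; irreflexive; ∈-trans; compare; minimum)

  Ord-∉-self : ∀ {α} → Ord α → ¬ α ∈⁺ α
  Ord-∉-self o p = irreflexive o p p

  Ord-subset : ∀ {α β} → Ord α → Cl β → (∀ {x} → x ∈⁺ β → x ∈⁺ α) →
               (∀ {x y} → x ∈⁺ β → y ∈⁺ x → y ∈⁺ β) → Ord β
  Ord-subset o c ⊆ t = record
    { isClassical = c
    ; elements = elements o ∘ ⊆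
    ; transitive = t
    ; irreflexive = irreflexive o ∘ ⊆
    ; ∈-trans = λ p q r → ∈-trans o (⊆ p) (⊆ q) (⊆ r)
    ; compare = λ p q → compare o (⊆ p) (⊆ q)
    ; minimum = λ cS s i → minimum o cS (⊆ ∘ s) i }

  Ord-element : ∀ {α β} → Ord α → β ∈⁺ α → Ord β
  Ord-element o β∈ = Ord-subset o (elements o β∈) (transitive o β∈)
    λ x∈ y∈ → let x∈α = transitive o β∈ x∈ in
      ∈-trans o (transitive o x∈α y∈) x∈α β∈ y∈ x∈

  -- If the inclusion is proper, the least element of β ∖ α is α itself: by minimality its elements
  -- lie in α, and since α is transitive no element of α equals or exceeds it.
  Ord-⊆ : ∀ {α β} → Ord α → Ord β → (∀ {x} → x ∈⁺ α → x ∈⁺ β) → α ≡ β ⊎ α ∈⁺ β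
  Ord-⊆ {α} {β} o o′ ⊆ with decide (Σ Dom λ x → x ∈⁺ β × (¬ x ∈⁺ α))
  ... | inj₂ none = inj₁ (comprises-≡ (Ord.isClassical o) (Ord.isClassical o′) λ x →
          ⊆ , λ x∈ → by-contradiction λ x∉ → none (x , x∈ , x∉))
  ... | inj₁ (x₀ , x₀∈ , x₀∉) = inj₂ (subst (_∈⁺ β) μ≡α (proj₁ (out c μ∈)))
    where
    D = sep (¬̇ (0F ∈̇ 1F)) (α ∷ []) (Ord.isClassical o′)
    c = proj₂ D
    least = minimum o′ (classical c) (proj₁ ∘ out c) (x₀ , into c (x₀∈ , x₀∉))
    μ = proj₁ least
    μ∈ = proj₁ (proj₂ least)
    μ∈β = proj₁ (out c μ∈)
    μ≡α : μ ≡ α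
    μ≡α = comprises-≡ (elements o′ μ∈β) (Ord.isClassical o) λ x →
        (λ x∈μ → let x∈β = transitive o′ μ∈β x∈μ in by-contradiction λ x∉α →
          [ (λ μ∈x → irreflexive o′ μ∈β (∈-trans o′ μ∈β x∈β μ∈β μ∈x x∈μ))
          , (λ { refl → irreflexive o′ μ∈β x∈μ }) ]′
          (proj₂ (proj₂ least) x (into c (x∈β , x∉α))))
      , (λ x∈α → [ id , [ (λ { refl → absurd (proj₂ (out c μ∈) x∈α) })
                        , (λ μ∈x → absurd (proj₂ (out c μ∈) (transitive o x∈α μ∈x))) ]′ ]′
                 (compare o′ (⊆ x∈α) μ∈β))

  -- The intersection is an ordinal included in both. If it were an element of both, it would be an
  -- element of itself.
  Ord-compare : ∀ {α β} → Ord α → Ord β → α ∈⁺ β ⊎ α ≡ β ⊎ β ∈⁺ α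
  Ord-compare {α} {β} o o′ =
    [ (λ γ≡α → [ (λ γ≡β → inj₂ (inj₁ (trans (sym γ≡α) γ≡β)))
               , (λ γ∈β → inj₁ (subst (_∈⁺ β) γ≡α γ∈β)) ]′
               (Ord-⊆ oγ o′ (proj₂ ∘ out c)))
    , (λ γ∈α → [ (λ γ≡β → inj₂ (inj₂ (subst (_∈⁺ α) γ≡β γ∈α)))
               , (λ γ∈β → absurd (irreflexive o γ∈α (into c (γ∈α , γ∈β)))) ]′
               (Ord-⊆ oγ o′ (proj₂ ∘ out c))) ]′
    (Ord-⊆ oγ o (proj₁ ∘ out c))
    where
    γ = sep (0F ∈̇ 1F) (β ∷ []) (Ord.isClassical o)
    c = proj₂ γ
    oγ = Ord-subset o (classical c) (proj₁ ∘ out c)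
      λ x∈ y∈ → let p , q = out c x∈ in into c (transitive o p y∈ , transitive o′ q y∈)

  -- The ordinals satisfying φ may form a proper class, so the minimum is taken among those below α;
  -- any others are compared with α.
  Ord-least : (φ : Form (suc n)) (ρ : Vec Dom n) → ∀ {α} → Ord α → T φ (α ∷ ρ) →
    Σ Dom λ μ → Ord μ × T φ (μ ∷ ρ) × (∀ {β} → Ord β → T φ (β ∷ ρ) → μ ∈⁺ β ⊎ μ ≡ β)
  Ord-least φ ρ {α} o t with decide (Σ Dom λ β → β ∈⁺ α × T φ (β ∷ ρ))
  ... | inj₂ none = α , o , t , λ o′ u →
          [ inj₁ , [ inj₂ , (λ β∈α → absurd (none (_ , β∈α , u))) ]′ ]′ (Ord-compare o o′)
  ... | inj₁ (β₀ , β₀∈ , t₀) = μ , Ord-element o μ∈α , proj₂ (out c μ∈) , λ o′ u →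
          [ (λ α∈β → inj₁ (transitive o′ α∈β μ∈α))
          , [ (λ { refl → inj₁ μ∈α }) , (λ β∈α → least _ (into c (β∈α , u))) ]′ ]′ (Ord-compare o o′)
    where
    S = sep φ ρ (Ord.isClassical o)
    c = proj₂ S
    M = minimum o (classical c) (proj₁ ∘ out c) (β₀ , into c (β₀∈ , t₀))
    μ = proj₁ M
    μ∈ = proj₁ (proj₂ M)
    μ∈α = proj₁ (out c μ∈)
    least = proj₂ (proj₂ M)

  Ord-induction : (φ : Form (suc n)) (ρ : Vec Dom n) →
    (∀ {α} → Ord α → (∀ {β} → β ∈⁺ α → T φ (β ∷ ρ)) → T φ (α ∷ ρ)) →
    ∀ {α} → Ord α → T φ (α ∷ ρ)
  Ord-induction φ ρ step o = by-contradiction λ nt →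
    let μ , oμ , nμ , least = Ord-least (¬̇ φ) ρ o nt in
    nμ (step oμ λ β∈μ → by-contradiction λ nβ →
      [ (λ μ∈β → irreflexive oμ β∈μ (transitive (Ord-element oμ β∈μ) μ∈β β∈μ))
      , (λ { refl → irreflexive oμ β∈μ β∈μ }) ]′ (least (Ord-element oμ β∈μ) nβ))

  Ord-of-ordinals : ∀ {δ} → Cl δ → (∀ {x} → x ∈⁺ δ → Ord x) →
    (∀ {x y} → x ∈⁺ δ → y ∈⁺ x → y ∈⁺ δ) → Ord δ
  Ord-of-ordinals cl ord t = record
    { isClassical = cl
    ; elements = Ord.isClassical ∘ ord
    ; transitive = t
    ; irreflexive = λ x∈ → Ord-∉-self (ord x∈)
    ; ∈-trans = λ _ _ z∈ x∈y y∈z → transitive (ord z∈) y∈z x∈y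
    ; compare = λ p q → Ord-compare (ord p) (ord q)
    ; minimum = λ {S} cS s (x , x∈) →
        let μ , _ , μ∈ , least = Ord-least (0F ∈̇ 1F) (S ∷ []) (ord (s x∈)) x∈ in
        μ , μ∈ , λ y y∈ → least (ord (s y∈)) y∈ }

  -- The well-ordering theorem

  -- F follows the recursion β ↦ g(X ∖ F[β]) on an initial segment of the
  -- ordinals, where g is a choice function.
  approximation : Fin n → Fin n → Fin n → Form n
  approximation F X g = ∀̇ λ β → ∀̇ λ x → ⟪ ↑ β , x ⟫∈ ↑² F →̇
      Ordinal (↑ β)
    ∧̇ (∀̇ λ γ → γ ∈̇ ↑² β →̇ ∃̇ λ y → ⟪ ↑ γ , y ⟫∈ ↑² (↑² F))
    ∧̇ (∃̇ λ D → Classical D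
        ∧̇ (∀̇ λ z → z ∈̇ ↑ D ↔̇ z ∈̇ ↑² (↑² X) ∧̇
             (∀̇ λ γ → γ ∈̇ ↑² (↑² β) →̇ ¬̇ ⟪ γ , ↑ z ⟫∈ ↑³ (↑² F)))
        ∧̇ ⟪ D , ↑ x ⟫∈ ↑³ g)

  IsRest : Dom → Dom → Dom → Dom → Set ℓ
  IsRest F X β D = Cl D × (∀ z → z ∈⁺ D ⟷ (z ∈⁺ X × (∀ γ → γ ∈⁺ β → ¬ App F γ z)))

  record Step (F X g β x : Dom) : Set ℓ where
    field
      ordinal : Ord β
      below   : ∀ {γ} → γ ∈⁺ β → Σ Dom λ y → App F γ y
      rest    : Dom
      isRest  : IsRest F X β rest
      chosen  : App g rest x

  record ChoiceOn (X g : Dom) : Set ℓ where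
    field
      functional : Functional (App g)
      choose     : ∀ {D} → Cl D → (∀ {x} → x ∈⁺ D → x ∈⁺ X) → Σ Dom (_∈⁺ D) → Σ Dom (App g D)
      chosen∈    : ∀ {D x} → App g D x → x ∈⁺ D

  Approximation : Dom → Dom → Dom → Set ℓ
  Approximation F X g = ∀ {β x} → App F β x → Step F X g β x

  approximation-true : (F X g : Fin n) (ρ : Vec Dom n) →
    T (approximation F X g) ρ ⟷ Approximation (lookup ρ F) (lookup ρ X) (lookup ρ g)
  approximation-true F X g ρ =
      (λ t {β} {x} p →
        let o , b , D , cl , r , c = t β x (proj₂ (app-true 1F 0F (↑² F) (x ∷ β ∷ ρ)) p) in record
          { ordinal = proj₂ (Ord⟷true 1F (x ∷ β ∷ ρ)) o
          ; below   = λ {γ} γ∈ → proj₁ (defined x β γ) (b γ γ∈)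
          ; rest    = D
          ; isRest  = cl , proj₁ (rest-true D x β) r
          ; chosen  = proj₁ (app-true 0F 1F (↑³ g) (D ∷ x ∷ β ∷ ρ)) c })
    , (λ a β x p → let open Step (a (proj₁ (app-true 1F 0F (↑² F) (x ∷ β ∷ ρ)) p)) in
          proj₁ (Ord⟷true 1F (x ∷ β ∷ ρ)) ordinal
        , (λ γ γ∈ → proj₂ (defined x β γ) (below γ∈))
        , rest , proj₁ isRest , proj₂ (rest-true rest x β) (proj₂ isRest)
        , proj₂ (app-true 0F 1F (↑³ g) (rest ∷ x ∷ β ∷ ρ)) chosen)
    where
    defined : ∀ x β γ → T (ex (⟪ 1F , 0F ⟫∈ ↑² (↑² F))) (γ ∷ x ∷ β ∷ ρ) ⟷ Σ Dom (App (lookup ρ F) γ)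
    defined x β γ = Σ-cong λ y → app-true 1F 0F (↑² (↑² F)) (y ∷ γ ∷ x ∷ β ∷ ρ)

    fresh : ∀ D x β z →
      T (all (0F ∈̇ 4F →̇ ¬̇ ⟪ 0F , 1F ⟫∈ ↑³ (↑² F))) (z ∷ D ∷ x ∷ β ∷ ρ) ⟷
      (∀ γ → γ ∈⁺ β → ¬ App (lookup ρ F) γ z)
    fresh D x β z = Π-cong λ γ → →-cong (id , id)
      (→-cong (app-true 0F 1F (↑³ (↑² F)) (γ ∷ z ∷ D ∷ x ∷ β ∷ ρ)) (id , id))

    rest-true : ∀ D x β →
      T (all (0F ∈̇ 1F ↔̇ 0F ∈̇ ↑² (↑² X) ∧̇ all (0F ∈̇ 4F →̇ ¬̇ ⟪ 0F , 1F ⟫∈ ↑³ (↑² F)))) (D ∷ x ∷ β ∷ ρ) ⟷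
      (∀ z → z ∈⁺ D ⟷ (z ∈⁺ lookup ρ X × (∀ γ → γ ∈⁺ β → ¬ App (lookup ρ F) γ z)))
    rest-true D x β = Π-cong λ z →
      ×-cong (→-cong (id , id) (×-cong (id , id) (fresh D x β z)))
             (→-cong (×-cong (id , id) (fresh D x β z)) (id , id))

  enumerates : Fin n → Fin n → Fin n → Fin n → Form n
  enumerates β x X g = ∃̇ λ F → approximation F (↑ X) (↑ g) ∧̇ ⟪ ↑ β , ↑ x ⟫∈ F

  module _ {X g} (clX : Cl X) (ch : ChoiceOn X g) where
    private module C = ChoiceOn ch

    -- By induction both are defined and equal below β. They therefore leave the same rest of X,
    -- from which the choice function picks the same value.
    approximations-agree : ∀ {F F′} → Approximation F X g → Approximation F′ X g →
      ∀ {β} → Ord β → ∀ x x′ → App F β x → App F′ β x′ → x ≡ x′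
    approximations-agree {F} {F′} a a′ o = proj₁ (agreement _)
      (Ord-induction (all (all (⟪ 2F , 1F ⟫∈ 3F →̇ ⟪ 2F , 0F ⟫∈ 4F →̇ 1F ≐ 0F))) (F ∷ F′ ∷ [])
        (λ oα ih → proj₂ (agreement _) λ x x′ p p′ →
          agree (a p) (a′ p′) λ γ∈ → proj₁ (agreement _) (ih γ∈)) o)
      where
      agreement : ∀ β → T (all (all (⟪ 2F , 1F ⟫∈ 3F →̇ ⟪ 2F , 0F ⟫∈ 4F →̇ 1F ≐ 0F))) (β ∷ F ∷ F′ ∷ []) ⟷
                        (∀ x x′ → App F β x → App F′ β x′ → x ≡ x′)
      agreement β = Π-cong λ x → Π-cong λ x′ →
        →-cong (app-true 2F 1F 3F (x′ ∷ x ∷ β ∷ F ∷ F′ ∷ []))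
          (→-cong (app-true 2F 0F 4F (x′ ∷ x ∷ β ∷ F ∷ F′ ∷ [])) (id , id))

      agree : ∀ {β x x′} → Step F X g β x → Step F′ X g β x′ →
        (∀ {γ} → γ ∈⁺ β → ∀ y y′ → App F γ y → App F′ γ y′ → y ≡ y′) → x ≡ x′
      agree {x′ = x′} s s′ ih =
        C.functional S.chosen (subst (λ D → App g D x′) (sym rest≡) S′.chosen)
        where
        module S = Step s
        module S′ = Step s′
        rest≡ : S.rest ≡ S′.rest
        rest≡ = comprises-≡ (proj₁ S.isRest) (proj₁ S′.isRest) λ z →
            (λ z∈ → let z∈X , z∉ = proj₁ (proj₂ S.isRest z) z∈ in
              proj₂ (proj₂ S′.isRest z) (z∈X , λ γ γ∈ q → let y , r = S.below γ∈ in
                z∉ γ γ∈ (subst (App F γ) (ih γ∈ y z r q) r)))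
          , (λ z∈ → let z∈X , z∉ = proj₁ (proj₂ S′.isRest z) z∈ in
              proj₂ (proj₂ S.isRest z) (z∈X , λ γ γ∈ q → let y , r = S′.below γ∈ in
                z∉ γ γ∈ (subst (App F′ γ) (sym (ih γ∈ z y q r)) r)))

    -- The union of all approximations, kept as a relation because nothing bounds its ordinals yet.
    Enumerates : Dom → Dom → Set ℓ
    Enumerates β x = Σ Dom λ F → Approximation F X g × App F β x

    Enumerates-functional : Functional Enumerates
    Enumerates-functional (F , a , p) (F′ , a′ , p′) =
      approximations-agree a a′ (Step.ordinal (a p)) _ _ p p′

    Enumerates-ordinal : ∀ {β x} → Enumerates β x → Ord β
    Enumerates-ordinal (_ , a , p) = Step.ordinal (a p)

    Enumerates-below : ∀ {β γ x} → Enumerates β x → γ ∈⁺ β → Σ Dom (Enumerates γ)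
    Enumerates-below (F , a , p) γ∈ = let y , q = Step.below (a p) γ∈ in y , F , a , q

    Enumerates-rest : ∀ {β x} → Enumerates β x → Σ Dom λ D → Cl D × App g D x ×
      (∀ z → z ∈⁺ D ⟷ (z ∈⁺ X × (∀ γ → γ ∈⁺ β → ¬ Enumerates γ z)))
    Enumerates-rest (F , a , p) = rest , proj₁ isRest , chosen , λ z →
        (λ z∈ → let z∈X , z∉ = proj₁ (proj₂ isRest z) z∈ in
          z∈X , λ γ γ∈ e → let y , q = below γ∈ in
            z∉ γ γ∈ (subst (App F γ) (Enumerates-functional (F , a , q) e) q))
      , (λ (z∈X , z∉) → proj₂ (proj₂ isRest z) (z∈X , λ γ γ∈ q → z∉ γ γ∈ (F , a , q)))
      where open Step (a p)

    Enumerates-new : ∀ {β x} → Enumerates β x → x ∈⁺ X × (∀ γ → γ ∈⁺ β → ¬ Enumerates γ x)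
    Enumerates-new e = let D , _ , c , r = Enumerates-rest e in proj₁ (r _) (C.chosen∈ c)

    -- Of two ordinals with the same value, the later one chose it from a rest that excludes all
    -- earlier values.
    Enumerates-injective : Functional (λ x β → Enumerates β x)
    Enumerates-injective e e′ =
      [ (λ β∈ → absurd (proj₂ (Enumerates-new e′) _ β∈ e))
      , [ id , (λ γ∈ → absurd (proj₂ (Enumerates-new e) _ γ∈ e′)) ]′ ]′
      (Ord-compare (Enumerates-ordinal e) (Enumerates-ordinal e′))

    Enumerates-true : (β x i j : Fin n) (ρ : Vec Dom n) → lookup ρ i ≡ X → lookup ρ j ≡ g →
      T (enumerates β x i j) ρ ⟷ Enumerates (lookup ρ β) (lookup ρ x)
    Enumerates-true β x i j ρ refl refl = Σ-cong λ F →
      ×-cong (approximation-true 0F (↑ i) (↑ j) (F ∷ ρ)) (app-true (↑ β) (↑ x) 0F (F ∷ ρ))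

    opaque
      -- By injectivity the enumeration can be read backwards as a functional relation on X, so
      -- replacement collects its ordinals into a set. This is what bounds the recursion.
      enumeratedOrdinals : Σ Dom λ δ → δ Comprises λ β → Σ Dom λ x → Enumerates β x × x ∈⁺ X
      enumeratedOrdinals = image (enumerates 1F 0F 2F 3F) (X ∷ g ∷ []) (λ x β → Enumerates β x)
        (λ x β → Enumerates-true 1F 0F 2F 3F (x ∷ β ∷ X ∷ g ∷ []) refl refl) Enumerates-injective clX

    -- The clause for b adds one further value. It serves to extend the enumeration past its last
    -- ordinal and thereby to refute that anything in X is left over.
    enumerationWith : ∀ {A} → Cl A → ∀ b y → (∀ {x} → ¬ Enumerates b x) →
      Σ Dom λ f → Graph f λ β x → β ∈⁺ A × (Enumerates β x ⊎ (β ≡ b × x ≡ y))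
    enumerationWith clA b y new =
      graph (enumerates 0F 1F 4F 5F ∨̇ 0F ≐ 2F ∧̇ 1F ≐ 3F) (b ∷ y ∷ X ∷ g ∷ [])
        (λ β x → Enumerates β x ⊎ (β ≡ b × x ≡ y))
        (λ β x′ → ⊎-cong (Enumerates-true 0F 1F 4F 5F (β ∷ x′ ∷ b ∷ y ∷ X ∷ g ∷ []) refl refl) (id , id))
        (λ { (inj₁ e) (inj₁ e′) → Enumerates-functional e e′
           ; (inj₁ e) (inj₂ (refl , refl)) → absurd (new e)
           ; (inj₂ (refl , refl)) (inj₁ e) → absurd (new e)
           ; (inj₂ (_ , refl)) (inj₂ (_ , refl)) → refl }) clA

    private
      δ = proj₁ enumeratedOrdinals
      c = proj₂ enumeratedOrdinals

      δ-into : ∀ {β x} → Enumerates β x → β ∈⁺ δ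
      δ-into e = into c (_ , e , proj₁ (Enumerates-new e))

    δ-Ord : Ord δ
    δ-Ord = Ord-of-ordinals (classical c) (λ β∈ → Enumerates-ordinal (proj₁ (proj₂ (out c β∈))))
      λ β∈ γ∈ → δ-into (proj₂ (Enumerates-below (proj₁ (proj₂ (out c β∈))) γ∈))

    private
      δ-new : ∀ {x} → ¬ Enumerates δ x
      δ-new e = Ord-∉-self δ-Ord (δ-into e)

    private
      unenumerated : Σ Dom λ D → D Comprises λ z → z ∈⁺ X × (∀ γ → ¬ Enumerates γ z)
      unenumerated =
        let D , d = sep (all (¬̇ enumerates 0F 1F 2F 3F)) (X ∷ g ∷ []) clX
            e = λ γ z → Enumerates-true 0F 1F 2F 3F (γ ∷ z ∷ X ∷ g ∷ []) refl refl
        in D , record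
          { classical = classical d
          ; out  = λ {z} z∈ → proj₁ (out d z∈) , λ γ n → proj₂ (out d z∈) γ (proj₂ (e γ z) n)
          ; into = λ {z} (z∈ , n) → into d (z∈ , λ γ t → n γ (proj₁ (e γ z) t)) }

      successor : Σ Dom λ δ⁺ → δ⁺ Comprises λ β → β ∈⁺ δ ⊎ β ∈⁺ proj₁ (singleton δ)
      successor = binaryUnionCl (classical c) (classical (sing-comprises (proj₂ (singleton δ))))

      -- If g has a value on what is left of X, the enumeration extends to δ itself,
      -- which is the set of all ordinals it is defined on.
      module _ {D x} (cD : D Comprises λ z → z ∈⁺ X × (∀ γ → ¬ Enumerates γ z)) (p : App g D x)
               {H} (γ⁺ : Graph H λ β y → β ∈⁺ proj₁ successor × (Enumerates β y ⊎ (β ≡ δ × y ≡ x)))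
        where
        keep : ∀ {β y} → Enumerates β y → App H β y
        keep e = appInto γ⁺ (into (proj₂ successor) (inj₁ (δ-into e)) , inj₁ e)

        old : ∀ {β y} → β ∈⁺ δ → App H β y → Enumerates β y
        old β∈ q = [ id , (λ (e , _) → absurd (Ord-∉-self δ-Ord (subst (_∈⁺ δ) e β∈))) ]′
          (proj₂ (appOut γ⁺ q))

        oldStep : ∀ {β y} → Enumerates β y →
                  (Σ Dom λ D → Cl D × App g D y ×
                    (∀ z → z ∈⁺ D ⟷ (z ∈⁺ X × (∀ γ → γ ∈⁺ β → ¬ Enumerates γ z)))) →
                  Step H X g β y
        oldStep e (D , cl , p , r) = record
          { ordinal = Enumerates-ordinal e
          ; below   = λ γ∈ → let y , e′ = Enumerates-below e γ∈ in y , keep e′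
          ; rest    = D
          ; isRest  = cl , λ w →
              (λ w∈ → proj₁ (proj₁ (r w) w∈) , λ γ γ∈ q →
                proj₂ (proj₁ (r w) w∈) γ γ∈ (old (Ord.transitive δ-Ord (δ-into e) γ∈) q))
            , (λ (w∈X , w∉) → proj₂ (r w) (w∈X , λ γ γ∈ e′ → w∉ γ γ∈ (keep e′)))
          ; chosen  = p }

        lastStep : Step H X g δ x
        lastStep = record
          { ordinal = δ-Ord
          ; below   = λ γ∈ → let y , e , _ = out c γ∈ in y , keep e
          ; rest    = D
          ; isRest  = classical cD , λ w →
              (λ w∈ → proj₁ (out cD w∈) , λ γ γ∈ q → proj₂ (out cD w∈) γ (old γ∈ q))
            , (λ (w∈X , w∉) → into cD (w∈X , λ γ e → w∉ γ (δ-into e) (keep e)))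
          ; chosen  = p }

        overrun : ⊥ {ℓ}
        overrun = δ-new {x}
          ( H
          , (λ q → [ (λ e → oldStep e (Enumerates-rest e)) , (λ { (refl , refl) → lastStep }) ]′
                   (proj₂ (appOut γ⁺ q)))
          , appInto γ⁺ ( into (proj₂ successor) (inj₂ (into (sing-comprises (proj₂ (singleton δ))) refl))
                       , inj₂ (refl , refl)))

    exhausted : ∀ {z} → z ∈⁺ X → Σ Dom λ β → Enumerates β z
    exhausted {z} z∈ = by-contradiction λ none →
      let x , p = C.choose (classical cD) (proj₁ ∘ out cD) (z , into cD (z∈ , λ γ e → none (γ , e)))
      in overrun cD p (proj₂ (enumerationWith (classical (proj₂ successor)) δ x δ-new))
      where cD = proj₂ unenumerated

    ordinal≈ : Σ Dom λ α → Ord α × α ≈ X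
    ordinal≈ = δ , δ-Ord , H , record
      { embeds = record
        { inj = graph-inj γ (λ p q → Enumerates-functional (en p) (en q))
                            (λ p q → Enumerates-injective (en p) (en q))
        ; source = proj₁ ∘ appOut γ
        ; target = λ p → proj₁ (Enumerates-new (en (appOut γ p)))
        ; total = λ β∈ → let x , e , _ = out c β∈ in x , appInto γ (β∈ , inj₁ e) }
      ; onto = λ x∈ → let β , e = exhausted x∈ in β , appInto γ (δ-into e , inj₁ e) }
      where
      -- Here the extra clause is void, as it could only apply to δ as an element of δ; its value δ
      -- is a dummy.
      s = enumerationWith (classical c) δ δ δ-new
      H = proj₁ s
      γ = proj₂ s
      en : ∀ {β x} → β ∈⁺ δ × (Enumerates β x ⊎ (β ≡ δ × x ≡ δ)) → Enumerates β x
      en (_ , inj₁ e) = e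
      en (β∈ , inj₂ (refl , _)) = absurd (Ord-∉-self δ-Ord β∈)

  -- Choice is applied to the inhabited members of the power set of X. Some of these may be
  -- non-classical, but each value still lies in the set it is chosen for.
  choiceOn : ∀ {X} → Cl X → Σ Dom (ChoiceOn X)
  choiceOn {X} clX = f , record
    { functional = IsFunction.functional function
    ; choose = λ cl s i →
        let y , a , _ = pick (into cA
              (into cP (λ x → s , λ n → Cl-∈⁻ cl λ p → Cl-∉⁻ clX (s p) n) , i))
        in y , a
    ; chosen∈ = λ {D} p → let y , a , y∈ = pick (into cD (_ , p))
                          in subst (_∈⁺ D) (IsFunction.functional function a p) y∈ }
    where
    P = axiom pow X
    cP : proj₁ P Comprises λ S → T (0F ⊆̇ 1F) (S ∷ X ∷ [])
    cP = proj₁ (trueIff⟷comprises (λ S → proj₁ , (_, tt)) (λ S → id , id)) (proj₂ P)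

    A = sep (ex (0F ∈̇ 1F)) [] (classical cP)
    cA = proj₂ A

    choices = axiom ac (proj₁ A) (classical cA , λ x x∈ → proj₂ (out cA x∈))
    f = proj₁ choices
    function = proj₂ (Function⟷true 0F (f ∷ proj₁ A ∷ [])) (proj₁ (proj₂ choices))

    cD : proj₁ A Comprises λ D → Σ Dom (App f D)
    cD = proj₁ (domain-true 1F 0F (f ∷ proj₁ A ∷ []) (IsFunction.isClassical function))
           (proj₁ (proj₂ (proj₂ choices)))

    pick : ∀ {D} → D ∈⁺ proj₁ A → Σ Dom λ y → App f D y × y ∈⁺ D
    pick {D} D∈ = let y , a , y∈ = proj₂ (proj₂ (proj₂ choices)) D D∈ in
      y , proj₁ (app-true 1F 0F 2F (y ∷ D ∷ f ∷ proj₁ A ∷ [])) a , y∈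

  -- Cardinals of classical sets

  record Card (κ X : Dom) : Set ℓ where
    field
      ordinal  : Ord κ
      biject   : κ ≈ X
      smallest : ∀ {β} → Ord β → β ≈ X → κ ∈⁺ β ⊎ κ ≡ β

  Card-Cl : ∀ {κ X} → Card κ X → Cl κ
  Card-Cl c = Ord.isClassical (Card.ordinal c)

  Card⟷true : (i j : Fin n) (ρ : Vec Dom n) → Cl (lookup ρ j) →
    Card (lookup ρ i) (lookup ρ j) ⟷ T (i isCard j) ρ
  Card⟷true i j ρ clX =
      (λ c → let open Card c in
          proj₁ (Ord⟷true i ρ) ordinal
        , proj₂ (InBijection⟷≈ i j ρ (Ord.isClassical ordinal) clX) biject
        , λ β (o , b) → let o′ = proj₂ (Ord⟷true 0F (β ∷ ρ)) o in
            smallest o′ (proj₁ (InBijection⟷≈ 0F (suc j) (β ∷ ρ) (Ord.isClassical o′) clX) b))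
    , (λ (o , b , s) → let o′ = proj₂ (Ord⟷true i ρ) o in record
        { ordinal  = o′
        ; biject   = proj₁ (InBijection⟷≈ i j ρ (Ord.isClassical o′) clX) b
        ; smallest = λ {β} oβ b →
            s β ( proj₁ (Ord⟷true 0F (β ∷ ρ)) oβ
                , proj₂ (InBijection⟷≈ 0F (suc j) (β ∷ ρ) (Ord.isClassical oβ) clX) b) })

  card : ∀ {X} → Cl X → Σ Dom λ κ → Card κ X
  card {X} clX =
    let g , ch = choiceOn clX
        α , o , b = ordinal≈ clX ch
        μ , oμ , t , least = Ord-least (InBijection 0F 1F) (X ∷ []) o (proj₂ (def o) b)
    in μ , record
      { ordinal  = oμ
      ; biject   = proj₁ (def oμ) t
      ; smallest = λ oβ b → least oβ (proj₂ (def oβ) b) }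
    where
    def : ∀ {β} → Ord β → T (InBijection 0F 1F) (β ∷ X ∷ []) ⟷ β ≈ X
    def {β} o = InBijection⟷≈ 0F 1F (β ∷ X ∷ []) (Ord.isClassical o) clX

  Card-resp-≈ : ∀ {κ X Y} → Cl X → Cl Y → X ≈ Y → Card κ X → Card κ Y
  Card-resp-≈ clX clY e c = record
    { ordinal = ordinal
    ; biject = ≈-trans (Ord.isClassical ordinal) biject e
    ; smallest = λ o b → smallest o (≈-trans (Ord.isClassical o) b (≈-sym clY e)) }
    where open Card c

  -- Orbits and matchings

  -- Reachability from e along τ, as membership in every set that contains e and is closed under τ.
  orbit : Fin n → Fin n → Fin n → Form n
  orbit τ e a = ∀̇ λ S → ↑ e ∈̇ S →̇
    (∀̇ λ x → ∀̇ λ y → ⟪ ↑ x , y ⟫∈ ↑³ τ →̇ ↑ x ∈̇ ↑² S →̇ y ∈̇ ↑² S) →̇ ↑ a ∈̇ S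

  Orbit : Dom → Dom → Dom → Set ℓ
  Orbit τ e a = ∀ S → e ∈⁺ S → (∀ x y → App τ x y → x ∈⁺ S → y ∈⁺ S) → a ∈⁺ S

  orbit-true : (τ e a : Fin n) (ρ : Vec Dom n) →
    T (orbit τ e a) ρ ⟷ Orbit (lookup ρ τ) (lookup ρ e) (lookup ρ a)
  orbit-true τ e a ρ = Π-cong λ S → →-cong (id , id) (→-cong
    (Π-cong λ x → Π-cong λ y → →-cong (app-true 1F 0F (↑³ τ) (y ∷ x ∷ S ∷ ρ)) (id , id)) (id , id))

  orbit-base : ∀ {τ e} → Orbit τ e e
  orbit-base S e∈ _ = e∈

  orbit-step : ∀ {τ e a b} → Orbit τ e a → App τ a b → Orbit τ e b
  orbit-step o p S e∈ closed = closed _ _ p (o S e∈ closed)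

  module _ {τ Ω} (clΩ : Cl Ω) (ran : ∀ {x y} → App τ x y → y ∈⁺ Ω) where
    orbit⊆ : ∀ {e a} → e ∈⁺ Ω → Orbit τ e a → a ∈⁺ Ω
    orbit⊆ e∈ o = o Ω e∈ λ _ _ p _ → ran p

    -- The elements of Ω that satisfy φ form one of the closed sets in the definition of the orbit.
    -- The bound Ω is what makes them a set.
    orbit-induction : (φ : Form (suc n)) (ρ : Vec Dom n) (P : Dom → Set ℓ) →
      (∀ x → T φ (x ∷ ρ) ⟷ P x) → ∀ {e} → e ∈⁺ Ω → P e →
      (∀ {x y} → App τ x y → P x → P y) → ∀ {a} → Orbit τ e a → P a
    orbit-induction φ ρ P def {e} e∈ pe step {a} o =
      proj₁ (def a) (proj₂ (out c (o (proj₁ S) (into c (e∈ , proj₂ (def e) pe)) λ x y p x∈ →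
        into c (ran p , proj₂ (def y) (step p (proj₁ (def x) (proj₂ (out c x∈))))))))
      where S = sep φ ρ clΩ
            c = proj₂ S

    orbit-last : ∀ {e a} → e ∈⁺ Ω → Orbit τ e a → a ≡ e ⊎ (Σ Dom λ b → Orbit τ e b × App τ b a)
    orbit-last {e} e∈ = orbit-induction
      (0F ≐ 1F ∨̇ ex (orbit 3F 2F 0F ∧̇ ⟪ 0F , 1F ⟫∈ 3F)) (e ∷ τ ∷ [])
      (λ a → a ≡ e ⊎ (Σ Dom λ b → Orbit τ e b × App τ b a))
      (λ a → ⊎-cong (id , id) (Σ-cong λ b → let ρ = b ∷ a ∷ e ∷ τ ∷ [] in
         ×-cong (orbit-true 3F 2F 0F ρ) (app-true 0F 1F 3F ρ)))
      e∈ (inj₁ refl)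
      λ { p (inj₁ refl)       → inj₂ (e , orbit-base , p)
        ; p (inj₂ (b , o , q)) → inj₂ (_ , orbit-step o q , p) }

    orbit-first : Functional (App τ) → ∀ {e a} → e ∈⁺ Ω → Orbit τ e a →
                  ∀ {b} → App τ e b → a ≡ e ⊎ Orbit τ b a
    orbit-first fun {e} e∈ o {b} q = orbit-induction
      (0F ≐ 1F ∨̇ orbit 3F 2F 0F) (e ∷ b ∷ τ ∷ []) (λ a → a ≡ e ⊎ Orbit τ b a)
      (λ a → ⊎-cong (id , id) (orbit-true 3F 2F 0F (a ∷ e ∷ b ∷ τ ∷ []))) e∈ (inj₁ refl)
      (λ { p (inj₁ refl) → inj₂ (subst (Orbit τ b) (fun q p) orbit-base)
         ; p (inj₂ o)    → inj₂ (orbit-step o p) }) o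

    -- By injectivity a common element can be traced back along both orbits in step. As neither
    -- start has a predecessor, both starts are reached at once.
    orbits-disjoint : Functional (λ y x → App τ x y) → ∀ {e e′ a} → e ∈⁺ Ω → e′ ∈⁺ Ω →
      (∀ {x} → ¬ App τ x e) → (∀ {x} → ¬ App τ x e′) → Orbit τ e a → Orbit τ e′ a → e ≡ e′
    orbits-disjoint inj {e} {e′} e∈ e′∈ first first′ = orbit-induction
      (orbit 3F 2F 0F →̇ 1F ≐ 2F) (e ∷ e′ ∷ τ ∷ []) (λ a → Orbit τ e′ a → e ≡ e′)
      (λ a → →-cong (orbit-true 3F 2F 0F (a ∷ e ∷ e′ ∷ τ ∷ [])) (id , id)) e∈
      (λ o → [ id , (λ (_ , _ , p) → absurd (first p)) ]′ (orbit-last e′∈ o))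
      (λ p ih o → [ (λ { refl → absurd (first′ p) })
                  , (λ (_ , o′ , q) → ih (subst (Orbit τ e′) (inj q p) o′)) ]′ (orbit-last e′∈ o))

    -- On the way from e to a′ the point a stays reachable: it could be lost only by a step leaving
    -- a, and there is none. So a is reachable from a′, which has no successor either.
    orbit-end-unique : Functional (App τ) → ∀ {e a a′} → e ∈⁺ Ω → Orbit τ e a → Orbit τ e a′ →
      (∀ {x} → ¬ App τ a x) → (∀ {x} → ¬ App τ a′ x) → a ≡ a′
    orbit-end-unique fun {e} {a} {a′} e∈ o o′ end end′ =
      orbit-induction (0F ≐ 1F) (a′ ∷ []) (_≡ a′) (λ _ → id , id) (orbit⊆ e∈ o′) refl
        (λ { p refl → absurd (end′ p) })
        (proj₂ (orbit-induction (0F ∈̇ 3F ∧̇ orbit 2F 0F 1F) (a ∷ τ ∷ Ω ∷ [])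
          (λ b → b ∈⁺ Ω × Orbit τ b a)
          (λ b → ×-cong (id , id) (orbit-true 2F 0F 1F (b ∷ a ∷ τ ∷ Ω ∷ []))) e∈ (e∈ , o)
          (λ p (x∈ , o) → ran p , [ (λ { refl → absurd (end p) }) , id ]′ (orbit-first fun x∈ o p)) o′))

  -- Every point that h₁ or h₂ must cover lies on an alternating path of
  -- h₁ ∪ h₂; the paths that start at a point of dom h₁ ∖ ran h₂ use h₁, all
  -- others use h₂ (Mendelsohn–Dulmage).
  module Match {L h₁ h₂} (clL : Cl L) (inj₁′ : Inj h₁) (inj₂′ : Inj h₂)
               (h₁⊆ : ∀ {a b} → App h₁ a b → a ∈⁺ L) (h₂⊆ : ∀ {a b} → App h₂ b a → a ∈⁺ L) where
    private
      fun₁ = Inj-functional inj₁′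
      inv₁ = Inj-injective inj₁′
      fun₂ = Inj-functional inj₂′
      inv₂ = Inj-injective inj₂′

    opaque
      alternate : Σ Dom λ τ → Graph τ λ a a′ → a ∈⁺ L × Σ Dom λ b → App h₁ a b × App h₂ b a′
      alternate = composite fun₁ fun₂ clL

    private
      τ = proj₁ alternate
      γ = proj₂ alternate

    Forward : Dom → Set ℓ
    Forward a = Σ Dom λ e → (Σ Dom (App h₁ e) × (∀ b → ¬ App h₂ b e)) × Orbit τ e a

    forward-next : ∀ {a b a′} → Forward a → App h₁ a b → App h₂ b a′ → Forward a′
    forward-next (e , s , o) p q = e , s , orbit-step o (appInto γ (h₁⊆ p , _ , p , q))

    -- A forward point in the range of h₂ is not a start, so a last step leads to it; injectivity of
    -- h₂ makes that step pass through b.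
    forward-last : ∀ {a b} → Forward a → App h₂ b a → Σ Dom λ a₀ → Forward a₀ × App h₁ a₀ b
    forward-last (e , ((b₀ , p₀) , s) , o) q =
      [ (λ { refl → absurd (s _ q) })
      , (λ (a₀ , o₀ , p) → let _ , _ , p₁ , p₂ = appOut γ p in
          a₀ , (e , ((b₀ , p₀) , s) , o₀) , subst (App h₁ a₀) (inv₂ p₂ q) p₁) ]′
      (orbit-last clL (λ p → let _ , _ , _ , p₂ = appOut γ p in h₂⊆ p₂) (h₁⊆ p₀) o)

    -- The second alternative says that b is not claimed by a forward h₁-edge, rather than that a is
    -- not forward. This makes injectivity immediate, and `forward-last` supplies functionality.
    Matched : Dom → Dom → Set ℓ
    Matched a b = (Forward a × App h₁ a b) ⊎ ((∀ a₀ → Forward a₀ → ¬ App h₁ a₀ b) × App h₂ b a)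

    Matched-functional : Functional Matched
    Matched-functional (inj₁ (_ , p)) (inj₁ (_ , q)) = fun₁ p q
    Matched-functional (inj₁ (s , p)) (inj₂ (n , q)) =
      let a₀ , s₀ , p₀ = forward-last s q in absurd (n a₀ s₀ p₀)
    Matched-functional (inj₂ (n , q)) (inj₁ (s , p)) =
      let a₀ , s₀ , p₀ = forward-last s q in absurd (n a₀ s₀ p₀)
    Matched-functional (inj₂ (_ , p)) (inj₂ (_ , q)) = inv₂ p q

    Matched-injective : Functional (λ b a → Matched a b)
    Matched-injective (inj₁ (_ , p)) (inj₁ (_ , q)) = inv₁ p q
    Matched-injective (inj₁ (s , p)) (inj₂ (n , _)) = absurd (n _ s p)
    Matched-injective (inj₂ (n , _)) (inj₁ (s , p)) = absurd (n _ s p)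
    Matched-injective (inj₂ (_ , p)) (inj₂ (_ , q)) = fun₂ p q

    -- If a is not forward, it is in the range of h₂, or it would be a start. The b′ sent to it is
    -- not claimed by a forward edge, since from there the path would reach a.
    covers₁ : ∀ {a b} → App h₁ a b → Σ Dom (Matched a)
    covers₁ {a} p with decide (Forward a)
    ... | inj₁ s = _ , inj₁ (s , p)
    ... | inj₂ ns with decide (Σ Dom λ b′ → App h₂ b′ a)
    ...   | inj₂ none    = absurd (ns (a , ((_ , p) , λ b q → none (b , q)) , orbit-base))
    ...   | inj₁ (b′ , q) = b′ , inj₂ ((λ a₀ s₀ p₀ → ns (forward-next s₀ p₀ q)) , q)

    covers₂ : ∀ {a b} → App h₂ b a → Σ Dom λ a₀ → Matched a₀ b
    covers₂ {a} {b} q with decide (Σ Dom λ a₀ → Forward a₀ × App h₁ a₀ b)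
    ... | inj₁ (a₀ , s , p) = a₀ , inj₁ (s , p)
    ... | inj₂ none         = a , inj₂ ((λ a₀ s p → none (a₀ , s , p)) , q)

    sound : ∀ {a b} → Matched a b → App h₁ a b ⊎ App h₂ b a
    sound (inj₁ (_ , p)) = inj₁ p
    sound (inj₂ (_ , q)) = inj₂ q

    forward : Fin n → Fin n → Fin n → Fin n → Form n
    forward a h₁ h₂ τ = ∃̇ λ e → ((∃̇ λ b → ⟪ ↑ e , b ⟫∈ ↑² h₁) ∧̇ (∀̇ λ b → ¬̇ ⟪ b , ↑ e ⟫∈ ↑² h₂))
                              ∧̇ orbit (↑ τ) e (↑ a)

    matched : Fin n → Fin n → Fin n → Fin n → Fin n → Form n
    matched a b h₁ h₂ τ =
        forward a h₁ h₂ τ ∧̇ ⟪ a , b ⟫∈ h₁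
      ∨̇ (∀̇ λ a₀ → forward a₀ (↑ h₁) (↑ h₂) (↑ τ) →̇ ¬̇ ⟪ a₀ , ↑ b ⟫∈ ↑ h₁) ∧̇ ⟪ b , a ⟫∈ h₂

    forward-true : (a i j k : Fin n) (ρ : Vec Dom n) →
      lookup ρ i ≡ h₁ → lookup ρ j ≡ h₂ → lookup ρ k ≡ τ →
      T (forward a i j k) ρ ⟷ Forward (lookup ρ a)
    forward-true a i j k ρ refl refl refl′ = Σ-cong λ e → ×-cong
      (×-cong (Σ-cong λ b → app-true 1F 0F (↑² i) (b ∷ e ∷ ρ))
              (Π-cong λ b → →-cong (app-true 0F 1F (↑² j) (b ∷ e ∷ ρ)) (id , id)))
      (subst (λ t → T (orbit (↑ k) 0F (↑ a)) (e ∷ ρ) ⟷ Orbit t e (lookup ρ a)) refl′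
        (orbit-true (↑ k) 0F (↑ a) (e ∷ ρ)))

    Matched-true : Defines (matched 0F 1F 2F 3F 4F) (h₁ ∷ h₂ ∷ τ ∷ []) Matched
    Matched-true a b = let ρ = a ∷ b ∷ h₁ ∷ h₂ ∷ τ ∷ [] in ⊎-cong
      (×-cong (forward-true 0F 2F 3F 4F ρ refl refl refl) (app-true 0F 1F 2F ρ))
      (×-cong (Π-cong λ a₀ → →-cong (forward-true 0F 3F 4F 5F (a₀ ∷ ρ) refl refl refl)
                                (→-cong (app-true 0F 2F 3F (a₀ ∷ ρ)) (id , id)))
              (app-true 1F 0F 3F ρ))

    opaque
      matching : Σ Dom λ M → Graph M λ a b → a ∈⁺ L × Matched a b
      matching = graph (matched 0F 1F 2F 3F 4F) (h₁ ∷ h₂ ∷ τ ∷ []) Matched Matched-true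
                   Matched-functional clL

  -- The matching covers the domains of both embeddings, which here are all of X and all of Y.
  cantor-bernstein : ∀ {X Y} → Cl X → X ↪ Y → Y ↪ X → X ≈ Y
  cantor-bernstein {X} {Y} clX (h , e) (k , e′) = proj₁ matching , record
    { embeds = record
      { inj = restricted-inj γ Matched-functional Matched-injective
      ; source = proj₁ ∘ appOut γ
      ; target = λ a → [ Embeds.target e , Embeds.source e′ ]′ (sound (proj₂ (appOut γ a)))
      ; total = λ x∈ → let y , m = covers₁ (proj₂ (Embeds.total e x∈)) in y , appInto γ (x∈ , m) }
    ; onto = λ y∈ → let x , m = covers₂ (proj₂ (Embeds.total e′ y∈)) in
        x , appInto γ ([ Embeds.source e , Embeds.target e′ ]′ (sound m) , m) }
    where
    open Match clX (Embeds.inj e) (Embeds.inj e′) (Embeds.source e) (Embeds.target e′)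
    γ = proj₂ matching

  -- Were μ an element of κ, then μ would embed into X and X into Y and hence into μ. By
  -- Cantor-Bernstein μ would be in bijection with X, against the minimality of κ.
  Card-⊆ : ∀ {κ μ X Y} → Cl X → Cl Y → Card κ X → Card μ Y → X ↪ Y → ∀ {x} → x ∈⁺ κ → x ∈⁺ μ
  Card-⊆ {κ} {μ} {X} clX clY c c′ e =
    [ (λ κ∈μ → Ord.transitive (Card.ordinal c′) κ∈μ)
    , [ (λ { refl → id }) , (λ μ∈κ → absurd (smaller μ∈κ)) ]′ ]′
    (Ord-compare (Card.ordinal c) (Card.ordinal c′))
    where
    clκ = Card-Cl c
    clμ = Card-Cl c′
    smaller : ¬ μ ∈⁺ κ
    smaller μ∈κ = Ord-∉-self (Card.ordinal c)
      ([ (λ κ∈μ → Ord.transitive (Card.ordinal c) μ∈κ κ∈μ) , (λ κ≡μ → subst (_∈⁺ κ) (sym κ≡μ) μ∈κ) ]′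
       (Card.smallest c (Card.ordinal c′) (cantor-bernstein clμ
         (↪-trans clμ (⊆⇒↪ clμ (Ord.transitive (Card.ordinal c) μ∈κ)) (≈⇒↪ (Card.biject c)))
         (↪-trans clX e (≈⇒↪ (≈-sym clY (Card.biject c′)))))))

  Card-↪ : ∀ {κ μ X Y} → Cl X → Card κ X → Card μ Y → (∀ {x} → x ∈⁺ κ → x ∈⁺ μ) → X ↪ Y
  Card-↪ clX c c′ ⊆ =
    ↪-trans clX (≈⇒↪ (≈-sym clX (Card.biject c)))
      (↪-trans clκ (⊆⇒↪ clκ ⊆) (≈⇒↪ (Card.biject c′)))
    where clκ = Card-Cl c

  -- To make h map P into N, follow h x ↦ j x (x ∈ P) from the points of W ∖ N:
  -- along these paths P is remapped by j, and the point of S ∖ P that h sends to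
  -- the end of a path is sent to its start instead.
  module Reroute {S W P N h j} (clS : Cl S) (clW : Cl W)
                 (N⊆W : ∀ {x} → x ∈⁺ N → x ∈⁺ W)
                 (eh : Embeds h S W) (ej : Embeds j P N) where
    private
      module H = Embeds eh
      module J = Embeds ej

    opaque
      pathGraph : Σ Dom λ τ → Graph τ λ n m → n ∈⁺ W × Σ Dom λ x → App h x n × App j x m
      pathGraph = graph (ex (⟪ 0F , 1F ⟫∈ 3F ∧̇ ⟪ 0F , 2F ⟫∈ 4F)) (h ∷ j ∷ [])
        (λ n m → Σ Dom λ x → App h x n × App j x m)
        (λ n m → Σ-cong λ x → let ρ = x ∷ n ∷ m ∷ h ∷ j ∷ [] in
           ×-cong (app-true 0F 1F 3F ρ) (app-true 0F 2F 4F ρ))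
        (λ {n} {m} {m′} (x , p , q) (x′ , p′ , q′) →
           J.functional q (subst (λ x → App j x m′) (H.injective p′ p) q′)) clW

    private
      τ = proj₁ pathGraph
      γ = proj₂ pathGraph

    step : ∀ {x n m} → App h x n → App j x m → App τ n m
    step p q = appInto γ (H.target p , _ , p , q)

    τ-range : ∀ {n m} → App τ n m → m ∈⁺ N
    τ-range a = let _ , _ , _ , q = appOut γ a in J.target q

    τ-functional : Functional (App τ)
    τ-functional {z = m′} a b = let _ , x , p , q = appOut γ a
                                    _ , x′ , p′ , q′ = appOut γ b in
      J.functional q (subst (λ x → App j x m′) (H.injective p′ p) q′)

    τ-injective : Functional (λ m n → App τ n m)
    τ-injective {z = n′} a b = let _ , x , p , q = appOut γ a
                                   _ , x′ , p′ , q′ = appOut γ b in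
      H.functional p (subst (λ x → App h x n′) (J.injective q′ q) p′)

    Root : Dom → Dom → Set ℓ
    Root t n = t ∈⁺ W × (¬ t ∈⁺ N) × Orbit τ t n

    root-self : ∀ {t} → t ∈⁺ W → ¬ t ∈⁺ N → Root t t
    root-self w n = w , n , orbit-base

    -- Roots lie outside N while every step ends in N, so roots have no predecessors and their
    -- orbits are disjoint.
    root-unique : ∀ {n t t′} → Root t n → Root t′ n → t ≡ t′
    root-unique (w , n , o) (w′ , n′ , o′) =
      orbits-disjoint clW (N⊆W ∘ τ-range) τ-injective w w′ (n ∘ τ-range) (n′ ∘ τ-range) o o′

    -- A step out of n applies j to the only point that h sends to n. That point is x, and j is
    -- defined on P alone.
    end : ∀ {x n m} → ¬ x ∈⁺ P → App h x n → ¬ App τ n m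
    end x∉ p a = let _ , x′ , p′ , q = appOut γ a in x∉ (subst (_∈⁺ P) (H.injective p′ p) (J.source q))

    root-injective : ∀ {x x′ n n′ t} → ¬ x ∈⁺ P → ¬ x′ ∈⁺ P → App h x n → App h x′ n′ →
                     Root t n → Root t n′ → x ≡ x′
    root-injective {x′ = x′} x∉ x′∉ p p′ (w , _ , o) (_ , _ , o′) =
      H.injective p (subst (App h x′)
        (orbit-end-unique clW (N⊆W ∘ τ-range) τ-functional w o′ o (end x′∉ p′) (end x∉ p)) p′)

    data Way : Set where
      keep jump back : Way

    Rerouted : Way → Dom → Dom → Set ℓ
    Rerouted keep x z = App h x z × (∀ t → ¬ Root t z)
    Rerouted jump x z = App j x z × Σ Dom λ n → App h x n × Σ Dom λ t → Root t n
    Rerouted back x z = (¬ x ∈⁺ P) × Σ Dom λ n → App h x n × Root z n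

    R : Dom → Dom → Set ℓ
    R x z = Rerouted keep x z ⊎ Rerouted jump x z ⊎ Rerouted back x z

    keep-jump : ∀ {x z z′} → Rerouted keep x z → ¬ Rerouted jump x z′
    keep-jump (p , nr) (_ , _ , p′ , t , r) = nr t (subst (Root t) (H.functional p′ p) r)

    keep-back : ∀ {x z z′} → Rerouted keep x z → ¬ Rerouted back x z′
    keep-back (p , nr) (_ , _ , p′ , r) = nr _ (subst (Root _) (H.functional p′ p) r)

    jump-back : ∀ {x z z′} → Rerouted jump x z → ¬ Rerouted back x z′
    jump-back (p , _) (x∉ , _) = x∉ (J.source p)

    R-functional : Functional R
    R-functional (inj₁ (p , _)) (inj₁ (q , _)) = H.functional p q
    R-functional (inj₁ p) (inj₂ (inj₁ q)) = absurd (keep-jump p q)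
    R-functional (inj₁ p) (inj₂ (inj₂ q)) = absurd (keep-back p q)
    R-functional (inj₂ (inj₁ p)) (inj₁ q) = absurd (keep-jump q p)
    R-functional (inj₂ (inj₁ (p , _))) (inj₂ (inj₁ (q , _))) = J.functional p q
    R-functional (inj₂ (inj₁ p)) (inj₂ (inj₂ q)) = absurd (jump-back p q)
    R-functional (inj₂ (inj₂ p)) (inj₁ q) = absurd (keep-back q p)
    R-functional (inj₂ (inj₂ p)) (inj₂ (inj₁ q)) = absurd (jump-back q p)
    R-functional (inj₂ (inj₂ (_ , n , p , r))) (inj₂ (inj₂ (_ , n′ , p′ , r′))) =
      root-unique r (subst (Root _) (H.functional p′ p) r′)

    -- The three ways have disjoint values: `keep` takes values without a root, `jump` takes rooted
    -- values in N, and `back` takes roots, which lie outside N and are rooted in themselves.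
    keep-jump′ : ∀ {x x′ z} → Rerouted keep x z → ¬ Rerouted jump x′ z
    keep-jump′ (_ , nr) (q , _ , p′ , t , w , n , o) = nr t (w , n , orbit-step o (step p′ q))

    keep-back′ : ∀ {x x′ z} → Rerouted keep x z → ¬ Rerouted back x′ z
    keep-back′ (_ , nr) (_ , _ , _ , w , n , _) = nr _ (root-self w n)

    jump-back′ : ∀ {x x′ z} → Rerouted jump x z → ¬ Rerouted back x′ z
    jump-back′ (p , _) (_ , _ , _ , _ , n , _) = n (J.target p)

    R-injective : Functional (λ z x → R x z)
    R-injective (inj₁ (p , _)) (inj₁ (q , _)) = H.injective p q
    R-injective (inj₁ p) (inj₂ (inj₁ q)) = absurd (keep-jump′ p q)
    R-injective (inj₁ p) (inj₂ (inj₂ q)) = absurd (keep-back′ p q)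
    R-injective (inj₂ (inj₁ p)) (inj₁ q) = absurd (keep-jump′ q p)
    R-injective (inj₂ (inj₁ (p , _))) (inj₂ (inj₁ (q , _))) = J.injective p q
    R-injective (inj₂ (inj₁ p)) (inj₂ (inj₂ q)) = absurd (jump-back′ p q)
    R-injective (inj₂ (inj₂ p)) (inj₁ q) = absurd (keep-back′ q p)
    R-injective (inj₂ (inj₂ p)) (inj₂ (inj₁ q)) = absurd (jump-back′ q p)
    R-injective (inj₂ (inj₂ (x∉ , n , p , r))) (inj₂ (inj₂ (x′∉ , n′ , p′ , r′))) =
      root-injective x∉ x′∉ p p′ r r′

    R-total : ∀ {x} → x ∈⁺ S → Σ Dom (R x)
    R-total {x} x∈ with H.total x∈
    ... | n , p with decide (Σ Dom λ t → Root t n)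
    ...   | inj₂ none = n , inj₁ (p , λ t r → none (t , r))
    ...   | inj₁ (t , r) with decide (x ∈⁺ P)
    ...     | inj₁ x∈P = let z , q = J.total x∈P in z , inj₂ (inj₁ (q , n , p , t , r))
    ...     | inj₂ x∉P = t , inj₂ (inj₂ (x∉P , n , p , r))

    R-target : ∀ {x z} → R x z → z ∈⁺ W
    R-target (inj₁ (p , _)) = H.target p
    R-target (inj₂ (inj₁ (q , _))) = N⊆W (J.target q)
    R-target (inj₂ (inj₂ (_ , _ , _ , w , _))) = w

    R-PN : ∀ {x z} → x ∈⁺ P → R x z → z ∈⁺ N
    R-PN x∈ (inj₁ (p , nr)) = by-contradiction λ z∉ → nr _ (root-self (H.target p) z∉)
    R-PN x∈ (inj₂ (inj₁ (q , _))) = J.target q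
    R-PN x∈ (inj₂ (inj₂ (x∉ , _))) = absurd (x∉ x∈)

    root : Fin n → Fin n → Fin n → Fin n → Fin n → Form n
    root t m W N τ = t ∈̇ W ∧̇ ¬̇ (t ∈̇ N) ∧̇ orbit τ t m

    rerouted : Form 8
    rerouted =
        ⟪ 0F , 1F ⟫∈ 2F ∧̇ (∀̇ λ t → ¬̇ root t 2F 7F 6F 8F)
      ∨̇ ⟪ 0F , 1F ⟫∈ 3F ∧̇ (∃̇ λ m → ⟪ 1F , m ⟫∈ 3F ∧̇ (∃̇ λ t → root t 1F 8F 7F 9F))
      ∨̇ ¬̇ (0F ∈̇ 4F) ∧̇ (∃̇ λ m → ⟪ 1F , m ⟫∈ 3F ∧̇ root 2F m 7F 6F 8F)

    root-true : (t m i j k : Fin n) (ρ : Vec Dom n) →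
      lookup ρ i ≡ W → lookup ρ j ≡ N → lookup ρ k ≡ τ →
      T (root t m i j k) ρ ⟷ Root (lookup ρ t) (lookup ρ m)
    root-true t m i j k ρ refl refl τ≡ = ×-cong (id , id) (×-cong (id , id)
      (subst (λ τ → T (orbit k t m) ρ ⟷ Orbit τ (lookup ρ t) (lookup ρ m)) τ≡ (orbit-true k t m ρ)))

    R-true : Defines rerouted (h ∷ j ∷ P ∷ N ∷ W ∷ τ ∷ []) R
    R-true x z = let ρ = x ∷ z ∷ h ∷ j ∷ P ∷ N ∷ W ∷ τ ∷ [] in
      ⊎-cong (×-cong (app-true 0F 1F 2F ρ)
               (Π-cong λ t → →-cong (root-true 0F 2F 7F 6F 8F (t ∷ ρ) refl refl refl) (id , id)))
      (⊎-cong (×-cong (app-true 0F 1F 3F ρ)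
                (Σ-cong λ m → ×-cong (app-true 1F 0F 3F (m ∷ ρ))
                  (Σ-cong λ t → root-true 0F 1F 8F 7F 9F (t ∷ m ∷ ρ) refl refl refl)))
              (×-cong (id , id)
                (Σ-cong λ m → ×-cong (app-true 1F 0F 3F (m ∷ ρ))
                  (root-true 2F 0F 7F 6F 8F (m ∷ ρ) refl refl refl))))

    opaque
      rerouting : Σ Dom λ k → Graph k λ x z → x ∈⁺ S × R x z
      rerouting = graph rerouted (h ∷ j ∷ P ∷ N ∷ W ∷ τ ∷ []) R R-true R-functional clS

    reroute : Σ Dom λ k → Embeds k S W × (∀ {x z} → x ∈⁺ P → App k x z → z ∈⁺ N)
    reroute = proj₁ rerouting , record
        { inj = restricted-inj δ R-functional R-injective
        ; source = proj₁ ∘ appOut δ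
        ; target = R-target ∘ proj₂ ∘ appOut δ
        ; total = λ x∈ → let z , r = R-total x∈ in z , appInto δ (x∈ , r) }
      , λ x∈ a → R-PN x∈ (proj₂ (appOut δ a))
      where δ = proj₂ rerouting

  -- Parts of a set and cardinal numbers

  isPart : Part → Fin n → Fin n → Form n
  isPart truth    = _isTruePart_
  isPart nonFalse = _isNonFalsePart_
  isPart glut     = _isBPart_
  isPart tpart    = _isTPart_
  isPart gap      = _isNPart_
  isPart realm    = _isRealm_

  In : Part → Dom → Dom → Set ℓ
  In truth    A x = x ∈⁺ A
  In nonFalse A x = ¬ x ∈⁻ A
  In glut     A x = x ∈⁺ A × x ∈⁻ A
  In tpart    A x = x ∈⁺ A × (¬ x ∈⁻ A)
  In gap      A x = (¬ x ∈⁻ A) × (¬ x ∈⁺ A)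
  In realm    A x = x ∈⁺ A ⊎ (¬ x ∈⁻ A)

  In-realm : ∀ p {A x} → In p A x → In realm A x
  In-realm truth    t       = inj₁ t
  In-realm nonFalse n       = inj₂ n
  In-realm glut     (t , _) = inj₁ t
  In-realm tpart    (t , _) = inj₁ t
  In-realm gap      (n , _) = inj₂ n
  In-realm realm    r       = r

  In-cong : ∀ p {A B x y} → x ∈⁺ A ⟷ y ∈⁺ B → x ∈⁻ A ⟷ y ∈⁻ B → In p A x ⟷ In p B y
  In-cong p e⁺ e⁻ = go p
    where
    ¬-cong = →-cong {Q = ⊥} e⁻ (id , id)
    go : ∀ p → In p _ _ ⟷ In p _ _
    go truth    = e⁺
    go nonFalse = ¬-cong
    go glut     = ×-cong e⁺ e⁻
    go tpart    = ×-cong e⁺ ¬-cong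
    go gap      = ×-cong ¬-cong (→-cong e⁺ (id , id))
    go realm    = ⊎-cong e⁺ ¬-cong

  part-true : ∀ p (i j : Fin n) (ρ : Vec Dom n) →
    T (isPart p i j) ρ ⟷ lookup ρ i Comprises In p (lookup ρ j)
  part-true truth i j ρ = trueIff⟷comprises
    (λ x → proj₁ , (_, tt)) (λ x → id , id)
  part-true nonFalse i j ρ = trueIff⟷comprises
    (λ x → id , id) (λ x → (λ (f , _) n → n f) , (λ nn → by-contradiction nn , tt))
  part-true glut i j ρ = trueIff⟷comprises
    (λ x → (λ ((t , _) , f , _) → t , f) , (λ (t , f) → (t , tt) , f , tt))
    (λ x → (λ { (inj₁ nt) (t , _) → nt t ; (inj₂ nf) (_ , f) → nf f })
         , (λ n → [ (λ t → inj₂ λ f → n (t , f)) , inj₁ ]′ (decide _)))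
  part-true tpart i j ρ = trueIff⟷comprises
    (λ x → (λ ((t , _) , nf) → t , nf) , (λ (t , nf) → (t , tt) , nf))
    (λ x → (λ { (inj₁ nt) (t , _) → nt t ; (inj₂ (f , _)) (_ , nf) → nf f })
         , (λ n → [ (λ t → inj₂ (by-contradiction (λ nf → n (t , nf)) , tt)) , inj₁ ]′ (decide _)))
  part-true gap i j ρ = trueIff⟷comprises
    (λ x → id , id)
    (λ x → (λ { (inj₁ (f , _)) (nf , _) → nf f ; (inj₂ (t , _)) (_ , nt) → nt t })
         , (λ n → [ (λ f → inj₁ (f , tt))
                  , (λ nf → inj₂ (by-contradiction (λ nt → n (nf , nt)) , tt)) ]′ (decide _)))
  part-true realm i j ρ = trueIff⟷comprises
    (λ x → (λ { (inj₁ (t , _)) → inj₁ t ; (inj₂ nf) → inj₂ nf })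
         , (λ { (inj₁ t) → inj₁ (t , tt) ; (inj₂ nf) → inj₂ nf }))
    (λ x → (λ (nt , f , _) → [ nt , (λ nf → nf f) ]′)
         , (λ n → n ∘ inj₁ , by-contradiction (n ∘ inj₂) , tt))

  inPart : Part → Form 2
  inPart truth    = 0F ∈̇ 1F
  inPart nonFalse = ⁇ (0F ∈̇ 1F)
  inPart glut     = 0F ∈̇ 1F ∧̇ ∼ (0F ∈̇ 1F)
  inPart tpart    = 0F ∈̇ 1F ∧̇ ⁇ (0F ∈̇ 1F)
  inPart gap      = ⁇ (0F ∈̇ 1F) ∧̇ ¬̇ (0F ∈̇ 1F)
  inPart realm    = 0F ∈̇ 1F ∨̇ ⁇ (0F ∈̇ 1F)

  inPart-true : ∀ p {A x} → T (inPart p) (x ∷ A ∷ []) ⟷ In p A x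
  inPart-true truth    = id , id
  inPart-true nonFalse = id , id
  inPart-true glut     = id , id
  inPart-true tpart    = id , id
  inPart-true gap      = id , id
  inPart-true realm    = id , id

  opaque
    partSet : ∀ p A → Σ Dom λ S → S Comprises In p A
    partSet p A =
      let C , clC , A⊆C = axiom clSup A
          S , c = sep (inPart p) (A ∷ []) clC
      in S , record
        { classical = classical c
        ; out  = λ x∈ → proj₁ (inPart-true p) (proj₂ (out c x∈))
        ; into = λ i → into c
            -- A non-false element of A lies in C because `⊆̇` carries falsity from C back to A.
            ( [ proj₁ (A⊆C _) , (λ nf → by-contradiction λ n → nf (proj₂ (A⊆C _) (Cl-∈⁻ clC n))) ]′
              (In-realm p i)
            , proj₂ (inPart-true p) i) }

  part : Part → Dom → Dom
  part p A = proj₁ (partSet p A)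

  part-comprises : ∀ p A → part p A Comprises In p A
  part-comprises p A = proj₂ (partSet p A)

  part-Cl : ∀ p A → Cl (part p A)
  part-Cl p A = classical (part-comprises p A)

  -- A witness of A^! ⊈ A^? is true in A^! and false in A^?, so its membership in A is both true and
  -- false. The other half of ACLA likewise yields a membership that is neither.
  glut-exists : Σ Dom λ A → Σ Dom λ x → x ∈⁺ A × x ∈⁻ A
  glut-exists = let A , S , s , T , t , x , d = proj₁ (axiom aclas)
                    x∈S , x∉T = [ id , (λ (p , q) → q , p) ]′ d
                in A , x , proj₁ (proj₁ (proj₁ (s x)) x∈S) , proj₁ (proj₁ (proj₂ (t x)) x∉T)

  gap-exists : Σ Dom λ A → Σ Dom λ x → (¬ x ∈⁺ A) × (¬ x ∈⁻ A)
  gap-exists = let A , S , s , T , t , x , d = proj₂ (axiom aclas)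
                   x∈T , x∉S = [ id , (λ (p , q) → q , p) ]′ d
               in A , x , proj₁ (proj₂ (s x)) x∉S , proj₁ (proj₁ (t x)) x∈T

  -- The set is cut out of X ∪ Y by (x ∈ X ∧ x ∈ Y) ∨ (x ∈ X ∧ β) ∨ (x ∈ Y ∧ ν),
  -- where β is both true and false, and ν is neither.
  ⟨_∣_⟩ : ∀ {X Y} → Cl X → Cl Y → Σ Dom λ W → TrueIff W (_∈⁺ X) (λ x → ¬ x ∈⁺ Y)
  ⟨_∣_⟩ {X} {Y} clX clY =
    let U , u = binaryUnionCl clX clY
        B , b , β⁺ , β⁻ = glut-exists
        N , v , ν≠⁺ , ν≠⁻ = gap-exists
        W , e = comprehend
          (0F ∈̇ 1F ∧̇ 0F ∈̇ 2F ∨̇ 0F ∈̇ 1F ∧̇ 3F ∈̇ 4F ∨̇ 0F ∈̇ 2F ∧̇ 5F ∈̇ 6F)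
          (X ∷ Y ∷ b ∷ B ∷ v ∷ N ∷ []) U
    in W , λ x →
        ( (λ x∈ → [ proj₁ , [ proj₁ , (λ (_ , t) → absurd (ν≠⁺ t)) ]′ ]′ (proj₂ (proj₁ (proj₁ (e x)) x∈)))
        , (λ x∈ → proj₂ (proj₁ (e x)) (into u (inj₁ x∈) , inj₂ (inj₁ (x∈ , β⁺)))))
      , ( (λ x∉ x∈Y → [ Cl-∉⁻ (classical u) (into u (inj₂ x∈Y))
                      , (λ (_ , _ , n) → [ Cl-∉⁻ clY x∈Y , ν≠⁻ ]′ n) ]′ (proj₁ (proj₂ (e x)) x∉))
        , (λ x∉Y → proj₂ (proj₂ (e x)) (inj₂ (inj₂ (Cl-∈⁻ clY x∉Y) , inj₂ β⁻ , inj₁ (Cl-∈⁻ clY x∉Y)))))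

  -- The components of a cardinal number.

  record Component (p q : Part) (W A : Dom) : Set ℓ where
    field
      κ μ  : Dom
      cardκ : Card κ (part p A)
      cardμ : Card μ (part q A)
      extent : TrueIff W (_∈⁺ κ) (λ x → ¬ x ∈⁺ μ)

  component : Part → Part → Fin n → Fin n → Form n
  component p q W A = ∃̇ λ S → isPart p S (↑ A) & ∃̇ λ T → isPart q T (↑² A) &
    ↑² W isCardPair ↑ S , T

  module _ (p q : Part) where
    halves-true : (i j k : Fin n) (ρ : Vec Dom n) → Cl (lookup ρ j) → Cl (lookup ρ k) →
      T (i is⟨ j ∣ k ⟩) ρ ⟷ TrueIff (lookup ρ i) (_∈⁺ lookup ρ j) (λ x → ¬ x ∈⁺ lookup ρ k)
    halves-true i j k ρ clκ clμ =
        (λ (t , f) → let c = proj₁ (part-true truth j i ρ) t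
                         d = proj₁ (part-true nonFalse k i ρ) f in
          λ x → (into c , out c)
              , ((λ x∉ x∈ → out d x∈ x∉) , λ x∉ → by-contradiction λ nx → x∉ (into d nx)))
      , (λ e → proj₂ (part-true truth j i ρ) (record
                 { classical = clκ ; out = proj₂ (proj₁ (e _)) ; into = proj₁ (proj₁ (e _)) })
             , proj₂ (part-true nonFalse k i ρ) (record
                 { classical = clμ
                 ; out  = λ x∈ x∉ → proj₁ (proj₂ (e _)) x∉ x∈
                 ; into = λ nx → by-contradiction λ x∉ → nx (proj₂ (proj₂ (e _)) x∉) }))

    module _ (i j : Fin n) (ρ : Vec Dom n) where
      private
        W = lookup ρ i
        A = lookup ρ j

      Component⟷true : Component p q W A ⟷ T (component p q i j) ρ
      Component⟷true = to , from
        where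
        to : Component p q W A → T (component p q i j) ρ
        to c =
            S , proj₂ (part-true p 0F (suc j) (S ∷ ρ)) (part-comprises p A)
          , S′ , proj₂ (part-true q 0F (suc (suc j)) (S′ ∷ S ∷ ρ)) (part-comprises q A)
          , κ , proj₁ (Card⟷true 0F 2F (κ ∷ S′ ∷ S ∷ ρ) (part-Cl p A)) cardκ
          , μ , proj₁ (Card⟷true 0F 2F (μ ∷ κ ∷ S′ ∷ S ∷ ρ) (part-Cl q A)) cardμ
          , proj₂ (halves-true (suc (↑³ i)) 1F 0F (μ ∷ κ ∷ S′ ∷ S ∷ ρ)
                     (Card-Cl cardκ) (Card-Cl cardμ)) extent
          where open Component c
                S = part p A
                S′ = part q A

        from : T (component p q i j) ρ → Component p q W A
        from (S , s , S′ , s′ , κ , k , μ , l , h) = record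
          { κ = κ ; μ = μ
          ; cardκ = subst (Card κ) (comprises-unique cS (part-comprises p A)) ck
          ; cardμ = subst (Card μ) (comprises-unique cS′ (part-comprises q A)) cl
          ; extent = proj₁ (halves-true (suc (↑³ i)) 1F 0F (μ ∷ κ ∷ S′ ∷ S ∷ ρ)
                       (Card-Cl ck) (Card-Cl cl)) h }
          where cS  = proj₁ (part-true p 0F (suc j) (S ∷ ρ)) s
                cS′ = proj₁ (part-true q 0F (suc (suc j)) (S′ ∷ S ∷ ρ)) s′
                ck = proj₂ (Card⟷true 0F 2F (κ ∷ S′ ∷ S ∷ ρ) (classical cS)) k
                cl = proj₂ (Card⟷true 0F 2F (μ ∷ κ ∷ S′ ∷ S ∷ ρ) (classical cS′)) l

    component-exists : ∀ A → Σ Dom λ W → Component p q W A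
    component-exists A =
      let κ , k = card (part-Cl p A)
          μ , l = card (part-Cl q A)
          W , e = ⟨ Card-Cl k ∣ Card-Cl l ⟩
      in W , record { κ = κ ; μ = μ ; cardκ = k ; cardμ = l ; extent = e }

    component-resp : ∀ {W A B} → part p A ≈ part p B → part q A ≈ part q B →
                     Component p q W A → Component p q W B
    component-resp {A = A} {B} e e′ c = record
      { κ = κ ; μ = μ
      ; cardκ = Card-resp-≈ (part-Cl p A) (part-Cl p B) e cardκ
      ; cardμ = Card-resp-≈ (part-Cl q A) (part-Cl q B) e′ cardμ
      ; extent = extent }
      where open Component c

    module _ {W A B} (c : Component p q W A) (d : Component p q W B) where
      private
        module C = Component c
        module D = Component d

      κ-unique : C.κ ≡ D.κ
      κ-unique = comprises-≡ (Card-Cl C.cardκ) (Card-Cl D.cardκ)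
        λ x → proj₁ (proj₁ (D.extent x)) ∘ proj₂ (proj₁ (C.extent x))
            , proj₁ (proj₁ (C.extent x)) ∘ proj₂ (proj₁ (D.extent x))

      μ-unique : C.μ ≡ D.μ
      μ-unique = comprises-≡ (Card-Cl C.cardμ) (Card-Cl D.cardμ)
        λ x → (λ x∈ → by-contradiction λ n → proj₁ (proj₂ (C.extent x)) (proj₂ (proj₂ (D.extent x)) n) x∈)
            , (λ x∈ → by-contradiction λ n → proj₁ (proj₂ (D.extent x)) (proj₂ (proj₂ (C.extent x)) n) x∈)

      component-≈ : part p A ≈ part p B × part q A ≈ part q B
      component-≈ =
          ≈-trans (part-Cl p A) (≈-sym (part-Cl p A) (Card.biject C.cardκ))
            (Card.biject (subst (λ κ → Card κ (part p B)) (sym κ-unique) D.cardκ))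
        , ≈-trans (part-Cl q A) (≈-sym (part-Cl q A) (Card.biject C.cardμ))
            (Card.biject (subst (λ μ → Card μ (part q B)) (sym μ-unique) D.cardμ))

    module _ {W W′ A B} (c : Component p q W A) (d : Component p q W′ B) where
      private
        module C = Component c
        module D = Component d

      -- ⟨κ|μ⟩ and ⟨κ′|μ′⟩ are separated by a point of κ outside μ′ or of κ′ outside μ. Without such
      -- a point κ ⊆ μ′ and κ′ ⊆ μ, and inclusions of cardinals are embeddings.
      inseparable⇒↪ : ¬ W =⁻ W′ → (part p A ↪ part q B) × (part p B ↪ part q A)
      inseparable⇒↪ n =
          Card-↪ (part-Cl p A) C.cardκ D.cardμ (λ {x} x∈ → by-contradiction λ x∉ →
            n (proj₂ =⁻⟷Separated
              (x , inj₁ (proj₂ (proj₁ (C.extent x)) x∈ , proj₂ (proj₂ (D.extent x)) x∉))))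
        , Card-↪ (part-Cl p B) D.cardκ C.cardμ (λ {x} x∈ → by-contradiction λ x∉ →
            n (proj₂ =⁻⟷Separated
              (x , inj₂ (proj₂ (proj₂ (C.extent x)) x∉ , proj₂ (proj₁ (D.extent x)) x∈))))

      ↪⇒inseparable : part p A ↪ part q B → part p B ↪ part q A → ¬ W =⁻ W′
      ↪⇒inseparable e e′ n = let x , s = proj₁ =⁻⟷Separated n in
        [ (λ (x∈ , x∉) → proj₁ (proj₂ (D.extent x)) x∉
             (Card-⊆ (part-Cl p A) (part-Cl q B) C.cardκ D.cardμ e (proj₁ (proj₁ (C.extent x)) x∈)))
        , (λ (x∉ , x∈) → proj₁ (proj₂ (C.extent x)) x∉
             (Card-⊆ (part-Cl p B) (part-Cl q A) D.cardκ C.cardμ e′ (proj₁ (proj₁ (D.extent x)) x∈))) ]′ s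

  record CardinalNumber (c A : Dom) : Set ℓ where
    field
      {X Y Z p} : Dom
      isX : Component truth nonFalse X A
      isY : Component tpart nonFalse Y A
      isZ : Component glut gap Z A
      pairXY : Pair p X Y
      triple : Pair c p Z

  CardinalNumber⟷true : (i j : Fin n) (ρ : Vec Dom n) →
    CardinalNumber (lookup ρ i) (lookup ρ j) ⟷ T (i isCardinalNumber j) ρ
  CardinalNumber⟷true i j ρ = to , from
    where
    to : CardinalNumber (lookup ρ i) (lookup ρ j) → T (i isCardinalNumber j) ρ
    to n =
        X , proj₁ (Component⟷true truth nonFalse 0F (suc j) (X ∷ ρ)) isX
      , Y , proj₁ (Component⟷true tpart nonFalse 0F (suc (suc j)) (Y ∷ X ∷ ρ)) isY
      , Z , proj₁ (Component⟷true glut gap 0F (suc (suc (suc j))) (Z ∷ Y ∷ X ∷ ρ)) isZ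
      , p , proj₂ (pair-true 0F 3F 2F (p ∷ Z ∷ Y ∷ X ∷ ρ)) pairXY
          , proj₂ (pair-true (↑ (↑³ i)) 0F 1F (p ∷ Z ∷ Y ∷ X ∷ ρ)) triple
      where open CardinalNumber n

    from : T (i isCardinalNumber j) ρ → CardinalNumber (lookup ρ i) (lookup ρ j)
    from (X , x , Y , y , Z , z , p , π , π′) = record
      { X = X ; Y = Y ; Z = Z ; p = p
      ; isX = proj₂ (Component⟷true truth nonFalse 0F (suc j) (X ∷ ρ)) x
      ; isY = proj₂ (Component⟷true tpart nonFalse 0F (suc (suc j)) (Y ∷ X ∷ ρ)) y
      ; isZ = proj₂ (Component⟷true glut gap 0F (suc (suc (suc j))) (Z ∷ Y ∷ X ∷ ρ)) z
      ; pairXY = proj₁ (pair-true 0F 3F 2F (p ∷ Z ∷ Y ∷ X ∷ ρ)) π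
      ; triple = proj₁ (pair-true (↑ (↑³ i)) 0F 1F (p ∷ Z ∷ Y ∷ X ∷ ρ)) π′ }

  cardinalNumber : ∀ A → Σ Dom λ c → CardinalNumber c A
  cardinalNumber A =
    let X , x = component-exists truth nonFalse A
        Y , y = component-exists tpart nonFalse A
        Z , z = component-exists glut gap A
        p , π = opair X Y
        c , π′ = opair p Z
    in c , record { isX = x ; isY = y ; isZ = z ; pairXY = π ; triple = π′ }

  -- Countings and equinumerosity

  -- Another form of "f counts A and f[A] = B": a bijection of realms that preserves truth and
  -- falsity of membership.
  record Iso (f A B : Dom) : Set ℓ where
    field
      inj       : Inj f
      source    : ∀ {x y} → App f x y → In realm A x
      total     : ∀ {x} → In realm A x → Σ Dom (App f x)
      preserve⁺ : ∀ {x y} → App f x y → x ∈⁺ A ⟷ y ∈⁺ B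
      preserve⁻ : ∀ {x y} → App f x y → x ∈⁻ A ⟷ y ∈⁻ B
      onto      : ∀ {y} → In realm B y → Σ Dom λ x → App f x y

  Counts : Dom → Dom → Set ℓ
  Counts f A = Inj f × part realm A Comprises λ x → Σ Dom (App f x)

  Count-true : (i j : Fin n) (ρ : Vec Dom n) → T (i ∈Count j) ρ ⟷ Counts (lookup ρ i) (lookup ρ j)
  Count-true i j ρ =
      (λ (inj , D , r , d) → counts (proj₂ (Injection⟷true i ρ) inj) D
        (proj₁ (part-true realm 0F (suc j) (D ∷ ρ)) r)
        (λ cl → proj₁ (domain-true 0F (suc i) (D ∷ ρ) cl) d))
    , (λ (inj , c) → proj₁ (Injection⟷true i ρ) inj , D
         , proj₂ (part-true realm 0F (suc j) (D ∷ ρ)) (part-comprises realm (lookup ρ j))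
         , proj₂ (domain-true 0F (suc i) (D ∷ ρ) (Inj-Cl inj)) c)
    where
    D = part realm (lookup ρ j)
    counts : ∀ {f A} → Inj f → ∀ D → D Comprises In realm A →
             (Cl f → D Comprises λ x → Σ Dom (App f x)) → Counts f A
    counts {f} {A} inj D c d = inj , subst (_Comprises λ x → Σ Dom (App f x))
      (comprises-unique c (part-comprises realm A)) (d (Inj-Cl inj))

  Image : Dom → Dom → Dom → Set ℓ
  Image U f A = TrueIff U (λ y → Σ Dom λ x → App f x y × x ∈⁺ A) (λ y → ∀ x → App f x y → x ∈⁻ A)

  Image-true : (i j k : Fin n) (ρ : Vec Dom n) →
    T (i isImage j [ k ]) ρ ⟷ Image (lookup ρ i) (lookup ρ j) (lookup ρ k)
  Image-true i j k ρ = Π-cong λ y → ×-cong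
    (×-cong (→-cong (id , id) (t y)) (→-cong (t y) (id , id)))
    (×-cong (→-cong (id , id) (f y)) (→-cong (f y) (id , id)))
    where
    t = λ y → Σ-cong λ x → ×-cong (app-true 0F 1F (↑² j) (x ∷ y ∷ ρ)) (id , id)
    f = λ y → Π-cong λ x → →-cong (app-true 0F 1F (↑² j) (x ∷ y ∷ ρ)) (id , id)

  Image-exists : ∀ {f} → Functional (App f) → ∀ A → Σ Dom λ U → Image U f A
  Image-exists {f} fun A =
    let U , e = replace (⟪ 0F , 1F ⟫∈ 2F) (f ∷ [])
                  (λ p q → fun (proj₁ (app _ _) p) (proj₁ (app _ _) q)) A
    in U , λ y →
      let (p , p′) , (q , q′) = e y
      in ( (λ y∈ → let x , a , x∈ = p y∈ in x , proj₁ (app x y) a , x∈)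
         , (λ (x , a , x∈) → p′ (x , proj₂ (app x y) a , x∈)))
       , ( (λ y∉ x a → q y∉ x (proj₂ (app x y) a))
         , (λ h → q′ λ x a → h x (proj₁ (app x y) a)))
    where
    app = λ x y → app-true 0F 1F 2F (x ∷ y ∷ f ∷ [])

  restriction : ∀ {f} → Functional (App f) → ∀ {X} → Cl X →
                Σ Dom λ k → Graph k λ x y → x ∈⁺ X × App f x y
  restriction {f} fun clX = graph (⟪ 0F , 1F ⟫∈ 2F) (f ∷ []) (App f)
    (λ x y → app-true 0F 1F 2F (x ∷ y ∷ f ∷ [])) fun clX

  Iso⇒counts : ∀ {f A B} → Iso f A B → Counts f A × Image B f A
  Iso⇒counts {f} {A} {B} i =
      (inj , record
        { classical = part-Cl realm A
        ; out  = total ∘ out (part-comprises realm A)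
        ; into = λ (_ , a) → into (part-comprises realm A) (source a) })
    , λ y →
        ( (λ y∈ → let x , a = onto (inj₁ y∈) in x , a , proj₂ (preserve⁺ a) y∈)
        , (λ (x , a , x∈) → proj₁ (preserve⁺ a) x∈))
      , ( (λ y∉ x a → proj₂ (preserve⁻ a) y∉)
        , (λ h → by-contradiction λ ny → let x , a = onto (inj₂ ny) in ny (proj₁ (preserve⁻ a) (h x a))))
    where open Iso i

  counts⇒Iso : ∀ {f A B} → Counts f A → Image B f A → Iso f A B
  counts⇒Iso {f} {A} (inj , d) im = record
    { inj       = inj
    ; source    = λ a → out (part-comprises realm A) (into d (_ , a))
    ; total     = λ x∈ → out d (into (part-comprises realm A) x∈)
    ; preserve⁺ = λ a → (λ x∈ → proj₂ (proj₁ (im _)) (_ , a , x∈))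
                      , (λ y∈ → let x′ , a′ , x′∈ = proj₁ (proj₁ (im _)) y∈ in
                           subst (_∈⁺ A) (Inj-injective inj a′ a) x′∈)
    ; preserve⁻ = λ a → (λ x∉ → proj₂ (proj₂ (im _)) λ x′ a′ → subst (_∈⁻ A) (Inj-injective inj a a′) x∉)
                      , (λ y∉ → proj₁ (proj₂ (im _)) y∉ _ a)
    ; onto      = [ (λ y∈ → let x , a , _ = proj₁ (proj₁ (im _)) y∈ in x , a)
                  -- A value that f does not take is vacuously false in the image.
                  , (λ ny → by-contradiction λ none →
                       ny (proj₂ (proj₂ (im _)) λ x a → absurd (none (x , a)))) ]′ }

  Iso⇒≈ : ∀ p {f A B} → Iso f A B → part p A ≈ part p B
  Iso⇒≈ p {f} {A} {B} i = proj₁ r , record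
    { embeds = record
      { inj    = restricted-inj γ (Inj-functional inj) (Inj-injective inj)
      ; source = proj₁ ∘ appOut γ
      ; target = λ a → let x∈ , b = appOut γ a in
          into (part-comprises p B)
            (proj₁ (In-cong p (preserve⁺ b) (preserve⁻ b)) (out (part-comprises p A) x∈))
      ; total  = λ x∈ → let y , a = total (In-realm p (out (part-comprises p A) x∈)) in
          y , appInto γ (x∈ , a) }
    ; onto = λ y∈ → let x , a = onto (In-realm p (out (part-comprises p B) y∈)) in
        x , appInto γ (into (part-comprises p A)
              (proj₂ (In-cong p (preserve⁺ a) (preserve⁻ a)) (out (part-comprises p B) y∈)) , a) }
    where open Iso i
          r = restriction (Inj-functional inj) (part-Cl p A)
          γ = proj₂ r

  Basic-disjoint : ∀ {p q A x} → Basic p → Basic q → In p A x → In q A x → p ≡ q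
  Basic-disjoint glut  glut  _ _ = refl
  Basic-disjoint glut  tpart (_ , f) (_ , nf) = absurd (nf f)
  Basic-disjoint glut  gap   (t , _) (_ , nt) = absurd (nt t)
  Basic-disjoint tpart glut  (_ , nf) (_ , f) = absurd (nf f)
  Basic-disjoint tpart tpart _ _ = refl
  Basic-disjoint tpart gap   (t , _) (_ , nt) = absurd (nt t)
  Basic-disjoint gap   glut  (_ , nt) (t , _) = absurd (nt t)
  Basic-disjoint gap   tpart (_ , nt) (t , _) = absurd (nt t)
  Basic-disjoint gap   gap   _ _ = refl

  realm-Basic : ∀ {A x} → In realm A x → Σ Part λ p → Basic p × In p A x
  realm-Basic {A} {x} r with decide (x ∈⁺ A) | decide (x ∈⁻ A)
  ... | inj₁ t  | inj₁ f  = _ , glut , t , f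
  ... | inj₁ t  | inj₂ nf = _ , tpart , t , nf
  ... | inj₂ nt | inj₂ nf = _ , gap , nf , nt
  ... | inj₂ nt | inj₁ f  = absurd ([ nt , (λ nf → nf f) ]′ r)

  Basic-preserve : ∀ {p A B x y} → Basic p → In p A x → In p B y →
                   (x ∈⁺ A ⟷ y ∈⁺ B) × (x ∈⁻ A ⟷ y ∈⁻ B)
  Basic-preserve glut (t , f) (t′ , f′) = ((λ _ → t′) , (λ _ → t)) , (λ _ → f′) , (λ _ → f)
  Basic-preserve tpart (t , nf) (t′ , nf′) = ((λ _ → t′) , (λ _ → t)) , absurd ∘ nf , absurd ∘ nf′
  Basic-preserve gap (nf , nt) (nf′ , nt′) = (absurd ∘ nt , absurd ∘ nt′) , absurd ∘ nf , absurd ∘ nf′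

  module _ {A B} (e : ∀ {p} → Basic p → part p A ≈ part p B) where
    private
      map : ∀ {p} → Basic p → Dom
      map b = proj₁ (e b)

      bij : ∀ {p} (b : Basic p) → Bijects (map b) (part p A) (part p B)
      bij b = proj₂ (e b)

      Union : Dom → Dom → Set ℓ
      Union x y = App (map glut) x y ⊎ App (map tpart) x y ⊎ App (map gap) x y

      -- The relation `Union` again, indexed by the part. Two pieces with a common source or target
      -- then belong to the same part, and the bijection of that part decides.
      Piece : Dom → Dom → Set ℓ
      Piece x y = Σ Part λ p → Σ (Basic p) λ b → App (map b) x y

      piece : ∀ {x y} → Union x y → Piece x y
      piece (inj₁ a)        = _ , glut , a
      piece (inj₂ (inj₁ a)) = _ , tpart , a
      piece (inj₂ (inj₂ a)) = _ , gap , a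

      glue : ∀ {x y p} (b : Basic p) → App (map b) x y → Union x y
      glue glut  a = inj₁ a
      glue tpart a = inj₂ (inj₁ a)
      glue gap   a = inj₂ (inj₂ a)

      Basic-unique : ∀ {p} (b b′ : Basic p) → b ≡ b′
      Basic-unique glut  glut  = refl
      Basic-unique tpart tpart = refl
      Basic-unique gap   gap   = refl

      source∈ : ∀ {p x y} (b : Basic p) → App (map b) x y → In p A x
      source∈ {p} b a = out (part-comprises p A) (Bijects.source (bij b) a)

      target∈ : ∀ {p x y} (b : Basic p) → App (map b) x y → In p B y
      target∈ {p} b a = out (part-comprises p B) (Bijects.target (bij b) a)

      functional : ∀ {x y z} → Piece x y → Piece x z → y ≡ z
      functional (p , b , a) (q , b′ , a′) with Basic-disjoint b b′ (source∈ b a) (source∈ b′ a′)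
      ... | refl with Basic-unique b b′
      ...   | refl = Bijects.functional (bij b) a a′

      injective : ∀ {x y z} → Piece x z → Piece y z → x ≡ y
      injective (p , b , a) (q , b′ , a′) with Basic-disjoint b b′ (target∈ b a) (target∈ b′ a′)
      ... | refl with Basic-unique b b′
      ...   | refl = Bijects.injective (bij b) a a′

      opaque
        unionGraph : Σ Dom λ f → Graph f λ x y → x ∈⁺ part realm A × Union x y
        unionGraph = graph (⟪ 0F , 1F ⟫∈ 2F ∨̇ ⟪ 0F , 1F ⟫∈ 3F ∨̇ ⟪ 0F , 1F ⟫∈ 4F)
          (map glut ∷ map tpart ∷ map gap ∷ []) Union
          (λ x y → let ρ = x ∷ y ∷ map glut ∷ map tpart ∷ map gap ∷ [] in
            ⊎-cong (app-true 0F 1F 2F ρ) (⊎-cong (app-true 0F 1F 3F ρ) (app-true 0F 1F 4F ρ)))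
          (λ u v → functional (piece u) (piece v)) (part-Cl realm A)

      f = proj₁ unionGraph
      γ = proj₂ unionGraph

      pieceOf : ∀ {x y} → App f x y → Piece x y
      pieceOf a = piece (proj₂ (appOut γ a))

      preserve : ∀ {x y} → Piece x y → (x ∈⁺ A ⟷ y ∈⁺ B) × (x ∈⁻ A ⟷ y ∈⁻ B)
      preserve (p , b , a) = Basic-preserve b (source∈ b a) (target∈ b a)

      app : ∀ {p x y} (b : Basic p) → App (map b) x y → App f x y
      app {p} b a = appInto γ (into (part-comprises realm A) (In-realm p (source∈ b a)) , glue b a)

    -- Bijections of the basic parts glue to a bijection of realms, and it preserves truth and
    -- falsity since each basic part fixes both.
    ≈⇒Iso : Σ Dom λ f → Iso f A B
    ≈⇒Iso = f , record
      { inj       = graph-inj γ (λ (_ , u) (_ , v) → functional (piece u) (piece v))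
                                (λ (_ , u) (_ , v) → injective (piece u) (piece v))
      ; source    = λ a → let p , b , a′ = pieceOf a in In-realm p (source∈ b a′)
      ; total     = λ r → let p , b , i = realm-Basic r
                              y , a = Bijects.total (bij b) (into (part-comprises p A) i)
                          in y , app b a
      ; preserve⁺ = λ a → proj₁ (preserve (pieceOf a))
      ; preserve⁻ = λ a → proj₂ (preserve (pieceOf a))
      ; onto      = λ r → let p , b , i = realm-Basic r
                              x , a = Bijects.onto (bij b) (into (part-comprises p B) i)
                          in x , app b a }

  Iso-refl : ∀ A → Σ Dom λ f → Iso f A A
  Iso-refl A = ≈⇒Iso λ {p} _ → identity p
    where
    identity : ∀ p → part p A ≈ part p A
    identity p = cantor-bernstein (part-Cl p A) (⊆⇒↪ (part-Cl p A) id) (⊆⇒↪ (part-Cl p A) id)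

  Iso⇒cardinal : ∀ {f g A B U} → Iso f A U → Iso g B U →
                 ∀ {c} → CardinalNumber c A → CardinalNumber c B
  Iso⇒cardinal {A = A} {B} {U} i j n = record
    { isX = component-resp truth nonFalse (e truth) (e nonFalse) isX
    ; isY = component-resp tpart nonFalse (e tpart) (e nonFalse) isY
    ; isZ = component-resp glut gap (e glut) (e gap) isZ
    ; pairXY = pairXY ; triple = triple }
    where open CardinalNumber n
          e : ∀ p → part p A ≈ part p B
          e p = ≈-trans (part-Cl p A) (Iso⇒≈ p i) (≈-sym (part-Cl p U) (Iso⇒≈ p j))

  -- The third component determines the gluts and the gaps up to bijection, the truth half of the
  -- second determines A_t.
  cardinal⇒Iso : ∀ {c A B} → CardinalNumber c A → CardinalNumber c B → Σ Dom λ f → Iso f A B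
  cardinal⇒Iso {A = A} {B} m′ n′ = ≈⇒Iso e
    where
    module M = CardinalNumber m′
    module N = CardinalNumber n′
    p≡ = pair-first M.triple N.triple
    X≡ : N.X ≡ M.X
    X≡ = pair-first N.pairXY (subst (λ p → Pair p M.X M.Y) p≡ M.pairXY)
    Y≡ : N.Y ≡ M.Y
    Y≡ = pair-second N.pairXY (subst (λ p → Pair p M.X M.Y) p≡ M.pairXY)
    Z≡ : N.Z ≡ M.Z
    Z≡ = pair-second N.triple M.triple
    glut-gap = component-≈ glut gap M.isZ (subst (λ Z → Component glut gap Z B) Z≡ N.isZ)
    e : ∀ {p} → Basic p → part p A ≈ part p B
    e glut  = proj₁ glut-gap
    e tpart = proj₁ (component-≈ tpart nonFalse M.isY
                      (subst (λ Y → Component tpart nonFalse Y B) Y≡ N.isY))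
    e gap   = proj₂ glut-gap

  -- Falsity: separated cardinals and separated images.

  cardinal-=⁻⇒image-=⁻ : ∀ {f g A B U V} → Iso f A U → Iso g B V →
    (∀ c → CardinalNumber c A → ∀ d → CardinalNumber d B → c =⁻ d) → U =⁻ V
  cardinal-=⁻⇒image-=⁻ {A = A} {B} {U} {V} i j h = by-contradiction λ n →
    let c , C = cardinalNumber A
        d , D = cardinalNumber B
    in refute n C D (h c C d D)
    where
    -- If U and V are not separated, U^! lies in V^? and V^! in U^?. Carried to A and B along the
    -- countings, these inclusions become embeddings under which no component of the cardinals is
    -- separated.
    module _ (n : ¬ U =⁻ V) where
      U⁺ : ∀ {x} → x ∈⁺ U → ¬ x ∈⁻ V
      U⁺ x∈ x∉ = n (proj₂ =⁻⟷Separated (_ , inj₁ (x∈ , x∉)))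

      V⁺ : ∀ {x} → x ∈⁺ V → ¬ x ∈⁻ U
      V⁺ x∈ x∉ = n (proj₂ =⁻⟷Separated (_ , inj₂ (x∉ , x∈)))

      A↪B : ∀ p q → (∀ {x} → In p U x → In q V x) → part p A ↪ part q B
      A↪B p q ⊆ = ↪-trans (part-Cl p A) (≈⇒↪ (Iso⇒≈ p i)) (↪-trans (part-Cl p U)
        (⊆⇒↪ (part-Cl p U) (into (part-comprises q V) ∘ ⊆ ∘ out (part-comprises p U)))
        (≈⇒↪ (≈-sym (part-Cl q V) (Iso⇒≈ q j))))

      B↪A : ∀ p q → (∀ {x} → In p V x → In q U x) → part p B ↪ part q A
      B↪A p q ⊆ = ↪-trans (part-Cl p B) (≈⇒↪ (Iso⇒≈ p j)) (↪-trans (part-Cl p V)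
        (⊆⇒↪ (part-Cl p V) (into (part-comprises q U) ∘ ⊆ ∘ out (part-comprises p V)))
        (≈⇒↪ (≈-sym (part-Cl q U) (Iso⇒≈ q i))))

      refute : ∀ {c d} → CardinalNumber c A → CardinalNumber d B → ¬ c =⁻ d
      refute C D c≠d =
        [ (λ p≠ → [ ↪⇒inseparable truth nonFalse C.isX D.isX
                      (A↪B truth nonFalse U⁺) (B↪A truth nonFalse V⁺)
                  , ↪⇒inseparable tpart nonFalse C.isY D.isY
                      (A↪B tpart nonFalse (U⁺ ∘ proj₁)) (B↪A tpart nonFalse (V⁺ ∘ proj₁))
                  ]′ (proj₁ (pair-=⁻ C.pairXY D.pairXY) p≠))
        , ↪⇒inseparable glut gap C.isZ D.isZ
            -- Being true in U, a glut of U is not false in V; being false in U, it is not true in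
            -- V.
            (A↪B glut gap λ (t , f) → U⁺ t , λ t′ → V⁺ t′ f)
            (B↪A glut gap λ (t , f) → V⁺ t , λ t′ → U⁺ t′ f)
        ]′ (proj₁ (pair-=⁻ C.triple D.triple) c≠d)
        where module C = CardinalNumber C
              module D = CardinalNumber D

  counting-image : ∀ {f A} → Inj f → (∀ {x y} → App f x y → In realm A x) →
                   (∀ {x} → In realm A x → Σ Dom (App f x)) → Σ Dom (Iso f A)
  counting-image {f} {A} inj source total =
    let U , u = Image-exists (Inj-functional inj) A in
    U , counts⇒Iso (inj , record
      { classical = part-Cl realm A
      ; out  = total ∘ out (part-comprises realm A)
      ; into = λ (_ , a) → into (part-comprises realm A) (source a) }) u

  gap⊆nonFalse : ∀ {A x} → x ∈⁺ part gap A → x ∈⁺ part nonFalse A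
  gap⊆nonFalse {A} x∈ = into (part-comprises nonFalse A) (proj₁ (out (part-comprises gap A) x∈))

  -- What an edge from A^! must satisfy so that a common value of a and b does not separate f[A]
  -- from g[B]: truth on either side excludes falsity on the other.
  Compatible : Dom → Dom → Dom → Set ℓ
  Compatible k A B = ∀ {a b} → App k a b →
    a ∈⁺ A × (¬ b ∈⁻ B) × (b ∈⁺ B → ¬ a ∈⁻ A)

  -- The critical case is a glut a: it is false in A, so its partner must not be true in B.
  -- Rerouting ensures this by sending gluts to gaps.
  compatible : ∀ {A B} → part truth A ↪ part nonFalse B → part glut A ↪ part gap B →
    Σ Dom λ k → Inj k × (∀ {a} → a ∈⁺ A → Σ Dom (App k a)) × Compatible k A B
  compatible {A} {B} (_ , eh) (_ , ej) = k , Embeds.inj E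
    , (λ a∈ → Embeds.total E (into (part-comprises truth A) a∈))
    , λ a → let a∈ = out (part-comprises truth A) (Embeds.source E a) in
          a∈ , out (part-comprises nonFalse B) (Embeds.target E a)
        , λ b∈ a∉ → proj₂ (out (part-comprises gap B)
                             (toGap (into (part-comprises glut A) (a∈ , a∉)) a)) b∈
    where
    r = Reroute.reroute (part-Cl truth A) (part-Cl nonFalse B) gap⊆nonFalse eh ej
    k = proj₁ r
    E = proj₁ (proj₂ r)
    toGap = proj₂ (proj₂ r)

  -- Countings that send matched elements to a common value, all other
  -- elements to values of their own.
  module Countings {A B k l} (inj-k : Inj k) (inj-l : Inj l)
    (total-k : ∀ {a} → a ∈⁺ A → Σ Dom (App k a)) (total-l : ∀ {b} → b ∈⁺ B → Σ Dom (App l b))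
    (ok-k : Compatible k A B) (ok-l : Compatible l B A) where

    private
      open module Mt = Match (part-Cl realm A) inj-k inj-l
        (λ a → into (part-comprises realm A) (inj₁ (proj₁ (ok-k a))))
        (λ a → into (part-comprises realm A) (inj₂ (proj₁ (proj₂ (ok-l a)))))
        using (Matched; Matched-functional; Matched-injective; covers₁; covers₂; sound; matching)

      M = proj₁ matching
      γM = proj₂ matching

      ok⁺ : ∀ {a b} → Matched a b → a ∈⁺ A → ¬ b ∈⁻ B
      ok⁺ m = [ (λ p _ → proj₁ (proj₂ (ok-k p))) , (λ q → proj₂ (proj₂ (ok-l q))) ]′ (sound m)

      ok⁻ : ∀ {a b} → Matched a b → b ∈⁺ B → ¬ a ∈⁻ A
      ok⁻ m = [ (λ p → proj₂ (proj₂ (ok-k p))) , (λ q _ → proj₁ (proj₂ (ok-l q))) ]′ (sound m)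

      realmA : ∀ {a b} → Matched a b → a ∈⁺ part realm A
      realmA m = into (part-comprises realm A)
        ([ (λ p → inj₁ (proj₁ (ok-k p))) , (λ q → inj₂ (proj₁ (proj₂ (ok-l q)))) ]′ (sound m))

      -- A matched a takes the value of its partner, which carries the tag `𝟏` as all values for B
      -- do. An unmatched a gets the tag `𝟎` and so avoids them.
      CountA : Dom → Dom → Set ℓ
      CountA a z = (Σ Dom λ b → App M a b × Tag z b 𝟏) ⊎ ((¬ Σ Dom (App M a)) × Tag z a 𝟎)

      CountB : Dom → Dom → Set ℓ
      CountB b z = Tag z b 𝟏

      M-functional : Functional (App M)
      M-functional p q = Matched-functional (proj₂ (appOut γM p)) (proj₂ (appOut γM q))

      M-injective : Functional (λ b a → App M a b)
      M-injective p q = Matched-injective (proj₂ (appOut γM p)) (proj₂ (appOut γM q))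

      CountA-functional : Functional CountA
      CountA-functional {y = z} (inj₁ (b , p , τ)) (inj₁ (b′ , p′ , τ′)) =
        tag-unique (subst (λ b → Tag z b 𝟏) (M-functional p p′) τ) τ′
      CountA-functional (inj₁ (b , p , _)) (inj₂ (n , _)) = absurd (n (b , p))
      CountA-functional (inj₂ (n , _)) (inj₁ (b , p , _)) = absurd (n (b , p))
      CountA-functional (inj₂ (_ , τ)) (inj₂ (_ , τ′)) = tag-unique τ τ′

      CountA-injective : Functional (λ z a → CountA a z)
      CountA-injective {z = a′} (inj₁ (b , p , τ)) (inj₁ (b′ , p′ , τ′)) =
        M-injective p (subst (App M a′) (tag-first τ′ τ) p′)
      CountA-injective (inj₁ (_ , _ , τ)) (inj₂ (_ , τ′)) = absurd (tag-𝟎𝟏 τ′ τ)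
      CountA-injective (inj₂ (_ , τ)) (inj₁ (_ , _ , τ′)) = absurd (tag-𝟎𝟏 τ τ′)
      CountA-injective (inj₂ (_ , τ)) (inj₂ (_ , τ′)) = tag-first τ τ′

      CountB-injective : Functional (λ z b → CountB b z)
      CountB-injective τ τ′ = tag-first τ τ′

      opaque
        graphA : Σ Dom λ f → Graph f λ a z → a ∈⁺ part realm A × CountA a z
        graphA = graph
          (   ex (⟪ 1F , 0F ⟫∈ 3F ∧̇ 2F isTagged 0F , 4F)
           ∨̇ ¬̇ ex (⟪ 1F , 0F ⟫∈ 3F) ∧̇ 1F isTagged 0F , 4F)
          (M ∷ 𝟏 ∷ 𝟎 ∷ []) CountA
          (λ a z → let ρ = a ∷ z ∷ M ∷ 𝟏 ∷ 𝟎 ∷ [] in ⊎-cong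
            (Σ-cong λ b → ×-cong (app-true 1F 0F 3F (b ∷ ρ)) (id , id))
            (×-cong (→-cong (Σ-cong λ b → app-true 1F 0F 3F (b ∷ ρ)) (id , id)) (id , id)))
          CountA-functional (part-Cl realm A)

        graphB : Σ Dom λ g → Graph g λ b z → b ∈⁺ part realm B × CountB b z
        graphB =
          graph (1F isTagged 0F , 2F) (𝟏 ∷ []) CountB (λ _ _ → id , id) tag-unique (part-Cl realm B)

      f = proj₁ graphA
      γf = proj₂ graphA
      g = proj₁ graphB
      γg = proj₂ graphB

      valueA : ∀ a → Σ Dom (CountA a)
      valueA a with decide (Σ Dom (App M a))
      ... | inj₁ (b , p) = let z , τ = tag b 𝟏 in z , inj₁ (b , p , τ)
      ... | inj₂ n       = let z , τ = tag a 𝟎 in z , inj₂ (n , τ)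

      imageA : Σ Dom (Iso f A)
      imageA = counting-image
        (restricted-inj γf CountA-functional CountA-injective)
        (λ p → out (part-comprises realm A) (proj₁ (appOut γf p)))
        (λ {a} r → let z , v = valueA a in z , appInto γf (into (part-comprises realm A) r , v))

      imageB : Σ Dom (Iso g B)
      imageB = counting-image
        (restricted-inj γg tag-unique CountB-injective)
        (λ p → out (part-comprises realm B) (proj₁ (appOut γg p)))
        (λ {b} r → let z , τ = tag b 𝟏 in z , appInto γg (into (part-comprises realm B) r , τ))

      module IA = Iso (proj₂ imageA)
      module IB = Iso (proj₂ imageB)

      common : ∀ {a b z} → Matched a b → In realm B b → Tag z b 𝟏 → App f a z × App g b z
      common m r τ = appInto γf (realmA m , inj₁ (_ , appInto γM (realmA m , m) , τ))
                   , appInto γg (into (part-comprises realm B) r , τ)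

      -- A value true in f[A] comes from A^!, where k is total, so the matching covers its source.
      -- The partner has the same value and is not false in B.
      inseparable⁺ : ∀ {x} → x ∈⁺ proj₁ imageA → ¬ x ∈⁻ proj₁ imageB
      inseparable⁺ {x} x∈ x∉ =
        let a , p = IA.onto (inj₁ x∈)
            a∈ = proj₂ (IA.preserve⁺ p) x∈
            b , m = covers₁ (proj₂ (total-k a∈))
            z , τ = tag b 𝟏
            pf , pg = common m (inj₂ (ok⁺ m a∈)) τ
        in ok⁺ m a∈ (proj₂ (IB.preserve⁻ pg) (subst (_∈⁻ _) (Inj-functional IA.inj p pf) x∉))

      inseparable⁻ : ∀ {x} → x ∈⁺ proj₁ imageB → ¬ x ∈⁻ proj₁ imageA
      inseparable⁻ {x} x∈ x∉ =
        let b , p = IB.onto (inj₁ x∈)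
            b∈ = proj₂ (IB.preserve⁺ p) x∈
            a , m = covers₂ (proj₂ (total-l b∈))
            z , τ = tag b 𝟏
            pf , pg = common m (inj₁ b∈) τ
        in ok⁻ m b∈ (proj₂ (IA.preserve⁻ pf) (subst (_∈⁻ _) (Inj-functional IB.inj p pg) x∉))

    inseparable-images : Σ Dom λ f → Σ Dom λ g → Σ Dom λ U → Σ Dom λ V →
                         Iso f A U × Iso g B V × (¬ U =⁻ V)
    inseparable-images = f , g , proj₁ imageA , proj₁ imageB , proj₂ imageA , proj₂ imageB
      , λ n → let x , s = proj₁ =⁻⟷Separated n in
          [ (λ (x∈ , x∉) → inseparable⁺ x∈ x∉) , (λ (x∉ , x∈) → inseparable⁻ x∈ x∉) ]′ s

  -- By contraposition: inseparable first components embed A^! and B^!, inseparable third components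
  -- embed the gluts into the gaps, and from these come countings with inseparable images.
  image-=⁻⇒cardinal-=⁻ : ∀ {A B} → (∀ {f g U V} → Iso f A U → Iso g B V → U =⁻ V) →
    ∀ {c d} → CardinalNumber c A → CardinalNumber d B → c =⁻ d
  image-=⁻⇒cardinal-=⁻ h C D = by-contradiction λ n →
    let A!↪B? , B!↪A? = inseparable⇒↪ truth nonFalse C.isX D.isX
          λ x≠ → n (proj₂ (pair-=⁻ C.triple D.triple)
                      (inj₁ (proj₂ (pair-=⁻ C.pairXY D.pairXY) (inj₁ x≠))))
        Ab↪Bn , Bb↪An = inseparable⇒↪ glut gap C.isZ D.isZ
          λ z≠ → n (proj₂ (pair-=⁻ C.triple D.triple) (inj₂ z≠))
        k , inj-k , total-k , ok-k = compatible A!↪B? Ab↪Bn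
        l , inj-l , total-l , ok-l = compatible B!↪A? Bb↪An
        f , g , U , V , i , j , n′ = Countings.inseparable-images inj-k inj-l total-k total-l ok-k ok-l
    in n′ (h i j)
    where module C = CardinalNumber C
          module D = CardinalNumber D

  -- Truth and falsity of both sides, and the theorem.

  cardinal-true : (i j : Fin n) (ρ : Vec Dom n) → True 𝔐 ∣ i ∣≐∣ j ∣ ρ ⟷
    Σ Dom λ c → CardinalNumber c (lookup ρ i) × CardinalNumber c (lookup ρ j)
  cardinal-true i j ρ =
      (λ (c , C , d , D , e) → c , proj₂ (CardinalNumber⟷true 0F (↑ i) (c ∷ ρ)) C
         , subst (λ d → CardinalNumber d (lookup ρ j)) (sym e)
             (proj₂ (CardinalNumber⟷true 0F (↑² j) (d ∷ c ∷ ρ)) D))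
    , (λ (c , C , D) → c , proj₁ (CardinalNumber⟷true 0F (↑ i) (c ∷ ρ)) C
                     , c , proj₁ (CardinalNumber⟷true 0F (↑² j) (c ∷ c ∷ ρ)) D , refl)

  -- Falsity turns the eliminated terms |A| and |B| into universal quantifiers over their values;
  -- `cardinalNumber` provides values to instantiate them.
  cardinal-false : (i j : Fin n) (ρ : Vec Dom n) → False 𝔐 ∣ i ∣≐∣ j ∣ ρ ⟷
    (∀ c → CardinalNumber c (lookup ρ i) → ∀ d → CardinalNumber d (lookup ρ j) → c =⁻ d)
  cardinal-false i j ρ =
      (λ h c C d D → h c (proj₁ (CardinalNumber⟷true 0F (↑ i) (c ∷ ρ)) C)
                       d (proj₁ (CardinalNumber⟷true 0F (↑² j) (d ∷ c ∷ ρ)) D))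
    , (λ h c C d D → h c (proj₂ (CardinalNumber⟷true 0F (↑ i) (c ∷ ρ)) C)
                       d (proj₂ (CardinalNumber⟷true 0F (↑² j) (d ∷ c ∷ ρ)) D))

  module _ (i j : Fin n) (ρ : Vec Dom n) where
    private
      A = lookup ρ i
      B = lookup ρ j

      countA = λ f → Count-true 0F (↑ i) (f ∷ ρ)
      countB = λ g f → Count-true 0F (↑² j) (g ∷ f ∷ ρ)
      imageA = λ U g f → Image-true 0F (↑² 0F) (↑³ i) (U ∷ g ∷ f ∷ ρ)
      imageB = λ V U g f → Image-true 0F (↑² 0F) (↑ (↑³ j)) (V ∷ U ∷ g ∷ f ∷ ρ)

    ≅-true : True 𝔐 (i ≅̇ j) ρ ⟷ Σ Dom λ f → Σ Dom λ g → Σ Dom λ U → Iso f A U × Iso g B U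
    ≅-true =
        (λ (f , i₁ , g , j₁ , U , i₂ , V , j₂ , e) →
             f , g , U
           , counts⇒Iso (proj₁ (countA f) i₁) (proj₁ (imageA U g f) i₂)
           , subst (Iso g B) (sym e) (counts⇒Iso (proj₁ (countB g f) j₁) (proj₁ (imageB V U g f) j₂)))
      , (λ (f , g , U , i , j) →
             f , proj₂ (countA f) (proj₁ (Iso⇒counts i))
           , g , proj₂ (countB g f) (proj₁ (Iso⇒counts j))
           , U , proj₂ (imageA U g f) (proj₂ (Iso⇒counts i))
           , U , proj₂ (imageB U U g f) (proj₂ (Iso⇒counts j)) , refl)

    ≅-false : False 𝔐 (i ≅̇ j) ρ ⟷ (∀ {f g U V} → Iso f A U → Iso g B V → U =⁻ V)
    ≅-false =
        (λ h {f} {g} {U} {V} i j →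
             h f (proj₂ (countA f) (proj₁ (Iso⇒counts i)))
               g (proj₂ (countB g f) (proj₁ (Iso⇒counts j)))
               U (proj₂ (imageA U g f) (proj₂ (Iso⇒counts i)))
               V (proj₂ (imageB V U g f) (proj₂ (Iso⇒counts j))))
      , (λ h f i₁ g j₁ U i₂ V j₂ →
             h (counts⇒Iso (proj₁ (countA f) i₁) (proj₁ (imageA U g f) i₂))
               (counts⇒Iso (proj₁ (countB g f) j₁) (proj₁ (imageB V U g f) j₂)))

    cardinal⇒isos : (Σ Dom λ c → CardinalNumber c A × CardinalNumber c B) →
                    Σ Dom λ f → Σ Dom λ g → Σ Dom λ U → Iso f A U × Iso g B U
    -- B itself serves as the common image.
    cardinal⇒isos (c , C , D) = _ , _ , B , proj₂ (cardinal⇒Iso C D) , proj₂ (Iso-refl B)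

    isos⇒cardinal : (Σ Dom λ f → Σ Dom λ g → Σ Dom λ U → Iso f A U × Iso g B U) →
                    Σ Dom λ c → CardinalNumber c A × CardinalNumber c B
    isos⇒cardinal (f , g , U , i , j) =
      _ , proj₂ (cardinalNumber A) , Iso⇒cardinal i j (proj₂ (cardinalNumber A))

    cardinal⇔≅ : True 𝔐 (∣ i ∣≐∣ j ∣ ⇔ i ≅̇ j) ρ
    cardinal⇔≅ =
        ( (λ t → proj₂ ≅-true (cardinal⇒isos (proj₁ (cardinal-true i j ρ) t)))
        , (λ t → proj₂ (cardinal-true i j ρ) (isos⇒cardinal (proj₁ ≅-true t))))
      , ( (λ t → proj₂ ≅-false λ i′ j′ → cardinal-=⁻⇒image-=⁻ i′ j′ (proj₁ (cardinal-false i j ρ) t))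
        , (λ t → proj₂ (cardinal-false i j ρ) λ c C d D → image-=⁻⇒cardinal-=⁻ (proj₁ ≅-false t) C D))

theorem5p2 : (ℓ : Level) → ExcludedMiddle ℓ →
    BZFC ⊨[ ℓ ] (∀̇ λ A → ∀̇ λ B → ∣ ↑ A ∣≐∣ B ∣ ⇔ ↑ A ≅̇ B)
-- The implicit lengths make the instance syntactically equal to the goal, which
-- Agda would otherwise compare by unfolding both sides completely.
theorem5p2 ℓ em 𝔐 axiom A B =
  SetTheory.cardinal⇔≅ em 𝔐 axiom (↑ (zero {0})) zero (_∷_ {n = suc 0} B (_∷_ {n = 0} A []))
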